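{- Let $m$ be an odd prime, $\alpha\ge2$, and $1\le k\le m-1$. Let $\Lambda_1$ be the quotient of $[m,2m,m^\alpha]^+$ by the relations $\sigma_2^2\sigma_1=\sigma_1\sigma_2^2$ and $\sigma_3\sigma_2^2=\sigma_2^2\sigma_3^{1+km^{\alpha-1}}$. Then $\Lambda_1$ is the automorphism group, with standard generators $\sigma_1,\sigma_2,\sigma_3$, of an atomic chiral $4$-polytope of type $\{m,2m,m^\alpha\}$.
   Context: $[p,q,r]^+=\langle\sigma_1,\sigma_2,\sigma_3\mid\sigma_1^p=\sigma_2^q=\sigma_3^r=(\sigma_1\sigma_2)^2=(\sigma_2\sigma_3)^2=(\sigma_1\sigma_2\sigma_3)^2=1\rangle$. Standard generators of a chiral polytope with base flag $\Phi$: $\Phi\sigma_i=\Phi^{i(i-1)}$, $\Phi^j$ the flag differing from $\Phi$ only in its $j$-face. Tight: type $\{p,q,r\}$ with exactly $2pqr$ flags. A tight chiral $4$-polytope is atomic if it does not properly cover any tight chiral polytope. -}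

module Defs where

open import Algebra.Bundles using (Group)
open import Algebra.Morphism.Structures using (IsGroupIsomorphism)
open import Data.Fin.Base as Fin using (Fin; zero; suc; toℕ; inject₁)
import Data.Fin.Properties as Fin
open import Data.List.Base using (List; length)
open import Data.List.Relation.Unary.All using (All)
open import Data.List.Relation.Unary.Any using (Any)
open import Data.List.Relation.Unary.Linked using (Linked)
open import Data.Nat.Base as ℕ using (ℕ; zero; suc; _∸_)
open import Data.Product.Base using (Σ; Σ-syntax; ∃-syntax; _×_; _,_; proj₁; proj₂)
open import Data.Sum.Base using (_⊎_)
open import Data.Vec.Base using (Vec; []; _∷_; lookup)
open import Function.Base using (_on_)
open import Function.Bundles using (Inverse; _⇔_)
open import Level using (0ℓ)
open import Relation.Binary.Bundles using (Poset; Setoid)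
open import Relation.Binary.Construct.Closure.Equivalence using (EqClosure)
open import Relation.Binary.Core using (Rel)
open import Relation.Binary.Definitions using (Maximum; Minimum)
import Relation.Binary.Construct.NonStrictToStrict as NonStrictToStrict
import Relation.Binary.Morphism.Construct.Composition as Composition
import Relation.Binary.Morphism.Construct.Identity as Identity
open import Relation.Binary.Morphism.Structures using (IsOrderIsomorphism)
open import Relation.Binary.PropositionalEquality.Core using (_≡_; _≢_)
import Relation.Binary.PropositionalEquality as ≡
open import Relation.Nullary.Negation.Core using (¬_)

infixl 7 _·_
infixl 8 _^ʷ_
infix  9 _⁻¹ʷ

data Word (X : Set) : Set where
  gen  : X → Word X
  1ʷ   : Word X
  _·_  : Word X → Word X → Word X
  _⁻¹ʷ : Word X → Word X

_^ʷ_ : {X : Set} → Word X → ℕ → Word X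
w ^ʷ zero  = 1ʷ
w ^ʷ suc n = w · w ^ʷ n

data Presented {X : Set} (R : Rel (Word X) 0ℓ) : Rel (Word X) 0ℓ where
  rel       : ∀ {u v} → R u v → Presented R u v
  refl      : ∀ {u} → Presented R u u
  sym       : ∀ {u v} → Presented R u v → Presented R v u
  trans     : ∀ {u v w} → Presented R u v → Presented R v w → Presented R u w
  ·-cong    : ∀ {u u′ v v′} → Presented R u u′ → Presented R v v′ →
              Presented R (u · v) (u′ · v′)
  ⁻¹-cong   : ∀ {u v} → Presented R u v → Presented R (u ⁻¹ʷ) (v ⁻¹ʷ)
  assoc     : ∀ u v w → Presented R (u · v · w) (u · (v · w))
  identityˡ : ∀ u → Presented R (1ʷ · u) u
  identityʳ : ∀ u → Presented R (u · 1ʷ) u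
  inverseˡ  : ∀ u → Presented R (u ⁻¹ʷ · u) 1ʷ
  inverseʳ  : ∀ u → Presented R (u · u ⁻¹ʷ) 1ʷ

⟨_⟩ : {X : Set} → Rel (Word X) 0ℓ → Group 0ℓ 0ℓ
⟨_⟩ {X} R = record
  { Carrier = Word X
  ; _≈_     = Presented R
  ; _∙_     = _·_
  ; ε       = 1ʷ
  ; _⁻¹     = _⁻¹ʷ
  ; isGroup = record
    { isMonoid = record
      { isSemigroup = record
        { isMagma = record
          { isEquivalence = record { refl = refl ; sym = sym ; trans = trans }
          ; ∙-cong        = ·-cong
          }
        ; assoc = assoc
        }
      ; identity = identityˡ , identityʳ
      }
    ; inverse = inverseˡ , inverseʳ
    ; ⁻¹-cong = ⁻¹-cong
    }
  }

σ₁ σ₂ σ₃ : Word (Fin 3)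
σ₁ = gen zero
σ₂ = gen (suc zero)
σ₃ = gen (suc (suc zero))

-- The defining relations of [p,q,r]⁺.
data RotationRel (p q r : ℕ) : Rel (Word (Fin 3)) 0ℓ where
  σ₁^p      : RotationRel p q r (σ₁ ^ʷ p) 1ʷ
  σ₂^q      : RotationRel p q r (σ₂ ^ʷ q) 1ʷ
  σ₃^r      : RotationRel p q r (σ₃ ^ʷ r) 1ʷ
  [σ₁σ₂]²   : RotationRel p q r ((σ₁ · σ₂) ^ʷ 2) 1ʷ
  [σ₂σ₃]²   : RotationRel p q r ((σ₂ · σ₃) ^ʷ 2) 1ʷ
  [σ₁σ₂σ₃]² : RotationRel p q r ((σ₁ · σ₂ · σ₃) ^ʷ 2) 1ʷ

data Λ₁Rel (m α k : ℕ) : Rel (Word (Fin 3)) 0ℓ where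
  rotation : ∀ {u v} → RotationRel m (2 ℕ.* m) (m ℕ.^ α) u v → Λ₁Rel m α k u v
  σ₂²σ₁    : Λ₁Rel m α k (σ₂ ^ʷ 2 · σ₁) (σ₁ · σ₂ ^ʷ 2)
  σ₃σ₂²    : Λ₁Rel m α k (σ₃ · σ₂ ^ʷ 2)
                         (σ₂ ^ʷ 2 · σ₃ ^ʷ (1 ℕ.+ k ℕ.* m ℕ.^ (α ∸ 1)))

Λ₁ : (m α k : ℕ) → Group 0ℓ 0ℓ
Λ₁ m α k = ⟨ Λ₁Rel m α k ⟩

-- The ranks -1, 0, …, n are represented by 0, 1, …, n + 1 in Fin (2 + n).
record Polytope (n : ℕ) : Set₁ where
  field
    faces : Poset 0ℓ 0ℓ 0ℓ

  open Poset faces public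
    using (_≈_; _≤_; module Eq) renaming (Carrier to Face)
  open NonStrictToStrict _≈_ _≤_ public using (_<_)

  Chain : List Face → Set
  Chain = Linked _<_

  MaximalChain : List Face → Set
  MaximalChain c = Chain c ×
    (∀ F → All (λ G → F ≤ G ⊎ G ≤ F) c → Any (F ≈_) c)

  -- The proper faces of the section G/F.
  Between : Face → Face → Set
  Between F G = Σ[ H ∈ Face ] (F < H × H < G)

  field
    rank      : Face → Fin (2 ℕ.+ n)
    rank-cong : ∀ {F G} → F ≈ G → rank F ≡ rank G
    rank-mono : ∀ {F G} → F < G → rank F Fin.< rank G

    least         : Face
    least-min     : Minimum _≤_ least
    greatest      : Face
    greatest-max  : Maximum _≤_ greatest

    -- A maximal chain is finite because rank is strictly monotone, so
    -- lists account for all of them.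
    maximal-length : ∀ c → MaximalChain c → length c ≡ 2 ℕ.+ n

    -- Every section of rank at least 2 is connected.
    connected : ∀ {F G} → F < G → 3 ℕ.+ toℕ (rank F) ℕ.≤ toℕ (rank G) →
                (H K : Between F G) → EqClosure (_≤_ on proj₁) H K

    diamond : ∀ {F G} → F < G → 2 ℕ.+ toℕ (rank F) ≡ toℕ (rank G) →
              Σ[ H ∈ Between F G ] Σ[ K ∈ Between F G ]
                (¬ proj₁ H ≈ proj₁ K ×
                 ((L : Between F G) → proj₁ L ≈ proj₁ H ⊎ proj₁ L ≈ proj₁ K))

-- A flag is a chain of n + 2 faces.  Strict monotonicity of rank forces
-- face i to have rank index i, and makes such a chain maximal.
record Flag {n} (P : Polytope n) : Set where
  open Polytope P
  field
    face   : Fin (2 ℕ.+ n) → Face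
    strict : ∀ {i j} → i Fin.< j → face i < face j

open Flag public using (face)

flags : ∀ {n} → Polytope n → Setoid 0ℓ 0ℓ
flags P = record
  { Carrier       = Flag P
  ; _≈_           = λ Φ Ψ → ∀ i → face Φ i ≈ face Ψ i
  ; isEquivalence = record
    { refl  = λ i → Eq.refl
    ; sym   = λ e i → Eq.sym (e i)
    ; trans = λ d e i → Eq.trans (d i) (e i)
    }
  }
  where open Polytope P

-- Adjacent P j Φ Ψ says that Ψ is Φʲ; the j-face of a flag is its face at
-- index j + 1.
Adjacent : ∀ {n} (P : Polytope n) → Fin n → Rel (Flag P) 0ℓ
Adjacent P j Φ Ψ =
  (∀ i → i ≢ suc (inject₁ j) → face Φ i ≈ face Ψ i) ×
  ¬ face Φ (suc (inject₁ j)) ≈ face Ψ (suc (inject₁ j))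
  where open Polytope P

-- Next i j says that j = i + 1 modulo p.
Next : ∀ {p} → Rel (Fin p) 0ℓ
Next {p} i j = toℕ j ≡ suc (toℕ i) ⊎ (suc (toℕ i) ≡ p × toℕ j ≡ 0)

-- The section G/F, of rank 2, is the face poset of a p-gon, whose i-th edge
-- joins the vertices i and i + 1 modulo p.
record IsPolygon {n} (P : Polytope n) (F G : Polytope.Face P) (p : ℕ) : Set where
  open Polytope P
  field
    vertex           : Fin p → Between F G
    edge             : Fin p → Between F G
    vertex-rank      : ∀ i → toℕ (rank (proj₁ (vertex i))) ≡ 1 ℕ.+ toℕ (rank F)
    edge-rank        : ∀ i → toℕ (rank (proj₁ (edge i))) ≡ 2 ℕ.+ toℕ (rank F)
    vertex-injective : ∀ {i j} → proj₁ (vertex i) ≈ proj₁ (vertex j) → i ≡ j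
    edge-injective   : ∀ {i j} → proj₁ (edge i) ≈ proj₁ (edge j) → i ≡ j
    exhaustive       : (H : Between F G) →
                       (∃[ i ] proj₁ H ≈ proj₁ (vertex i)) ⊎
                       (∃[ i ] proj₁ H ≈ proj₁ (edge i))
    incidence        : ∀ i j → proj₁ (vertex i) ≤ proj₁ (edge j) ⇔
                               (i ≡ j ⊎ Next j i)

-- Entry i of ps is the Schläfli number p_{i+1}: it describes the sections
-- between faces of ranks i - 1 and i + 2.
HasType : ∀ {r} → Polytope (suc r) → Vec ℕ r → Set
HasType P ps = ∀ i {F G} → F < G →
  toℕ (rank F) ≡ toℕ i → toℕ (rank G) ≡ 3 ℕ.+ toℕ i →
  IsPolygon P F G (lookup ps i)
  where open Polytope P

Tight : Polytope 4 → Set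
Tight P = Σ[ p ∈ ℕ ] Σ[ q ∈ ℕ ] Σ[ r ∈ ℕ ]
  (HasType P (p ∷ q ∷ r ∷ []) ×
   Inverse (≡.setoid (Fin (2 ℕ.* p ℕ.* q ℕ.* r))) (flags P))

record Isomorphism {m n} (P : Polytope m) (Q : Polytope n) : Set where
  private
    module P = Polytope P
    module Q = Polytope Q
  field
    to                 : P.Face → Q.Face
    isOrderIsomorphism : IsOrderIsomorphism P._≈_ Q._≈_ P._≤_ Q._≤_ to

  open IsOrderIsomorphism isOrderIsomorphism public
    using (cong; mono; injective; cancel; surjective)

open Isomorphism public using (to)

-- Automorphisms act on the right: f ∙ g means f followed by g.
Aut : ∀ {n} → Polytope n → Group 0ℓ 0ℓ
Aut P = record
  { Carrier = Isomorphism P P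
  ; _≈_     = λ f g → ∀ F → to f F ≈ to g F
  ; _∙_     = λ f g → record
    { to                 = λ F → to g (to f F)
    ; isOrderIsomorphism = Composition.isOrderIsomorphism Eq.trans
        (Isomorphism.isOrderIsomorphism f) (Isomorphism.isOrderIsomorphism g)
    }
  ; ε       = record
    { to                 = λ F → F
    ; isOrderIsomorphism = Identity.isOrderIsomorphism _≈_ _≤_ Eq.refl
    }
  ; _⁻¹     = inv
  ; isGroup = record
    { isMonoid = record
      { isSemigroup = record
        { isMagma = record
          { isEquivalence = record
            { refl  = λ F → Eq.refl
            ; sym   = λ e F → Eq.sym (e F)
            ; trans = λ d e F → Eq.trans (d F) (e F)
            }
          ; ∙-cong = λ {f} {f′} {g} {g′} d e F →
              Eq.trans (Isomorphism.cong g (d F)) (e (to f′ F))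
          }
        ; assoc = λ f g h F → Eq.refl
        }
      ; identity = (λ f F → Eq.refl) , (λ f F → Eq.refl)
      }
    ; inverse = (λ f → to-inv f)
              , (λ f F → Isomorphism.injective f (to-inv f (to f F)))
    ; ⁻¹-cong = λ {f} {g} e F → Isomorphism.injective f
        (Eq.trans (to-inv f F)
        (Eq.sym (Eq.trans (e (to (inv g) F)) (to-inv g F))))
    }
  }
  where
  open Polytope P
  open Poset faces using (≤-respˡ-≈; ≤-respʳ-≈)

  from : Isomorphism P P → Face → Face
  from f F = proj₁ (Isomorphism.surjective f F)

  to-from : ∀ f F → to f (from f F) ≈ F
  to-from f F = proj₂ (Isomorphism.surjective f F) Eq.refl

  inv : Isomorphism P P → Isomorphism P P
  inv f = record
    { to                 = from f
    ; isOrderIsomorphism = record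
      { isOrderMonomorphism = record
        { isOrderHomomorphism = record
          { cong = λ {F} {G} e → Isomorphism.injective f
              (Eq.trans (to-from f F) (Eq.trans e (Eq.sym (to-from f G))))
          ; mono = λ {F} {G} F≤G → Isomorphism.cancel f
              (≤-respˡ-≈ (Eq.sym (to-from f F))
              (≤-respʳ-≈ (Eq.sym (to-from f G)) F≤G))
          }
        ; injective = λ {F} {G} e →
            Eq.trans (Eq.sym (to-from f F))
            (Eq.trans (Isomorphism.cong f e) (to-from f G))
        ; cancel    = λ {F} {G} le →
            ≤-respˡ-≈ (to-from f F)
            (≤-respʳ-≈ (to-from f G) (Isomorphism.mono f le))
        }
      ; surjective = λ F → to f F , λ {G} e → Isomorphism.injective f
          (Eq.trans (to-from f G) e)
      }
    }

  to-inv : ∀ f F → to f (to (inv f) F) ≈ F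
  to-inv = to-from

infixl 6 _▹_

_▹_ : ∀ {n} {P : Polytope n} → Flag P → Isomorphism P P → Flag P
Φ ▹ f = record
  { face   = λ i → to f (face Φ i)
  ; strict = λ i<j → let F≤G , F≉G = Flag.strict Φ i<j in
      Isomorphism.mono f F≤G , λ e → F≉G (Isomorphism.injective f e)
  }

-- f is the standard generator σ_{i+1} for the base flag Φ, that is,
-- Φ f = (Φʲ)ʲ⁻¹ with j = i + 1; Ψ is the flag Φʲ.
IsStandardGenerator : ∀ {r} (P : Polytope (suc r)) → Flag P → Fin r →
                      Isomorphism P P → Set
IsStandardGenerator P Φ i f = Σ[ Ψ ∈ Flag P ]
  (Adjacent P (suc i) Φ Ψ × Adjacent P (inject₁ i) Ψ (Φ ▹ f))

SameOrbit : ∀ {n} (P : Polytope n) → Rel (Flag P) 0ℓ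
SameOrbit P Φ Ψ = Σ[ f ∈ Isomorphism P P ] Φ ▹ f ≈ Ψ
  where open Setoid (flags P)

-- The automorphism group has exactly two orbits on flags, and adjacent
-- flags lie in distinct orbits.
Chiral : ∀ {n} → Polytope n → Set
Chiral {n} P =
  (Σ[ Φ ∈ Flag P ] Σ[ Ψ ∈ Flag P ]
    (¬ SameOrbit P Φ Ψ × (∀ Υ → SameOrbit P Φ Υ ⊎ SameOrbit P Ψ Υ))) ×
  (∀ (j : Fin n) Φ Ψ → Adjacent P j Φ Ψ → ¬ SameOrbit P Φ Ψ)

record Covering {n} (P Q : Polytope n) : Set where
  private
    module P = Polytope P
    module Q = Polytope Q
  field
    map        : P.Face → Q.Face
    cong       : ∀ {F G} → F P.≈ G → map F Q.≈ map G
    mono       : ∀ {F G} → F P.≤ G → map F Q.≤ map G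
    rank-map   : ∀ F → Q.rank (map F) ≡ P.rank F
    surjective : ∀ G → Σ[ F ∈ P.Face ] map F Q.≈ G

  mapFlag : Flag P → Flag Q
  mapFlag Φ = record
    { face   = λ i → map (face Φ i)
    ; strict = λ {i} {j} i<j →
        mono (proj₁ (Flag.strict Φ i<j)) ,
        λ e → Fin.<⇒≢ (P.rank-mono (Flag.strict Φ i<j))
          (≡.trans (≡.sym (rank-map (face Φ i)))
          (≡.trans (Q.rank-cong e) (rank-map (face Φ j))))
    }

  field
    adjacency : ∀ j Φ Ψ → Adjacent P j Φ Ψ →
                Adjacent Q j (mapFlag Φ) (mapFlag Ψ)

ProperlyCovers : ∀ {n} → Polytope n → Polytope n → Set
ProperlyCovers P Q = Covering P Q × ¬ Isomorphism P Q

Atomic : Polytope 4 → Set₁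
Atomic P = Tight P × Chiral P ×
  (∀ (Q : Polytope 4) → Tight Q → Chiral Q → ¬ ProperlyCovers P Q)

-- G is the automorphism group of P, and its elements g 0, g 1, … are the
-- standard generators with respect to some base flag.
IsAutomorphismGroup : ∀ {r} (G : Group 0ℓ 0ℓ) → (Fin r → Group.Carrier G) →
                      Polytope (suc r) → Set
IsAutomorphismGroup G g P =
  Σ[ Φ ∈ Flag P ] Σ[ φ ∈ (Group.Carrier G → Isomorphism P P) ]
    (IsGroupIsomorphism (Group.rawGroup G) (Group.rawGroup (Aut P)) φ ×
     (∀ i → IsStandardGenerator P Φ i (φ (g i))))

{-# OPTIONS --safe #-}

-- Λ₁ is the semidirect product of the normal subgroup generated by σ₁, σ₂² and
-- σ₃ with the group of order 2 generated by τ = σ₁σ₂, so its elements have the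
-- form τ^ε σ₁^i σ₂^2l σ₃^j.  In these coordinates its coset geometry becomes
-- explicit: there are vertices V i, edges E x y, 2-faces H j l and facets T t,
-- where i, x, y, l are integers modulo m and j, t are integers modulo m^α; the
-- edge E x y joins V (x - 1) and V x, and lies on H j l if l ≡ y + x j mod m;
-- the 2-face H j l separates T j and T (j + 1 + 2sl), with 2s ≡ k m^(α-1) mod m^α;
-- all other pairs of faces of different ranks are incident.
--
-- Automorphisms are determined by the image of one flag, because the flag graph
-- is connected.  An automorphism that takes the base flag to its 0-adjacent flag
-- would fix all facets, since they all lie on the edge E 0 0, but following the
-- facets on the edge E 1 0 one sees that it would take T (2 + 2s) to T (2 - 2s).
-- Hence the polytope is chiral.
--
-- Let it cover a chiral polytope Q.  The generators of Λ₁ act on Q, so the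
-- identifications of faces made by the covering are invariant under Λ₁.  If T 0
-- and T s are not identified, then nothing is.  If they are, the map that negates
-- x, y, l and sends V i to V (-1 - i) respects the identifications and the
-- induced order; it takes a flag of Q to its 0-adjacent flag, which is absurd.
module Submission where

open import Defs
open import Algebra.Bundles using (Group)
open import Algebra.Morphism.Structures using (IsGroupIsomorphism)
import Algebra.Properties.Group as GroupProperties
open import Data.Bool.Base using (Bool; true; false; not; _xor_)
open import Data.Bool.Properties using (not-involutive)
open import Data.Empty using (⊥; ⊥-elim)
open import Data.Fin.Base as Fin using (Fin; zero; suc; toℕ; inject₁; fromℕ; fromℕ<; combine; remQuot)
open import Data.Fin.Induction using (<-weakInduction; >-weakInduction)
open import Data.Fin.Patterns using (1F; 2F; 3F; 4F; 5F)
import Data.Fin.Properties as Fin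
open import Data.Integer.Base as ℤ using (ℤ; _^_; +_; 0ℤ; 1ℤ; _+_; _-_; _*_; -_)
import Data.Integer.Divisibility.Signed as Signed
import Data.Integer.DivMod as ℤ
import Data.Integer.Properties as ℤ
open import Data.Integer.Tactic.RingSolver using (solve-∀)
open import Data.List.Base as List using (List; length; lookup)
open import Data.List.Membership.Propositional using (_∈_; find; lose)
open import Data.List.Membership.Propositional.Properties using (∈-lookup)
open import Data.List.Relation.Unary.All as All using (All)
open import Data.List.Relation.Unary.AllPairs as AllPairs using (AllPairs)
open import Data.List.Relation.Unary.Any as Any using (Any; here; there)
open import Data.List.Relation.Unary.Any.Properties using (lookup-index)
open import Data.List.Relation.Unary.Linked using (Linked)
import Data.List.Relation.Unary.Linked.Properties as Linked
open import Data.Nat.Base as ℕ using (ℕ; zero; suc)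
open import Data.Nat.Coprimality using (prime⇒coprime; coprime-Bézout)
open import Data.Nat.Divisibility using (_∣_; _∤_; divides; ∣⇒≤)
import Data.Nat.DivMod as ℕ
open import Data.Nat.GCD using (module Bézout)
open import Data.Nat.Primality using (Prime; prime⇒nonZero; prime⇒nonTrivial; euclidsLemma)
import Data.Nat.Properties as ℕ
open import Data.Product.Base using (Σ-syntax; ∃-syntax; _×_; _,_; proj₁; proj₂; uncurry)
open import Data.Sum.Base as Sum using (_⊎_; inj₁; inj₂; [_,_]′)
open import Data.Vec.Base using ([]; _∷_)
open import Function.Base using (_on_)
open import Function.Bundles using (mk⇔; Inverse)
open import Level using (0ℓ)
open import Relation.Binary.Bundles using (Poset; Setoid)
open import Relation.Binary.Construct.Closure.Equivalence as EqClosure using (EqClosure)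
open import Relation.Binary.Construct.Closure.ReflexiveTransitive using (ε; _◅_; _◅◅_)
open import Relation.Binary.Construct.Closure.Symmetric using (fwd; bwd)
import Relation.Binary.Construct.NonStrictToStrict as NonStrictToStrict
open import Relation.Binary.Core using (Rel)
open import Relation.Binary.Definitions using (tri<; tri≈; tri>)
open import Relation.Binary.PropositionalEquality using (setoid)
open import Relation.Binary.PropositionalEquality.Core as ≡ using (_≡_; _≢_; refl; cong; cong₂; subst; subst₂)
import Relation.Binary.Reasoning.Setoid as SetoidReasoning
open import Relation.Nullary.Decidable.Core using (Dec; yes; no; map′; True; toWitness)
open import Relation.Nullary.Negation.Core using (¬_; contradiction)
import Tactic.MonoidSolver as MonoidSolver

-- Congruences of integers

-- Coordinates are integers and nearly all verifications are polynomial identities, for two reasons.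
-- As `α` is at least 2, `s` vanishes modulo `m` and `s * m` vanishes modulo `r`: a correction
-- `s * x` depends only on `x` modulo `m` and does not notice other corrections. Moreover, summing
-- the steps `1 + 2s(y + x i)` around an edge produces binomial coefficients; taking half of
-- `k m^(α-1)` as the constant `s` replaces them by the polynomial `n (n - 1)`.
--
-- Rewriting in the presented group yields only that every word has a normal form. That distinct
-- normal forms are distinct elements is read off from their action on faces, so no multiplication
-- rule for normal forms has to be worked out.
--
-- A covered polytope `Q` is abstract: its faces have no coordinates and their equality cannot be
-- decided. It is studied through the relations that the covering induces on the explicit faces; its
-- order has to be recovered from the diamond condition. Since only a negation is wanted in the end,
-- the case distinction on `T 0` and `T s` can be made under a double negation.

infix 4 _≋_mod_

-- The quotient is explicit so that matching on `mod q refl` eliminates `x` and leaves an identity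
-- to the ring solver. The modulus is any integer, such as the symbolic product `w * m * m`.
data _≋_mod_ (x y n : ℤ) : Set where
  mod : ∀ q → x ≡ y + q * n → x ≋ y mod n

module _ {n : ℤ} where

  ≡⇒≋ : ∀ {x y} → x ≡ y → x ≋ y mod n
  ≡⇒≋ {x} refl = mod 0ℤ (identity x n)
    where
    identity : ∀ x n → x ≡ x + 0ℤ * n
    identity = solve-∀

  ≋-refl : ∀ {x} → x ≋ x mod n
  ≋-refl = ≡⇒≋ refl

  -- Multiples of `n` form an ideal, so a congruence follows once the difference of its sides is
  -- written as a combination of known differences. The coefficients `c`, `d`, `q` are supplied by
  -- hand and the equation by the ring solver.
  ≋-combine : ∀ {x y x′ y′ z z′} c d q → x ≋ y mod n → x′ ≋ y′ mod n →
              z - z′ ≡ c * (x - y) + d * (x′ - y′) + q * n → z ≋ z′ mod n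
  ≋-combine {x} {y} {x′} {y′} {z} {z′} c d q (mod a refl) (mod b refl) e =
    mod (c * a + d * b + q)
        (≡.trans (lhs z z′) (≡.trans (cong (λ t → z′ + t) e) (rhs z′ y y′ a b c d q n)))
    where
    lhs : ∀ z z′ → z ≡ z′ + (z - z′)
    lhs = solve-∀
    rhs : ∀ z′ y y′ a b c d q n →
          z′ + (c * (y + a * n - y) + d * (y′ + b * n - y′) + q * n) ≡
          z′ + (c * a + d * b + q) * n
    rhs = solve-∀

  ≋-linear : ∀ {x y z z′} c q → x ≋ y mod n →
             z - z′ ≡ c * (x - y) + q * n → z ≋ z′ mod n
  ≋-linear {x} {y} {z} {z′} c q e f = ≋-combine c 0ℤ q e e (≡.trans f (identity x y c q n))
    where
    identity : ∀ x y c q n → c * (x - y) + q * n ≡ c * (x - y) + 0ℤ * (x - y) + q * n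
    identity = solve-∀

  ≋-sym : ∀ {x y} → x ≋ y mod n → y ≋ x mod n
  ≋-sym {x} {y} e = ≋-linear (- 1ℤ) 0ℤ e (identity x y n)
    where
    identity : ∀ x y n → y - x ≡ - 1ℤ * (x - y) + 0ℤ * n
    identity = solve-∀

  ≋-trans : ∀ {x y z} → x ≋ y mod n → y ≋ z mod n → x ≋ z mod n
  ≋-trans {x} {y} {z} e f = ≋-combine 1ℤ 1ℤ 0ℤ e f (identity x y z n)
    where
    identity : ∀ x y z n → x - z ≡ 1ℤ * (x - y) + 1ℤ * (y - z) + 0ℤ * n
    identity = solve-∀

  +-cong : ∀ {x y x′ y′} → x ≋ y mod n → x′ ≋ y′ mod n → x + x′ ≋ y + y′ mod n
  +-cong {x} {y} {x′} {y′} e f = ≋-combine 1ℤ 1ℤ 0ℤ e f (identity x y x′ y′ n)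
    where
    identity : ∀ x y x′ y′ n →
               x + x′ - (y + y′) ≡ 1ℤ * (x - y) + 1ℤ * (x′ - y′) + 0ℤ * n
    identity = solve-∀

  *-cong : ∀ {x y x′ y′} → x ≋ y mod n → x′ ≋ y′ mod n → x * x′ ≋ y * y′ mod n
  *-cong {x} {y} {x′} {y′} e f = ≋-combine x′ y 0ℤ e f (identity x y x′ y′ n)
    where
    identity : ∀ x y x′ y′ n →
               x * x′ - y * y′ ≡ x′ * (x - y) + y * (x′ - y′) + 0ℤ * n
    identity = solve-∀

  neg-cong : ∀ {x y} → x ≋ y mod n → - x ≋ - y mod n
  neg-cong {x} {y} e = ≋-linear (- 1ℤ) 0ℤ e (identity x y n)
    where
    identity : ∀ x y n → - x - - y ≡ - 1ℤ * (x - y) + 0ℤ * n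
    identity = solve-∀

  +-congˡ : ∀ a {x y} → x ≋ y mod n → a + x ≋ a + y mod n
  +-congˡ a = +-cong (≋-refl {a})

  +-congʳ : ∀ a {x y} → x ≋ y mod n → x + a ≋ y + a mod n
  +-congʳ a e = +-cong e (≋-refl {a})

  *-congˡ : ∀ a {x y} → x ≋ y mod n → a * x ≋ a * y mod n
  *-congˡ a = *-cong (≋-refl {a})

  +-cancelʳ : ∀ a {x y} → x + a ≋ y + a mod n → x ≋ y mod n
  +-cancelʳ a {x} {y} e = ≋-linear 1ℤ 0ℤ e (identity x y a n)
    where
    identity : ∀ x y a n → x - y ≡ 1ℤ * (x + a - (y + a)) + 0ℤ * n
    identity = solve-∀

  ∣⇒≋ : ∀ {x y} → n Signed.∣ (x - y) → x ≋ y mod n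
  ∣⇒≋ {x} {y} (Signed.divides q e) = mod q (≡.trans (identity x y) (cong (λ t → y + t) e))
    where
    identity : ∀ x y → x ≡ y + (x - y)
    identity = solve-∀

  ≋⇒∣ : ∀ {x y} → x ≋ y mod n → n Signed.∣ (x - y)
  ≋⇒∣ {x} {y} (mod q refl) = Signed.divides q (identity y (q * n))
    where
    identity : ∀ x y → x + y - x ≡ y
    identity = solve-∀

  _≋?_ : ∀ x y → Dec (x ≋ y mod n)
  x ≋? y = map′ ∣⇒≋ ≋⇒∣ (n Signed.∣? (x - y))

≋-weaken : ∀ {x y n} k → x ≋ y mod (k * n) → x ≋ y mod n
≋-weaken {y = y} {n} k (mod q refl) = mod (q * k) (identity y q k n)
  where
  identity : ∀ y q k n → y + q * (k * n) ≡ y + q * k * n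
  identity = solve-∀

*-scale : ∀ k {x y n} → x ≋ y mod n → k * x ≋ k * y mod (k * n)
*-scale k {y = y} {n} (mod q refl) = mod q (identity k y q n)
  where
  identity : ∀ k y q n → k * (y + q * n) ≡ k * y + q * (k * n)
  identity = solve-∀

module _ (n : ℕ) .{{_ : ℕ.NonZero n}} where

  residue : ℤ → ℕ
  residue x = x ℤ.%ℕ n

  residue<n : ∀ x → residue x ℕ.< n
  residue<n x = ℤ.n%ℕd<d x n

  ≋-residue : ∀ x → x ≋ + residue x mod (+ n)
  ≋-residue x = mod (x ℤ./ℕ n) (ℤ.a≡a%ℕn+[a/ℕn]*n x n)

  <⇒≋⇒≡ : ∀ {a b} → a ℕ.< n → b ℕ.< n → + a ≋ + b mod (+ n) → a ≡ b
  <⇒≋⇒≡ {a} {b} a<n b<n (mod (+ k) e) = nonneg k a b a<n e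
    where
    nonneg : ∀ k a b → a ℕ.< n → + a ≡ + b + + k * + n → a ≡ b
    nonneg k a b a<n e with ≡.trans e (≡.sym (≡.trans (ℤ.pos-+ b (k ℕ.* n))
        (cong (λ t → + b + t) (ℤ.pos-* k n))))
    nonneg zero a b a<n e | f = ≡.trans (ℤ.+-injective f) (ℕ.+-identityʳ b)
    nonneg (suc k) a b a<n e | f = contradiction
      (ℕ.≤-trans (ℕ.m≤m+n n (k ℕ.* n)) (ℕ.≤-trans (ℕ.m≤n+m _ b) (ℕ.≤-reflexive (≡.sym (ℤ.+-injective f)))))
      (ℕ.<⇒≱ a<n)
  -- A negative quotient becomes positive when `a` and `b` change places.
  <⇒≋⇒≡ {a} {b} a<n b<n (mod q@(ℤ.-[1+ k ]) e) = ≡.sym (<⇒≋⇒≡ b<n a<n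
    (mod (- q) (≡.trans (identity (+ b) q (+ n)) (cong (λ t → t + - q * + n) (≡.sym e)))))
    where
    identity : ∀ b q n → b ≡ b + q * n + - q * n
    identity = solve-∀

ℤ-induction : ∀ {p} (P : ℤ → Set p) → P 0ℤ →
              (∀ i → P i → P (i + 1ℤ)) → (∀ i → P (i + 1ℤ) → P i) → ∀ i → P i
ℤ-induction P z up down (+ zero) = z
ℤ-induction P z up down (+ suc n) = subst P (cong +_ (ℕ.+-comm n 1))
    (up (+ n) (ℤ-induction P z up down (+ n)))
ℤ-induction P z up down ℤ.-[1+ zero ] = down ℤ.-[1+ zero ] z
ℤ-induction P z up down ℤ.-[1+ suc n ] = down ℤ.-[1+ suc n ] (ℤ-induction P z up down ℤ.-[1+ n ])

≋-cast : ∀ {x y n n′} → n ≡ n′ → x ≋ y mod n → x ≋ y mod n′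
≋-cast refl e = e

module _ {m : ℕ} (m-prime : Prime m) where

  private instance
    m≢0 : ℕ.NonZero m
    m≢0 = prime⇒nonZero m-prime

  invertible : ∀ {d} → ¬ d ≋ 0ℤ mod (+ m) → ∃[ n ] n * d ≋ 1ℤ mod (+ m)
  invertible {d} d≢0 with residue m d in eq
  ... | zero  = contradiction (≋-trans (≋-residue m d) (≡⇒≋ (cong +_ eq))) d≢0
  ... | suc a = inverse (coprime-Bézout (prime⇒coprime m-prime a<m))
    where
    d≋a : d ≋ + suc a mod (+ m)
    d≋a = ≋-trans (≋-residue m d) (≡⇒≋ (cong +_ eq))

    a<m : suc a ℕ.< m
    a<m = subst (ℕ._< m) eq (residue<n m d)

    lift : ∀ {x y b c} → 1 ℕ.+ y ℕ.* b ≡ x ℕ.* c → 1ℤ + + y * + b ≡ + x * + c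
    lift {x} {y} {b} {c} e = ≡.trans (cong (λ t → 1ℤ + t) (≡.sym (ℤ.pos-* y b)))
      (≡.trans (≡.sym (ℤ.pos-+ 1 (y ℕ.* b))) (≡.trans (cong +_ e) (ℤ.pos-* x c)))

    inverse : Bézout.Identity 1 m (suc a) → ∃[ n ] n * d ≋ 1ℤ mod (+ m)
    inverse (Bézout.+- x y e) = - + y , ≋-trans (*-congˡ (- + y) d≋a)
      (mod (- + x) (≡.trans (identity (+ y) (+ suc a))
          (≡.trans (cong (λ t → 1ℤ + - t) (lift {x} {y} e)) (identity′ (+ x) (+ m)))))
      where
      identity : ∀ y a → - y * a ≡ 1ℤ + - (1ℤ + y * a)
      identity = solve-∀
      identity′ : ∀ x m → 1ℤ + - (x * m) ≡ 1ℤ + - x * m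
      identity′ = solve-∀
    inverse (Bézout.-+ x y e) = + y , ≋-trans (*-congˡ (+ y) d≋a)
      (mod (+ x) (≡.sym (lift {y} {x} e)))

  -- The errors `n * d - 1` and `n′ * d - 1` are divisible by `m` and `m ^ α`, so their product
  -- vanishes modulo `m ^ suc α`; one minus this product is a multiple of `d`, and the cofactor is
  -- the new inverse.
  invertible-^ : ∀ {d} → ¬ d ≋ 0ℤ mod (+ m) → ∀ α → ∃[ n ] n * d ≋ 1ℤ mod (+ m) ^ α
  invertible-^ {d} d≢0 zero    = 0ℤ , mod (- 1ℤ) refl
  invertible-^ {d} d≢0 (suc α) with invertible d≢0 | invertible-^ d≢0 α
  ... | n , mod q e | n′ , mod q′ e′ = n + n′ - n * (n′ * d) ,
    mod (- (q * q′)) (≡.trans (lhs n n′ d) (≡.trans (cong₂ (λ s t → 1ℤ - (s - 1ℤ) * (t - 1ℤ)) e e′)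
        (rhs q q′ (+ m) ((+ m) ^ α))))
    where
    lhs : ∀ n n′ d → (n + n′ - n * (n′ * d)) * d ≡ 1ℤ - (n * d - 1ℤ) * (n′ * d - 1ℤ)
    lhs = solve-∀
    rhs : ∀ q q′ m p → 1ℤ - (1ℤ + q * m - 1ℤ) * (1ℤ + q′ * p - 1ℤ) ≡ 1ℤ + - (q * q′) * (m * p)
    rhs = solve-∀

  -- The integers modulo a prime power have a least nonzero ideal, generated by `m ^ α`; factors `m`
  -- are stripped from `d` until a unit is left. Hence any proper identification of facets in a
  -- quotient entails that of `T 0ℤ` and `T s`.
  multiple-≋-power : ∀ α {d} → ¬ d ≋ 0ℤ mod (+ m) ^ suc α →
                     ∃[ n ] n * d ≋ (+ m) ^ α mod (+ m) ^ suc α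
  multiple-≋-power α {d} d≢0 with d ≋? 0ℤ
  ... | no  m∤d with invertible-^ m∤d (suc α)
  ...   | n , e = (+ m) ^ α * n , ≋-trans (≡⇒≋ (ℤ.*-assoc ((+ m) ^ α) n d))
                    (≋-trans (*-congˡ ((+ m) ^ α) e) (≡⇒≋ (ℤ.*-identityʳ _)))
  multiple-≋-power zero    d≢0 | yes m∣d = contradiction (≋-cast (≡.sym (ℤ.*-identityʳ (+ m))) m∣d) d≢0
  multiple-≋-power (suc α) d≢0 | yes (mod q refl)
    with multiple-≋-power α {q} (λ q≋0 → d≢0 (≋-trans (≡⇒≋ (identity q (+ m)))
        (≋-trans (*-scale (+ m) q≋0) (≡⇒≋ (ℤ.*-zeroʳ (+ m))))))
    where
    identity : ∀ q m → 0ℤ + q * m ≡ m * q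
    identity = solve-∀
  ... | n , e = n , ≋-trans (≡⇒≋ (identity n q (+ m))) (*-scale (+ m) e)
    where
    identity : ∀ n q m → n * (0ℤ + q * m) ≡ m * (n * q)
    identity = solve-∀

-- Flags of a polytope

-- Induction from the top keeps `f` below the identity, induction from the bottom keeps it above.
-- Applied to ranks, it shows that the face of a flag at index `i` has rank `i`.
strictlyMonotone⇒id : ∀ {n} (f : Fin (suc n) → Fin (suc n)) →
                      (∀ {i j} → i Fin.< j → f i Fin.< f j) → ∀ i → f i ≡ i
strictlyMonotone⇒id {n} f mono i = Fin.toℕ-injective (ℕ.≤-antisym
  (>-weakInduction (λ i → toℕ (f i) ℕ.≤ toℕ i)
    (ℕ.≤-trans (Fin.toℕ≤pred[n] (f (fromℕ n))) (ℕ.≤-reflexive (≡.sym (Fin.toℕ-fromℕ n))))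
    (λ i h → ℕ.≤-pred (ℕ.≤-trans (mono (step i))
        (ℕ.≤-trans h (ℕ.≤-reflexive (cong suc (≡.sym (Fin.toℕ-inject₁ i)))))))
    i)
  (<-weakInduction (λ i → toℕ i ℕ.≤ toℕ (f i)) ℕ.z≤n
    (λ i h → ℕ.≤-trans (ℕ.s≤s (ℕ.≤-trans (ℕ.≤-reflexive (≡.sym (Fin.toℕ-inject₁ i))) h)) (mono (step i)))
    i))
  where
  step : ∀ (i : Fin n) → inject₁ i Fin.< suc i
  step i = ℕ.s≤s (ℕ.≤-reflexive (Fin.toℕ-inject₁ i))

module _ {n : ℕ} (P : Polytope n) where
  open Polytope P
  open Setoid (flags P) using () renaming (_≈_ to _≈ᶠ_)

  rank-face : ∀ (Φ : Flag P) i → rank (face Φ i) ≡ i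
  rank-face Φ = strictlyMonotone⇒id (λ i → rank (face Φ i)) (λ i<j → rank-mono (Flag.strict Φ i<j))

  -- The axiom provides some pair of faces; by the pigeonhole principle any two distinct faces of
  -- the section are that pair.
  diamond-third : ∀ {F G} → F < G → 2 ℕ.+ toℕ (rank F) ≡ toℕ (rank G) →
                  ∀ {A B C} → F < A × A < G → F < B × B < G → F < C × C < G →
                  ¬ A ≈ B → C ≈ A ⊎ C ≈ B
  diamond-third F<G e {A} {B} {C} a b c A≉B with diamond F<G e
  ... | H , K , _ , only with only (A , a) | only (B , b) | only (C , c)
  ... | inj₁ A≈H | inj₁ B≈H | _        = contradiction (Eq.trans A≈H (Eq.sym B≈H)) A≉B
  ... | inj₁ A≈H | inj₂ B≈K | inj₁ C≈H = inj₁ (Eq.trans C≈H (Eq.sym A≈H))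
  ... | inj₁ A≈H | inj₂ B≈K | inj₂ C≈K = inj₂ (Eq.trans C≈K (Eq.sym B≈K))
  ... | inj₂ A≈K | inj₁ B≈H | inj₁ C≈H = inj₂ (Eq.trans C≈H (Eq.sym B≈H))
  ... | inj₂ A≈K | inj₁ B≈H | inj₂ C≈K = inj₁ (Eq.trans C≈K (Eq.sym A≈K))
  ... | inj₂ A≈K | inj₂ B≈K | _        = contradiction (Eq.trans A≈K (Eq.sym B≈K)) A≉B

  private
    <-resp : ∀ {A B C D} → A ≈ B → C ≈ D → A < C → B < D
    <-resp A≈B C≈D (A≤C , A≉C) =
      Poset.≤-respˡ-≈ faces A≈B (Poset.≤-respʳ-≈ faces C≈D A≤C) ,
      λ B≈D → A≉C (Eq.trans A≈B (Eq.trans B≈D (Eq.sym C≈D)))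

  adjacent-resp : ∀ {j} {Φ Φ′ Ψ Ψ′ : Flag P} → Φ ≈ᶠ Φ′ → Ψ ≈ᶠ Ψ′ → Adjacent P j Φ Ψ → Adjacent P j Φ′ Ψ′
  adjacent-resp {j} d e (same , differ) =
    (λ i i≢ → Eq.trans (Eq.sym (d i)) (Eq.trans (same i i≢) (e i))) ,
    λ f → differ (Eq.trans (d _) (Eq.trans f (Eq.sym (e _))))

  -- The diamond around the `j`-face leaves one alternative. All rigidity arguments rest on this
  -- uniqueness.
  adjacent-unique : ∀ {j} {Φ Ψ Υ : Flag P} → Adjacent P j Φ Ψ → Adjacent P j Φ Υ → Ψ ≈ᶠ Υ
  adjacent-unique {j} {Φ} {Ψ} {Υ} (same , differ) (same′ , differ′) i with i Fin.≟ suc (inject₁ j)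
  ... | no i≢ = Eq.trans (Eq.sym (same i i≢)) (same′ i i≢)
  ... | yes refl = choose (diamond-third (Flag.strict Φ (ℕ.<-trans below above)) ranks
                     (Flag.strict Φ below , Flag.strict Φ above) (between Ψ same) (between Υ same′) differ)
    where
    below : inject₁ (inject₁ j) Fin.< suc (inject₁ j)
    below = ℕ.s≤s (ℕ.≤-reflexive (Fin.toℕ-inject₁ (inject₁ j)))

    above : suc (inject₁ j) Fin.< suc (suc j)
    above = ℕ.s≤s (ℕ.s≤s (ℕ.≤-reflexive (Fin.toℕ-inject₁ j)))

    ranks : 2 ℕ.+ toℕ (rank (face Φ (inject₁ (inject₁ j)))) ≡ toℕ (rank (face Φ (suc (suc j))))
    ranks rewrite rank-face Φ (inject₁ (inject₁ j)) | rank-face Φ (suc (suc j))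
                | Fin.toℕ-inject₁ (inject₁ j) | Fin.toℕ-inject₁ j = refl

    between : ∀ Ω → (∀ i → i ≢ suc (inject₁ j) → face Φ i ≈ face Ω i) →
              face Φ (inject₁ (inject₁ j)) < face Ω (suc (inject₁ j)) ×
              face Ω (suc (inject₁ j)) < face Φ (suc (suc j))
    between Ω same =
      <-resp (Eq.sym (same _ λ e → Fin.<⇒≢ below e)) Eq.refl (Flag.strict Ω below) ,
      <-resp Eq.refl (Eq.sym (same _ λ e → Fin.<⇒≢ above (≡.sym e))) (Flag.strict Ω above)

    choose : face Υ i ≈ face Φ i ⊎ face Υ i ≈ face Ψ i → face Ψ i ≈ face Υ i
    choose (inj₁ e) = contradiction (Eq.sym e) differ′
    choose (inj₂ e) = Eq.sym e

  ▹-adjacent : ∀ {j} {Φ Ψ : Flag P} (f : Isomorphism P P) → Adjacent P j Φ Ψ → Adjacent P j (Φ ▹ f) (Ψ ▹ f)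
  ▹-adjacent f (same , differ) = (λ i i≢ → Isomorphism.cong f (same i i≢)) ,
    λ e → differ (Isomorphism.injective f e)

-- Polygonal sections

module _ (X : Poset 0ℓ 0ℓ 0ℓ) where
  open Poset X using (_≈_; _≤_; module Eq; ≤-respˡ-≈; ≤-respʳ-≈) renaming (Carrier to Face)
  open NonStrictToStrict _≈_ _≤_ using (_<_)

  -- An N-gon (an apeirogon if N is 0), its vertices and edges indexed by the
  -- integers modulo N.
  record CyclicSection (F G : Face) (N : ℤ) : Set where
    field
      vertex           : ℤ → Face
      edge             : ℤ → Face
      vertex-between   : ∀ s → F < vertex s × vertex s < G
      edge-between     : ∀ s → F < edge s × edge s < G
      vertex-cong      : ∀ {s t} → s ≋ t mod N → vertex s ≈ vertex t
      edge-cong        : ∀ {s t} → s ≋ t mod N → edge s ≈ edge t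
      vertex-injective : ∀ {s t} → vertex s ≈ vertex t → s ≋ t mod N
      edge-injective   : ∀ {s t} → edge s ≈ edge t → s ≋ t mod N
      exhaustive       : ∀ {H} → F < H → H < G → (∃[ s ] H ≈ vertex s) ⊎ (∃[ s ] H ≈ edge s)
      start            : ∀ s → vertex s ≤ edge s
      end              : ∀ s → vertex (s + 1ℤ) ≤ edge s
      incident⇒        : ∀ {s t} → vertex s ≤ edge t → s ≋ t mod N ⊎ s ≋ t + 1ℤ mod N

    connected : (H K : Σ[ H ∈ Face ] (F < H × H < G)) → EqClosure (_≤_ on proj₁) H K
    connected H K = toV₀ H ◅◅ EqClosure.symmetric _ (toV₀ K)
      where
      _∼_ : (H K : Σ[ H ∈ Face ] (F < H × H < G)) → Set
      _∼_ = EqClosure (_≤_ on proj₁)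

      V : ℤ → Σ[ H ∈ Face ] (F < H × H < G)
      V s = vertex s , vertex-between s

      V∼V₀ : ∀ s → V s ∼ V 0ℤ
      V∼V₀ = ℤ-induction (λ s → V s ∼ V 0ℤ) ε
        (λ s h → _◅_ {j = edge s , edge-between s} (fwd (end s)) (bwd (start s) ◅ h))
        (λ s h → _◅_ {j = edge s , edge-between s} (fwd (start s)) (bwd (end s) ◅ h))

      toV₀ : ∀ H → H ∼ V 0ℤ
      toV₀ (H , F<H , H<G) with exhaustive F<H H<G
      ... | inj₁ (s , e) = fwd (Poset.reflexive X e) ◅ V∼V₀ s
      ... | inj₂ (s , e) = bwd (≤-respʳ-≈ (Eq.sym e) (start s)) ◅ V∼V₀ s

  -- A 2N-gon: the vertex and the edge (b , s) have index 2s, or 2s + 1 if b is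
  -- true.
  record AlternatingSection (F G : Face) (N : ℤ) : Set where
    field
      vertex           : Bool → ℤ → Face
      edge             : Bool → ℤ → Face
      vertex-between   : ∀ b s → F < vertex b s × vertex b s < G
      edge-between     : ∀ b s → F < edge b s × edge b s < G
      vertex-cong      : ∀ b {s t} → s ≋ t mod N → vertex b s ≈ vertex b t
      edge-cong        : ∀ b {s t} → s ≋ t mod N → edge b s ≈ edge b t
      vertex-injective : ∀ {b c s t} → vertex b s ≈ vertex c t → b ≡ c × s ≋ t mod N
      edge-injective   : ∀ {b c s t} → edge b s ≈ edge c t → b ≡ c × s ≋ t mod N
      exhaustive       : ∀ {H} → F < H → H < G →
                         (∃[ b ] ∃[ s ] H ≈ vertex b s) ⊎ (∃[ b ] ∃[ s ] H ≈ edge b s)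
      even-even        : ∀ s → vertex false s ≤ edge false s
      odd-even         : ∀ s → vertex true s ≤ edge false s
      odd-odd          : ∀ s → vertex true s ≤ edge true s
      even-odd         : ∀ s → vertex false (s + 1ℤ) ≤ edge true s
      even-even⇒       : ∀ {s t} → vertex false s ≤ edge false t → s ≋ t mod N
      odd-even⇒        : ∀ {s t} → vertex true s ≤ edge false t → s ≋ t mod N
      odd-odd⇒         : ∀ {s t} → vertex true s ≤ edge true t → s ≋ t mod N
      even-odd⇒        : ∀ {s t} → vertex false s ≤ edge true t → s ≋ t + 1ℤ mod N

private
  index : Bool → ℤ → ℤ
  index false s = + 2 * s
  index true  s = + 2 * s + 1ℤ

  halve : ∀ n → ∃[ b ] ∃[ s ] n ≡ index b s
  halve n with n ℤ.%ℕ 2 | ℤ.n%ℕd<d n 2 | ℤ.a≡a%ℕn+[a/ℕn]*n n 2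
  ... | 0 | _ | e = false , n ℤ./ℕ 2 , ≡.trans e (identity (n ℤ./ℕ 2))
    where
    identity : ∀ s → 0ℤ + s * + 2 ≡ + 2 * s
    identity = solve-∀
  ... | 1 | _ | e = true , n ℤ./ℕ 2 , ≡.trans e (identity (n ℤ./ℕ 2))
    where
    identity : ∀ s → 1ℤ + s * + 2 ≡ + 2 * s + 1ℤ
    identity = solve-∀
  ... | suc (suc _) | ℕ.s≤s (ℕ.s≤s ()) | _

  1≢0-mod-2 : ¬ 1ℤ ≋ 0ℤ mod (+ 2)
  1≢0-mod-2 e with <⇒≋⇒≡ 2 {1} {0} (ℕ.s≤s (ℕ.s≤s ℕ.z≤n)) (ℕ.s≤s ℕ.z≤n) e
  ... | ()

  index-cong : ∀ b {s t N} → s ≋ t mod N → index b s ≋ index b t mod (+ 2 * N)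
  index-cong false e = *-scale (+ 2) e
  index-cong true  e = +-congʳ 1ℤ (*-scale (+ 2) e)

  double-injective : ∀ {s t N} → + 2 * s ≋ + 2 * t mod (+ 2 * N) → s ≋ t mod N
  double-injective {s} {t} {N} (mod q e) = mod q (ℤ.*-cancelˡ-≡ (+ 2) _ _ (≡.trans e (identity t q N)))
    where
    identity : ∀ t q N → + 2 * t + q * (+ 2 * N) ≡ + 2 * (t + q * N)
    identity = solve-∀

  -- The modulus is even, so reduction modulo 2 recovers the parity bit; a mixed case would make 1
  -- even.
  index-injective : ∀ b c {s t N} → index b s ≋ index c t mod (+ 2 * N) → b ≡ c × s ≋ t mod N
  index-injective false false e = refl , double-injective e
  index-injective true true e = refl , double-injective (+-cancelʳ 1ℤ e)
  index-injective false true {s} {t} {N} e = contradiction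
    (≋-linear (- 1ℤ) (s - t) (≋-weaken N (≋-cast (ℤ.*-comm (+ 2) N) e)) (identity s t)) 1≢0-mod-2
    where
    identity : ∀ s t → 1ℤ - 0ℤ ≡ - 1ℤ * (+ 2 * s - (+ 2 * t + 1ℤ)) + (s - t) * + 2
    identity = solve-∀
  index-injective true false {s} {t} {N} e = contradiction
    (≋-linear 1ℤ (t - s) (≋-weaken N (≋-cast (ℤ.*-comm (+ 2) N) e)) (identity s t)) 1≢0-mod-2
    where
    identity : ∀ s t → 1ℤ - 0ℤ ≡ 1ℤ * (+ 2 * s + 1ℤ - + 2 * t) + (t - s) * + 2
    identity = solve-∀

module _ (X : Poset 0ℓ 0ℓ 0ℓ) where
  open Poset X using (_≈_; _≤_; module Eq; ≤-respˡ-≈; ≤-respʳ-≈) renaming (Carrier to Face)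
  open NonStrictToStrict _≈_ _≤_ using (_<_)

  alternating⇒cyclic : ∀ {F G N} → AlternatingSection X F G N → CyclicSection X F G (+ 2 * N)
  alternating⇒cyclic {F} {G} {N} S = record
    { vertex           = at S.vertex
    ; edge             = at S.edge
    ; vertex-between   = λ s → S.vertex-between _ _
    ; edge-between     = λ s → S.edge-between _ _
    ; vertex-cong      = λ {s} {t} → at-cong S.vertex S.vertex-cong {s} {t}
    ; edge-cong        = λ {s} {t} → at-cong S.edge S.edge-cong {s} {t}
    ; vertex-injective = λ {s} {t} e → index-equal s t (S.vertex-injective e)
    ; edge-injective   = λ {s} {t} e → index-equal s t (S.edge-injective e)
    ; exhaustive       = λ F<H H<G → exhaustive (S.exhaustive F<H H<G)
    ; start            = start
    ; end              = end
    ; incident⇒        = incident⇒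
    }
    where
    module S = AlternatingSection S

    at : (Bool → ℤ → Face) → ℤ → Face
    at f n = f (proj₁ (halve n)) (proj₁ (proj₂ (halve n)))

    at-cong : ∀ f → (∀ b {s t} → s ≋ t mod N → f b s ≈ f b t) → ∀ {m n} → m ≋ n mod (+ 2 * N) → at f m ≈ at
        f n
    at-cong f f-cong {m} {n} e with halve m | halve n
    ... | b , s , refl | c , t , refl with index-injective b c {s} {t} e
    ... | refl , s≋t = f-cong b s≋t

    at-index : ∀ f → (∀ b {s t} → s ≋ t mod N → f b s ≈ f b t) → ∀ b s → f b s ≈ at f (index b s)
    at-index f f-cong b s with halve (index b s)
    ... | c , t , e with index-injective b c {s} {t} {N} (≡⇒≋ e)
    ... | refl , s≋t = f-cong b s≋t

    index-equal : ∀ m n → proj₁ (halve m) ≡ proj₁ (halve n) × proj₁ (proj₂ (halve m)) ≋ proj₁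
        (proj₂ (halve n)) mod N →
                  m ≋ n mod (+ 2 * N)
    index-equal m n e with halve m | halve n
    index-equal m n (refl , e) | b , s , refl | _ , t , refl = index-cong b e

    exhaustive : ∀ {H} → (∃[ b ] ∃[ s ] H ≈ S.vertex b s) ⊎ (∃[ b ] ∃[ s ] H ≈ S.edge b s) →
                 (∃[ n ] H ≈ at S.vertex n) ⊎ (∃[ n ] H ≈ at S.edge n)
    exhaustive (inj₁ (b , s , e)) = inj₁ (index b s , Eq.trans e (at-index S.vertex S.vertex-cong b s))
    exhaustive (inj₂ (b , s , e)) = inj₂ (index b s , Eq.trans e (at-index S.edge S.edge-cong b s))

    start : ∀ n → at S.vertex n ≤ at S.edge n
    start n with halve n
    ... | false , s , _ = S.even-even s
    ... | true  , s , _ = S.odd-odd s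

    next : ∀ s → + 2 * s + 1ℤ + 1ℤ ≡ + 2 * (s + 1ℤ)
    next = solve-∀

    end : ∀ n → at S.vertex (n + 1ℤ) ≤ at S.edge n
    end n with halve n
    ... | false , s , refl = ≤-respˡ-≈ (at-index S.vertex S.vertex-cong true s) (S.odd-even s)
    ... | true  , s , refl = ≤-respˡ-≈ (Eq.trans (at-index S.vertex S.vertex-cong false (s + 1ℤ))
                               (Eq.reflexive (cong (at S.vertex) (≡.sym (next s))))) (S.even-odd s)

    incident⇒ : ∀ {m n} → at S.vertex m ≤ at S.edge n → m ≋ n mod (+ 2 * N) ⊎ m ≋ n + 1ℤ mod (+ 2 * N)
    incident⇒ {m} {n} i with halve m | halve n
    ... | false , s , refl | false , t , refl = inj₁ (index-cong false (S.even-even⇒ i))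
    ... | true  , s , refl | false , t , refl = inj₂ (index-cong true (S.odd-even⇒ i))
    ... | true  , s , refl | true  , t , refl = inj₁ (index-cong true (S.odd-odd⇒ i))
    ... | false , s , refl | true  , t , refl = inj₂
        (≋-trans (index-cong false (S.even-odd⇒ i)) (≡⇒≋ (≡.sym (next t))))

module _ (n : ℕ) .{{_ : ℕ.NonZero n}} where

  class : ℤ → Fin n
  class x = fromℕ< (residue<n n x)

  ≋-class : ∀ x → x ≋ + toℕ (class x) mod (+ n)
  ≋-class x = ≋-trans (≋-residue n x) (≡⇒≋ (cong +_ (≡.sym (Fin.toℕ-fromℕ< (residue<n n x)))))

  toℕ-≋ : ∀ {i j : Fin n} → + toℕ i ≋ + toℕ j mod (+ n) → i ≡ j
  toℕ-≋ {i} {j} e = Fin.toℕ-injective (<⇒≋⇒≡ n (Fin.toℕ<n i) (Fin.toℕ<n j) e)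

  class-≋ : ∀ {x y} → x ≋ y mod (+ n) → class x ≡ class y
  class-≋ {x} {y} e = toℕ-≋ (≋-trans (≋-sym (≋-class x)) (≋-trans e (≋-class y)))

  class-toℕ : ∀ i → class (+ toℕ i) ≡ i
  class-toℕ i = toℕ-≋ (≋-sym (≋-class (+ toℕ i)))

cyclic⇒polygon : ∀ {n} (P : Polytope n) {F G N p} .{{_ : ℕ.NonZero p}} → N ≡ + p →
  (S : CyclicSection (Polytope.faces P) F G N) →
  (∀ s → toℕ (Polytope.rank P (CyclicSection.vertex S s)) ≡ 1 ℕ.+ toℕ (Polytope.rank P F)) →
  (∀ s → toℕ (Polytope.rank P (CyclicSection.edge S s)) ≡ 2 ℕ.+ toℕ (Polytope.rank P F)) →
  IsPolygon P F G p
cyclic⇒polygon P {F} {G} {_} {p} refl S vertex-rank edge-rank = record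
  { vertex           = λ i → _ , S.vertex-between (+ toℕ i)
  ; edge             = λ i → _ , S.edge-between (+ toℕ i)
  ; vertex-rank      = λ i → vertex-rank (+ toℕ i)
  ; edge-rank        = λ i → edge-rank (+ toℕ i)
  ; vertex-injective = λ e → toℕ-≋ p (S.vertex-injective e)
  ; edge-injective   = λ e → toℕ-≋ p (S.edge-injective e)
  ; exhaustive       = λ (H , F<H , H<G) → exhaustive (S.exhaustive F<H H<G)
  ; incidence        = λ i j → mk⇔ (λ h → forth i j (S.incident⇒ h)) (back i j)
  }
  where
  open Polytope P
  module S = CyclicSection S

  exhaustive : ∀ {H} → (∃[ s ] H ≈ S.vertex s) ⊎ (∃[ s ] H ≈ S.edge s) →
               (∃[ i ] H ≈ S.vertex (+ toℕ i)) ⊎ (∃[ i ] H ≈ S.edge (+ toℕ i))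
  exhaustive (inj₁ (s , e)) = inj₁ (class p s , Eq.trans e (S.vertex-cong (≋-class p s)))
  exhaustive (inj₂ (s , e)) = inj₂ (class p s , Eq.trans e (S.edge-cong (≋-class p s)))

  +1≡suc : ∀ a → + a + 1ℤ ≡ + suc a
  +1≡suc a = cong +_ (ℕ.+-comm a 1)

  p≋0 : + p ≋ 0ℤ mod (+ p)
  p≋0 = mod 1ℤ (≡.sym (≡.trans (ℤ.+-identityˡ _) (ℤ.*-identityˡ (+ p))))

  forth : ∀ i j → + toℕ i ≋ + toℕ j mod (+ p) ⊎ + toℕ i ≋ + toℕ j + 1ℤ mod (+ p) → i ≡ j ⊎ Next j i
  forth i j (inj₁ e) = inj₁ (toℕ-≋ p e)
  -- After the last index the polygon closes up, which `Next` lists as a case of its own.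
  forth i j (inj₂ e) with ℕ.m≤n⇒m<n∨m≡n (Fin.toℕ<n j)
  ... | inj₁ 1+j<p = inj₂ (inj₁ (<⇒≋⇒≡ p (Fin.toℕ<n i) 1+j<p (≋-trans e (≡⇒≋ (+1≡suc (toℕ j))))))
  ... | inj₂ 1+j≡p = inj₂ (inj₂ (1+j≡p , <⇒≋⇒≡ p (Fin.toℕ<n i) (ℕ.>-nonZero⁻¹ p)
          (≋-trans e (≋-trans (≡⇒≋ (≡.trans (+1≡suc (toℕ j)) (cong +_ 1+j≡p))) p≋0))))

  back : ∀ i j → i ≡ j ⊎ Next j i → S.vertex (+ toℕ i) ≤ S.edge (+ toℕ j)
  back i i (inj₁ refl)           = S.start (+ toℕ i)
  back i j (inj₂ next) = Poset.≤-respˡ-≈ faces (S.vertex-cong (wrap next)) (S.end (+ toℕ j))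
    where
    wrap : Next j i → + toℕ j + 1ℤ ≋ + toℕ i mod (+ p)
    wrap (inj₁ e) = ≡⇒≋ (≡.trans (+1≡suc (toℕ j)) (cong +_ (≡.sym e)))
    wrap (inj₂ (1+j≡p , i≡0)) = ≋-trans (≡⇒≋ (≡.trans (+1≡suc (toℕ j)) (cong +_ 1+j≡p)))
                                 (≋-trans p≋0 (≡⇒≋ (cong +_ (≡.sym i≡0))))

-- Normal forms in the presented group

-- The orders are successors so that `a ^ʷ p` and `c ^ʷ r` can stand for the inverses of `a` and
-- `c`, and normal forms need no negative exponents.
module NormalForm {R : Rel (Word (Fin 3)) 0ℓ} (p r N : ℕ)
  (σ₁^p : Presented R (σ₁ ^ʷ suc p) 1ʷ) (ζ^p : Presented R ((σ₂ ^ʷ 2) ^ʷ suc p) 1ʷ)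
      (σ₃^r : Presented R (σ₃ ^ʷ suc r) 1ʷ)
  ([σ₁σ₂]² : Presented R ((σ₁ · σ₂) ^ʷ 2) 1ʷ) ([σ₂σ₃]² : Presented R ((σ₂ · σ₃) ^ʷ 2) 1ʷ)
  ([σ₁σ₂σ₃]² : Presented R ((σ₁ · σ₂ · σ₃) ^ʷ 2) 1ʷ) (σ₂²σ₁ : Presented R (σ₂ ^ʷ 2 · σ₁) (σ₁ · σ₂ ^ʷ 2))
  (σ₃σ₂² : Presented R (σ₃ · σ₂ ^ʷ 2) (σ₂ ^ʷ 2 · σ₃ ^ʷ N)) where

  private module G = Group ⟨ R ⟩
  open G using (_≈_)
  open SetoidReasoning G.setoid
  open GroupProperties ⟨ R ⟩ using (inverseʳ-unique; ⁻¹-anti-homo-∙; ⁻¹-involutive)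

  private
    a b c z τ : Word (Fin 3)
    a = σ₁
    b = σ₂
    c = σ₃
    z = σ₂ ^ʷ 2
    τ = σ₁ · σ₂

  ^ʷ-+ : ∀ x m n → x ^ʷ m · x ^ʷ n ≈ x ^ʷ (m ℕ.+ n)
  ^ʷ-+ x zero    n = G.identityˡ _
  ^ʷ-+ x (suc m) n = G.trans (G.assoc x (x ^ʷ m) (x ^ʷ n)) (G.∙-congˡ (^ʷ-+ x m n))

  ^ʷ-sucʳ : ∀ x n → x ^ʷ n · x ≈ x ^ʷ suc n
  ^ʷ-sucʳ x zero    = G.trans (G.identityˡ x) (G.sym (G.identityʳ x))
  ^ʷ-sucʳ x (suc n) = G.trans (G.assoc x (x ^ʷ n) x) (G.∙-congˡ (^ʷ-sucʳ x n))

  ττ : τ · τ ≈ 1ʷ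
  ττ = G.trans (G.∙-congˡ (G.sym (G.identityʳ τ))) [σ₁σ₂]²

  -- Padding `c · a` with `τ · τ` in front and `(b · c) ^ʷ 2` behind makes `(a · b · c) ^ʷ 2` appear
  -- in the middle; without it `τ · (b · c)` remains.
  σ₃σ₁ : c · a ≈ a · (z · c)
  σ₃σ₁ = begin
    c · a                                      ≈⟨ G.identityˡ (c · a) ⟨
    1ʷ · (c · a)                               ≈⟨ G.∙-congʳ ττ ⟨
    τ · τ · (c · a)                            ≈⟨ G.identityʳ _ ⟨
    τ · τ · (c · a) · 1ʷ                       ≈⟨ G.∙-congˡ [σ₂σ₃]² ⟨
    τ · τ · (c · a) · (b · c) ^ʷ 2             ≈⟨ regroup ⟩
    τ · (a · b · c) ^ʷ 2 · (b · c)             ≈⟨ G.∙-congʳ (G.∙-congˡ [σ₁σ₂σ₃]²) ⟩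
    τ · 1ʷ · (b · c)                           ≈⟨ regroup′ ⟩
    a · (z · c)                                ∎
    where
    regroup : τ · τ · (c · a) · (b · c) ^ʷ 2 ≈ τ · (a · b · c) ^ʷ 2 · (b · c)
    regroup = MonoidSolver.solve G.monoid
    regroup′ : τ · 1ʷ · (b · c) ≈ a · (z · c)
    regroup′ = MonoidSolver.solve G.monoid

  -- Both `τ` and `τ · c` square to 1, hence `τ` inverts `c`; this is the form without inverses.
  σ₃τσ₃ : c · τ · c ≈ τ
  σ₃τσ₃ = begin
    c · τ · c                ≈⟨ G.identityˡ (c · τ · c) ⟨
    1ʷ · (c · τ · c)         ≈⟨ G.∙-congʳ ττ ⟨
    τ · τ · (c · τ · c)      ≈⟨ regroup ⟩
    τ · (a · b · c) ^ʷ 2     ≈⟨ G.∙-congˡ [σ₁σ₂σ₃]² ⟩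
    τ · 1ʷ                   ≈⟨ G.identityʳ τ ⟩
    τ                        ∎
    where
    regroup : τ · τ · (c · τ · c) ≈ τ · (a · b · c) ^ʷ 2
    regroup = MonoidSolver.solve G.monoid

  ζτ : z · τ ≈ τ · z
  ζτ = begin
    z · τ          ≈⟨ G.assoc z a b ⟨
    z · a · b      ≈⟨ G.∙-congʳ σ₂²σ₁ ⟩
    a · z · b      ≈⟨ regroup ⟩
    τ · z          ∎
    where
    regroup : a · z · b ≈ τ · z
    regroup = MonoidSolver.solve G.monoid

  -- Read as a conjugation, `τ` takes `a` to the inverse of `z · a`.
  σ₁τζσ₁ : a · τ · (z · a) ≈ τ
  σ₁τζσ₁ = begin
    a · τ · (z · a)            ≈⟨ G.∙-congˡ σ₂²σ₁ ⟩
    a · τ · (a · z)            ≈⟨ regroup ⟩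
    a · (τ · τ) · b            ≈⟨ G.∙-congʳ (G.∙-congˡ ττ) ⟩
    a · 1ʷ · b                 ≈⟨ G.∙-congʳ (G.identityʳ a) ⟩
    τ                          ∎
    where
    regroup : a · τ · (a · z) ≈ a · (τ · τ) · b
    regroup = MonoidSolver.solve G.monoid

  commute-power : ∀ {x y} → x · y ≈ y · x → ∀ n → x ^ʷ n · y ≈ y · x ^ʷ n
  commute-power {x} {y} e zero    = G.trans (G.identityˡ y) (G.sym (G.identityʳ y))
  commute-power {x} {y} e (suc n) = begin
    x · x ^ʷ n · y     ≈⟨ G.assoc _ _ _ ⟩
    x · (x ^ʷ n · y)   ≈⟨ G.∙-congˡ (commute-power e n) ⟩
    x · (y · x ^ʷ n)   ≈⟨ G.assoc _ _ _ ⟨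
    x · y · x ^ʷ n     ≈⟨ G.∙-congʳ e ⟩
    y · x · x ^ʷ n     ≈⟨ G.assoc _ _ _ ⟩
    y · (x · x ^ʷ n)   ∎

  ζ^-σ₁^ : ∀ n i → z ^ʷ n · a ^ʷ i ≈ a ^ʷ i · z ^ʷ n
  ζ^-σ₁^ n i = G.sym (commute-power (G.sym (commute-power σ₂²σ₁ n)) i)

  -- Here and below the new exponents are merely claimed to exist: the bound on the group needs the
  -- shape of the normal form, not its composition law.
  σ₃^-ζ : ∀ k → ∃[ e ] c ^ʷ k · z ≈ z · c ^ʷ e
  σ₃^-ζ zero    = 0 , G.trans (G.identityˡ z) (G.sym (G.identityʳ z))
  σ₃^-ζ (suc k) with σ₃^-ζ k
  ... | e , h = N ℕ.+ e , (begin
    c · c ^ʷ k · z          ≈⟨ G.assoc _ _ _ ⟩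
    c · (c ^ʷ k · z)        ≈⟨ G.∙-congˡ h ⟩
    c · (z · c ^ʷ e)        ≈⟨ G.assoc _ _ _ ⟨
    c · z · c ^ʷ e          ≈⟨ G.∙-congʳ σ₃σ₂² ⟩
    z · c ^ʷ N · c ^ʷ e     ≈⟨ G.assoc _ _ _ ⟩
    z · (c ^ʷ N · c ^ʷ e)   ≈⟨ G.∙-congˡ (^ʷ-+ c N e) ⟩
    z · c ^ʷ (N ℕ.+ e)      ∎)

  σ₃^-ζ^ : ∀ k n → ∃[ e ] c ^ʷ k · z ^ʷ n ≈ z ^ʷ n · c ^ʷ e
  σ₃^-ζ^ k zero    = k , G.trans (G.identityʳ _) (G.sym (G.identityˡ _))
  σ₃^-ζ^ k (suc n) with σ₃^-ζ k
  ... | e , h with σ₃^-ζ^ e n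
  ...   | e′ , h′ = e′ , (begin
    c ^ʷ k · (z · z ^ʷ n)     ≈⟨ G.assoc _ _ _ ⟨
    c ^ʷ k · z · z ^ʷ n       ≈⟨ G.∙-congʳ h ⟩
    z · c ^ʷ e · z ^ʷ n       ≈⟨ G.assoc _ _ _ ⟩
    z · (c ^ʷ e · z ^ʷ n)     ≈⟨ G.∙-congˡ h′ ⟩
    z · (z ^ʷ n · c ^ʷ e′)    ≈⟨ G.assoc _ _ _ ⟨
    z · z ^ʷ n · c ^ʷ e′      ∎)

  σ₃^-σ₁ : ∀ k → ∃[ n ] ∃[ e ] c ^ʷ k · a ≈ a · (z ^ʷ n · c ^ʷ e)
  σ₃^-σ₁ zero    = 0 , 0 , MonoidSolver.solve G.monoid
  σ₃^-σ₁ (suc k) with σ₃^-σ₁ k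
  ... | n , e , h with σ₃^-ζ^ 1 n
  ...   | e′ , h′ = suc n , e′ ℕ.+ e , (begin
    c · C · a                            ≈⟨ G.assoc _ _ _ ⟩
    c · (C · a)                          ≈⟨ G.∙-congˡ h ⟩
    c · (a · (Z · C₁))                   ≈⟨ G.assoc _ _ _ ⟨
    c · a · (Z · C₁)                     ≈⟨ G.∙-congʳ σ₃σ₁ ⟩
    a · (z · c) · (Z · C₁)               ≈⟨ regroup Z C₁ ⟩
    a · (z · (c · 1ʷ · Z) · C₁)          ≈⟨ G.∙-congˡ (G.∙-congʳ (G.∙-congˡ h′)) ⟩
    a · (z · (Z · C₂) · C₁)              ≈⟨ regroup′ Z C₁ C₂ ⟩
    a · (z · Z · (C₂ · C₁))              ≈⟨ G.∙-congˡ (G.∙-congˡ (^ʷ-+ c e′ e)) ⟩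
    a · (z · Z · c ^ʷ (e′ ℕ.+ e))        ∎)
    where
    C C₁ C₂ Z : Word (Fin 3)
    C  = c ^ʷ k
    C₁ = c ^ʷ e
    C₂ = c ^ʷ e′
    Z  = z ^ʷ n
    regroup : ∀ Z C₁ → a · (z · c) · (Z · C₁) ≈ a · (z · (c · 1ʷ · Z) · C₁)
    regroup Z C₁ = MonoidSolver.solve G.monoid
    regroup′ : ∀ Z C₁ C₂ → a · (z · (Z · C₂) · C₁) ≈ a · (z · Z · (C₂ · C₁))
    regroup′ Z C₁ C₂ = MonoidSolver.solve G.monoid

  σ₃^-τ : ∀ k → ∃[ e ] c ^ʷ k · τ ≈ τ · c ^ʷ e
  σ₃^-τ zero    = 0 , G.trans (G.identityˡ τ) (G.sym (G.identityʳ τ))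
  σ₃^-τ (suc k) with σ₃^-τ k
  -- Each `c` that passes `τ` becomes its inverse, here `c ^ʷ r`.
  ... | e , h = r ℕ.+ e , (begin
    c · c ^ʷ k · τ                       ≈⟨ G.assoc _ _ _ ⟩
    c · (c ^ʷ k · τ)                     ≈⟨ G.∙-congˡ h ⟩
    c · (τ · c ^ʷ e)                     ≈⟨ regroup (c ^ʷ e) ⟩
    c · τ · 1ʷ · c ^ʷ e                  ≈⟨ G.∙-congʳ (G.∙-congˡ σ₃^r) ⟨
    c · τ · (c · c ^ʷ r) · c ^ʷ e        ≈⟨ regroup′ (c ^ʷ r) (c ^ʷ e) ⟩
    c · τ · c · (c ^ʷ r · c ^ʷ e)        ≈⟨ G.∙-cong σ₃τσ₃ (^ʷ-+ c r e) ⟩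
    τ · c ^ʷ (r ℕ.+ e)                   ∎)
    where
    regroup : ∀ C → c · (τ · C) ≈ c · τ · 1ʷ · C
    regroup C = MonoidSolver.solve G.monoid
    regroup′ : ∀ C₁ C₂ → c · τ · (c · C₁) · C₂ ≈ c · τ · c · (C₁ · C₂)
    regroup′ C₁ C₂ = MonoidSolver.solve G.monoid

  σ₁τ : a · τ ≈ τ · (a ^ʷ p · z ^ʷ p)
  σ₁τ = begin
    a · τ                                     ≈⟨ regroup ⟩
    a · τ · (1ʷ · 1ʷ)                         ≈⟨ G.∙-congˡ (G.∙-congˡ ζ^p) ⟨
    a · τ · (1ʷ · (z · z ^ʷ p))               ≈⟨ G.∙-congˡ (G.∙-congʳ σ₁^p) ⟨
    a · τ · (a · a ^ʷ p · (z · z ^ʷ p))       ≈⟨ regroup₁ (a ^ʷ p) (z ^ʷ p) ⟩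
    a · τ · (a · (a ^ʷ p · z) · z ^ʷ p)       ≈⟨ G.∙-congˡ
        (G.∙-congʳ (G.∙-congˡ (commute-power (G.sym σ₂²σ₁) p))) ⟩
    a · τ · (a · (z · a ^ʷ p) · z ^ʷ p)       ≈⟨ regroup₂ (a ^ʷ p) (z ^ʷ p) ⟩
    a · τ · (a · z) · (a ^ʷ p · z ^ʷ p)       ≈⟨ G.∙-congʳ (G.∙-congˡ σ₂²σ₁) ⟨
    a · τ · (z · a) · (a ^ʷ p · z ^ʷ p)       ≈⟨ G.∙-congʳ σ₁τζσ₁ ⟩
    τ · (a ^ʷ p · z ^ʷ p)                     ∎
    where
    regroup : a · τ ≈ a · τ · (1ʷ · 1ʷ)
    regroup = MonoidSolver.solve G.monoid
    regroup₁ : ∀ A Z → a · τ · (a · A · (z · Z)) ≈ a · τ · (a · (A · z) · Z)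
    regroup₁ A Z = MonoidSolver.solve G.monoid
    regroup₂ : ∀ A Z → a · τ · (a · (z · A) · Z) ≈ a · τ · (a · z) · (A · Z)
    regroup₂ A Z = MonoidSolver.solve G.monoid

  σ₁^-τ : ∀ i → ∃[ i′ ] ∃[ l ] a ^ʷ i · τ ≈ τ · (a ^ʷ i′ · z ^ʷ l)
  σ₁^-τ zero    = 0 , 0 , MonoidSolver.solve G.monoid
  σ₁^-τ (suc i) with σ₁^-τ i
  ... | i′ , l , h = p ℕ.+ i′ , p ℕ.+ l , (begin
    a · a ^ʷ i · τ                                    ≈⟨ G.assoc _ _ _ ⟩
    a · (a ^ʷ i · τ)                                  ≈⟨ G.∙-congˡ h ⟩
    a · (τ · (a ^ʷ i′ · z ^ʷ l))                      ≈⟨ G.assoc _ _ _ ⟨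
    a · τ · (a ^ʷ i′ · z ^ʷ l)                        ≈⟨ G.∙-congʳ σ₁τ ⟩
    τ · (a ^ʷ p · z ^ʷ p) · (a ^ʷ i′ · z ^ʷ l)        ≈⟨ regroup (a ^ʷ p) (z ^ʷ p) (a ^ʷ i′) (z ^ʷ l) ⟩
    τ · (a ^ʷ p · (z ^ʷ p · a ^ʷ i′) · z ^ʷ l)        ≈⟨ G.∙-congˡ (G.∙-congʳ (G.∙-congˡ (ζ^-σ₁^ p i′))) ⟩
    τ · (a ^ʷ p · (a ^ʷ i′ · z ^ʷ p) · z ^ʷ l)        ≈⟨ regroup′ (a ^ʷ p) (z ^ʷ p) (a ^ʷ i′) (z ^ʷ l) ⟩
    τ · (a ^ʷ p · a ^ʷ i′ · (z ^ʷ p · z ^ʷ l))        ≈⟨ G.∙-congˡ (G.∙-cong (^ʷ-+ a p i′) (^ʷ-+ z p l)) ⟩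
    τ · (a ^ʷ (p ℕ.+ i′) · z ^ʷ (p ℕ.+ l))            ∎)
    where
    regroup : ∀ A Z A′ Z′ → τ · (A · Z) · (A′ · Z′) ≈ τ · (A · (Z · A′) · Z′)
    regroup A Z A′ Z′ = MonoidSolver.solve G.monoid
    regroup′ : ∀ A Z A′ Z′ → τ · (A · (A′ · Z) · Z′) ≈ τ · (A · A′ · (Z · Z′))
    regroup′ A Z A′ Z′ = MonoidSolver.solve G.monoid

  τ^ : Bool → Word (Fin 3)
  τ^ false = 1ʷ
  τ^ true  = τ

  normal : Bool → ℕ → ℕ → ℕ → Word (Fin 3)
  normal η i l j = τ^ η · (a ^ʷ i · (z ^ʷ l · c ^ʷ j))

  Normal : Word (Fin 3) → Set
  Normal g = ∃[ η ] ∃[ i ] ∃[ l ] ∃[ j ] g ≈ normal η i l j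

  -- Stability under right multiplication by `u`, unlike normality of `u` itself, passes directly to
  -- products of words.
  Closed : Word (Fin 3) → Set
  Closed u = ∀ {g} → Normal g → Normal (g · u)

  normal-resp : ∀ {g h} → g ≈ h → Normal g → Normal h
  normal-resp e (η , i , l , j , f) = η , i , l , j , G.trans (G.sym e) f

  closed-resp : ∀ {u v} → u ≈ v → Closed u → Closed v
  closed-resp e closed n = normal-resp (G.∙-congˡ e) (closed n)

  closed-1 : Closed 1ʷ
  closed-1 = normal-resp (G.sym (G.identityʳ _))

  closed-· : ∀ {u v} → Closed u → Closed v → Closed (u · v)
  closed-· closed-u closed-v n = normal-resp (G.assoc _ _ _) (closed-v (closed-u n))

  closed-^ : ∀ {u} → Closed u → ∀ n → Closed (u ^ʷ n)
  closed-^ closed zero    = closed-1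
  closed-^ closed (suc n) = closed-· closed (closed-^ closed n)

  closed-σ₁ : Closed a
  closed-σ₁ (η , i , l , j , h) with σ₃^-σ₁ j
  ... | n , e , f = η , suc i , l ℕ.+ n , e , G.trans (G.∙-congʳ h) (begin
    T · (A · (Z · C)) · a                  ≈⟨ regroup T A Z C ⟩
    T · (A · (Z · (C · a)))                ≈⟨ G.∙-congˡ (G.∙-congˡ (G.∙-congˡ f)) ⟩
    T · (A · (Z · (a · (Z′ · C′))))        ≈⟨ regroup₁ T A Z (Z′ · C′) ⟩
    T · (A · (Z · a · (Z′ · C′)))          ≈⟨ G.∙-congˡ (G.∙-congˡ (G.∙-congʳ (commute-power σ₂²σ₁ l))) ⟩
    T · (A · (a · Z · (Z′ · C′)))          ≈⟨ regroup₂ T A Z Z′ C′ ⟩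
    T · (A · a · (Z · Z′ · C′))            ≈⟨ G.∙-congˡ (G.∙-cong (^ʷ-sucʳ a i) (G.∙-congʳ (^ʷ-+ z l n))) ⟩
    T · (a ^ʷ suc i · (z ^ʷ (l ℕ.+ n) · C′)) ∎)
    where
    T A Z Z′ C C′ : Word (Fin 3)
    T  = τ^ η
    A  = a ^ʷ i
    Z  = z ^ʷ l
    Z′ = z ^ʷ n
    C  = c ^ʷ j
    C′ = c ^ʷ e
    regroup : ∀ T A Z C → T · (A · (Z · C)) · a ≈ T · (A · (Z · (C · a)))
    regroup T A Z C = MonoidSolver.solve G.monoid
    regroup₁ : ∀ T A Z C → T · (A · (Z · (a · C))) ≈ T · (A · (Z · a · C))
    regroup₁ T A Z C = MonoidSolver.solve G.monoid
    regroup₂ : ∀ T A Z Z′ C → T · (A · (a · Z · (Z′ · C))) ≈ T · (A · a · (Z · Z′ · C))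
    regroup₂ T A Z Z′ C = MonoidSolver.solve G.monoid

  closed-σ₃ : Closed c
  closed-σ₃ (η , i , l , j , h) = η , i , l , suc j , G.trans (G.∙-congʳ h)
    (G.trans (regroup (τ^ η) (a ^ʷ i) (z ^ʷ l) (c ^ʷ j)) (G.∙-congˡ (G.∙-congˡ (G.∙-congˡ (^ʷ-sucʳ c j)))))
    where
    regroup : ∀ T A Z C → T · (A · (Z · C)) · c ≈ T · (A · (Z · (C · c)))
    regroup T A Z C = MonoidSolver.solve G.monoid

  τ^-τ : ∀ η → τ^ η · τ ≈ τ^ (not η)
  τ^-τ false = G.identityˡ τ
  τ^-τ true  = ττ

  closed-τ : Closed τ
  closed-τ (η , i , l , j , h) with σ₃^-τ j | σ₁^-τ i
  ... | e , f | i′ , l′ , f′ = not η , i′ , l′ ℕ.+ l , e , G.trans (G.∙-congʳ h) (begin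
    T · (A · (Z · C)) · τ                  ≈⟨ regroup T A Z C τ ⟩
    T · (A · (Z · (C · τ)))                ≈⟨ G.∙-congˡ (G.∙-congˡ (G.∙-congˡ f)) ⟩
    T · (A · (Z · (τ · C′)))               ≈⟨ regroup₁ T A Z C′ τ ⟩
    T · (A · (Z · τ) · C′)                 ≈⟨ G.∙-congˡ (G.∙-congʳ (G.∙-congˡ (commute-power ζτ l))) ⟩
    T · (A · (τ · Z) · C′)                 ≈⟨ regroup₂ T A Z C′ τ ⟩
    T · (A · τ · (Z · C′))                 ≈⟨ G.∙-congˡ (G.∙-congʳ f′) ⟩
    T · (τ · (A′ · Z′) · (Z · C′))         ≈⟨ regroup₃ T A′ Z′ Z C′ τ ⟩
    T · τ · (A′ · (Z′ · Z · C′))           ≈⟨ G.∙-cong (τ^-τ η) (G.∙-congˡ (G.∙-congʳ (^ʷ-+ z l′ l))) ⟩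
    τ^ (not η) · (A′ · (z ^ʷ (l′ ℕ.+ l) · C′)) ∎)
    where
    T A A′ Z Z′ C C′ : Word (Fin 3)
    T  = τ^ η
    A  = a ^ʷ i
    A′ = a ^ʷ i′
    Z  = z ^ʷ l
    Z′ = z ^ʷ l′
    C  = c ^ʷ j
    C′ = c ^ʷ e
    regroup : ∀ T A Z C τ → T · (A · (Z · C)) · τ ≈ T · (A · (Z · (C · τ)))
    regroup T A Z C τ = MonoidSolver.solve G.monoid
    regroup₁ : ∀ T A Z C τ → T · (A · (Z · (τ · C))) ≈ T · (A · (Z · τ) · C)
    regroup₁ T A Z C τ = MonoidSolver.solve G.monoid
    regroup₂ : ∀ T A Z C τ → T · (A · (τ · Z) · C) ≈ T · (A · τ · (Z · C))
    regroup₂ T A Z C τ = MonoidSolver.solve G.monoid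
    regroup₃ : ∀ T A Z Z′ C τ → T · (τ · (A · Z) · (Z′ · C)) ≈ T · τ · (A · (Z · Z′ · C))
    regroup₃ T A Z Z′ C τ = MonoidSolver.solve G.monoid

  private
    a^p·a : a ^ʷ p · a ≈ 1ʷ
    a^p·a = G.trans (^ʷ-sucʳ a p) σ₁^p

    σ₂≈ : a ^ʷ p · τ ≈ b
    σ₂≈ = G.trans (G.sym (G.assoc (a ^ʷ p) a b)) (G.trans (G.∙-congʳ a^p·a) (G.identityˡ b))

    σ₂⁻¹≈ : τ · a ≈ b ⁻¹ʷ
    σ₂⁻¹≈ = inverseʳ-unique b (τ · a) (begin
      b · (τ · a)                        ≈⟨ G.∙-congʳ σ₂≈ ⟨
      a ^ʷ p · τ · (τ · a)               ≈⟨ regroup (a ^ʷ p) τ ⟩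
      a ^ʷ p · (τ · τ) · a               ≈⟨ G.∙-congʳ (G.∙-congˡ ττ) ⟩
      a ^ʷ p · 1ʷ · a                    ≈⟨ G.∙-congʳ (G.identityʳ _) ⟩
      a ^ʷ p · a                         ≈⟨ a^p·a ⟩
      1ʷ                                 ∎)
      where
      regroup : ∀ A τ → A · τ · (τ · a) ≈ A · (τ · τ) · a
      regroup A τ = MonoidSolver.solve G.monoid

  -- Inverses are treated at the same time so that the induction goes through `_⁻¹ʷ`.
  closed : ∀ u → Closed u × Closed (u ⁻¹ʷ)
  closed (gen zero) = closed-σ₁ , closed-resp (inverseʳ-unique a _ σ₁^p) (closed-^ closed-σ₁ p)
  -- The letter `b` does not occur in normal forms and is replaced by `a ^ʷ p · τ`.
  closed (gen 1F) = closed-resp σ₂≈ (closed-· (closed-^ closed-σ₁ p) closed-τ) ,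
                                  closed-resp σ₂⁻¹≈ (closed-· closed-τ closed-σ₁)
  closed (gen 2F) = closed-σ₃ , closed-resp (inverseʳ-unique c _ σ₃^r) (closed-^ closed-σ₃ r)
  closed 1ʷ = closed-1 , closed-resp (inverseʳ-unique 1ʷ 1ʷ (G.identityˡ 1ʷ)) closed-1
  closed (u · v) with closed u | closed v
  ... | cu , cu⁻¹ | cv , cv⁻¹   = closed-· cu cv , closed-resp (G.sym (⁻¹-anti-homo-∙ u v))
      (closed-· cv⁻¹ cu⁻¹)
  closed (u ⁻¹ʷ) with closed u
  ... | cu , cu⁻¹               = cu⁻¹ , closed-resp (G.sym (⁻¹-involutive u)) cu

  normalise : ∀ u → Normal u
  normalise u = normal-resp (G.identityˡ u) (proj₁ (closed u) (false , 0 , 0 , 0 , trivial))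
    where
    trivial : 1ʷ ≈ normal false 0 0 0
    trivial = MonoidSolver.solve G.monoid

-- The faces of the polytope

-- In the theorem w = m ^ (α - 2) and κ = k (m + 1) / 2, so that r = m ^ α and
-- 2s ≡ k m ^ (α - 1) modulo r.
module Modulus (m w κ : ℤ) where

  r s : ℤ
  r = w * m * m
  s = κ * w * m

  -- The facet adjacent to T j across the 2-face H j l is T (successor j l).
  successor predecessor : ℤ → ℤ → ℤ
  successor   j l = j + 1ℤ + s * (l + l)
  predecessor j l = j - 1ℤ - s * (l + l)

  mod-r⇒mod-m : ∀ {x y} → x ≋ y mod r → x ≋ y mod m
  mod-r⇒mod-m = ≋-weaken (w * m)

  -- The product `s * m` is `κ * r`. Together with `s*≋0` this lets nested corrections simply add
  -- up.
  s*-cong : ∀ {x y} → x ≋ y mod m → s * x ≋ s * y mod r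
  s*-cong {y = y} (mod q refl) = mod (q * κ) (identity y q m w κ)
    where
    identity : ∀ y q m w κ → κ * w * m * (y + q * m) ≡ κ * w * m * y + q * κ * (w * m * m)
    identity = solve-∀

  s*≋0 : ∀ x → s * x ≋ 0ℤ mod m
  s*≋0 x = mod (κ * w * x) (identity x m w κ)
    where
    identity : ∀ x m w κ → κ * w * m * x ≡ 0ℤ + κ * w * x * m
    identity = solve-∀

  +s*≋ : ∀ x y → x + s * y ≋ x mod m
  +s*≋ x y = ≋-trans (+-congˡ x (s*≋0 y)) (≡⇒≋ (ℤ.+-identityʳ x))

  -s*≋ : ∀ x y → x - s * y ≋ x mod m
  -s*≋ x y = ≋-trans (+-congˡ x (neg-cong (s*≋0 y))) (≡⇒≋ (ℤ.+-identityʳ x))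

  successor-cong : ∀ {j j′ l l′} → j ≋ j′ mod r → l ≋ l′ mod m → successor j l ≋ successor j′ l′ mod r
  successor-cong j≋j′ l≋l′ = +-cong (+-congʳ 1ℤ j≋j′) (s*-cong (+-cong l≋l′ l≋l′))

  predecessor-cong : ∀ {j j′ l l′} → j ≋ j′ mod r → l ≋ l′ mod m → predecessor j l ≋ predecessor j′ l′ mod r
  predecessor-cong j≋j′ l≋l′ = +-cong (+-congʳ (- 1ℤ) j≋j′) (neg-cong (s*-cong (+-cong l≋l′ l≋l′)))

  successor-mod-m : ∀ j l → successor j l ≋ j + 1ℤ mod m
  successor-mod-m j l = +s*≋ (j + 1ℤ) (l + l)

  predecessor-mod-m : ∀ j l → predecessor j l ≋ j - 1ℤ mod m
  predecessor-mod-m j l = -s*≋ (j - 1ℤ) (l + l)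

  successor-predecessor : ∀ j l → successor (predecessor j l) l ≡ j
  successor-predecessor j l = identity j s l
    where
    identity : ∀ j s l → j - 1ℤ - s * (l + l) + 1ℤ + s * (l + l) ≡ j
    identity = solve-∀

  predecessor-successor : ∀ j l → predecessor (successor j l) l ≡ j
  predecessor-successor j l = identity j s l
    where
    identity : ∀ j s l → j + 1ℤ + s * (l + l) - 1ℤ - s * (l + l) ≡ j
    identity = solve-∀

  label-cong : ∀ {x x′ y y′ j j′} → x ≋ x′ mod m → y ≋ y′ mod m → j ≋ j′ mod m →
               y + x * j ≋ y′ + x′ * j′ mod m
  label-cong x≋x′ y≋y′ j≋j′ = +-cong y≋y′ (*-cong x≋x′ j≋j′)

  label-predecessor : ∀ x y j l → y + x * predecessor j l ≋ y + x * (j - 1ℤ) mod m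
  label-predecessor x y j l = label-cong {x} {x} {y} {y} ≋-refl ≋-refl (predecessor-mod-m j l)

  -- The facets on the edge E x y are, in cyclic order, T (spiral x y n).
  spiral : ℤ → ℤ → ℤ → ℤ
  spiral x y n = n + s * ((y + y) * n + x * (n * (n - 1ℤ)))

  spiral-cong : ∀ x y {n n′} → n ≋ n′ mod r → spiral x y n ≋ spiral x y n′ mod r
  spiral-cong x y e = +-cong e (s*-cong (+-cong (*-congˡ (y + y) e′)
      (*-congˡ x (*-cong e′ (+-congʳ (- 1ℤ) e′)))))
    where e′ = mod-r⇒mod-m e

  spiral-mod-m : ∀ x y n → spiral x y n ≋ n mod m
  spiral-mod-m x y n = +s*≋ n _

  -- Modulo `m` the spiral is the identity, so equal values have equal corrections modulo `r`, and
  -- these can be subtracted.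
  spiral-injective : ∀ x y {n n′} → spiral x y n ≋ spiral x y n′ mod r → n ≋ n′ mod r
  spiral-injective x y {n} {n′} e = ≋-combine 1ℤ (- 1ℤ) 0ℤ e
    (s*-cong (+-cong (*-congˡ (y + y) e′) (*-congˡ x (*-cong e′ (+-congʳ (- 1ℤ) e′)))))
    (identity n n′ (s * ((y + y) * n + x * (n * (n - 1ℤ)))) (s * ((y + y) * n′ + x * (n′ * (n′ - 1ℤ)))) r)
    where
    e′ : n ≋ n′ mod m
    e′ = ≋-trans (≋-sym (spiral-mod-m x y n)) (≋-trans (mod-r⇒mod-m e) (spiral-mod-m x y n′))
    identity : ∀ n n′ a b r → n - n′ ≡ 1ℤ * (n + a - (n′ + b)) + - 1ℤ * (a - b) + 0ℤ * r
    identity = solve-∀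

  -- The correction may be computed from `j` instead of its preimage, since the two agree modulo
  -- `m`.
  spiral⁻¹ : ℤ → ℤ → ℤ → ℤ
  spiral⁻¹ x y j = j - s * ((y + y) * j + x * (j * (j - 1ℤ)))

  spiral-spiral⁻¹ : ∀ x y j → spiral x y (spiral⁻¹ x y j) ≋ j mod r
  spiral-spiral⁻¹ x y j = ≋-trans
    (+-congˡ (spiral⁻¹ x y j) (s*-cong (+-cong (*-congˡ (y + y) e)
        (*-congˡ x (*-cong e (+-congʳ (- 1ℤ) e))))))
    (≡⇒≋ (identity j (s * ((y + y) * j + x * (j * (j - 1ℤ))))))
    where
    e : spiral⁻¹ x y j ≋ j mod m
    e = -s*≋ j _
    identity : ∀ j a → j - a + a ≡ j
    identity = solve-∀

  -- This recurrence is the origin of `spiral`: the increments `1ℤ + 2s(y + x i)` for `i < n` add up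
  -- to its formula.
  spiral-suc : ∀ x y n → spiral x y (n + 1ℤ) ≡ successor (spiral x y n) (y + x * n)
  spiral-suc x y n = identity x y n s
    where
    identity : ∀ x y n s → n + 1ℤ + s * ((y + y) * (n + 1ℤ) + x * ((n + 1ℤ) * (n + 1ℤ - 1ℤ))) ≡
               n + s * ((y + y) * n + x * (n * (n - 1ℤ))) + 1ℤ + s * (y + x * n + (y + x * n))
    identity = solve-∀

  label-spiral : ∀ x y n → y + x * spiral x y n ≋ y + x * n mod m
  label-spiral x y n = label-cong {x} {x} {y} {y} ≋-refl ≋-refl (spiral-mod-m x y n)

-- Coordinates are left unreduced; the equality `_≈_` of the poset takes them modulo `m` or `r`, so
-- maps of faces can be given by polynomials.
data Face : Set where
  bot : Face
  V   : ℤ → Face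
  E H : ℤ → ℤ → Face
  T   : ℤ → Face
  top : Face

rank : Face → Fin 6
rank bot = zero
rank (V _) = suc zero
rank (E _ _) = suc 1F
rank (H _ _) = suc 2F
rank (T _) = suc 3F
rank top = suc 4F

module Order (m w κ : ℤ) where
  open Modulus m w κ

  infix 4 _≈_ _≤_

  data _≈_ : Face → Face → Set where
    bot : bot ≈ bot
    V   : ∀ {i i′} → i ≋ i′ mod m → V i ≈ V i′
    E   : ∀ {x x′ y y′} → x ≋ x′ mod m → y ≋ y′ mod m → E x y ≈ E x′ y′
    H   : ∀ {j j′ l l′} → j ≋ j′ mod r → l ≋ l′ mod m → H j l ≈ H j′ l′
    T   : ∀ {t t′} → t ≋ t′ mod r → T t ≈ T t′
    top : top ≈ top

  data _≤_ : Face → Face → Set where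
    bot≤ : ∀ {F} → bot ≤ F
    ≤top : ∀ {F} → F ≤ top
    V≤V  : ∀ {i i′} → i ≋ i′ mod m → V i ≤ V i′
    E≤E  : ∀ {x x′ y y′} → x ≋ x′ mod m → y ≋ y′ mod m → E x y ≤ E x′ y′
    H≤H  : ∀ {j j′ l l′} → j ≋ j′ mod r → l ≋ l′ mod m → H j l ≤ H j′ l′
    T≤T  : ∀ {t t′} → t ≋ t′ mod r → T t ≤ T t′
    V≤E  : ∀ {i x y} → i ≋ x mod m ⊎ i ≋ x - 1ℤ mod m → V i ≤ E x y
    E≤H  : ∀ {x y j l} → l ≋ y + x * j mod m → E x y ≤ H j l
    H≤T  : ∀ {j l t} → t ≋ j mod r ⊎ t ≋ successor j l mod r → H j l ≤ T t
    V≤H  : ∀ {i j l} → V i ≤ H j l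
    V≤T  : ∀ {i t} → V i ≤ T t
    E≤T  : ∀ {x y t} → E x y ≤ T t

  ≈-refl : ∀ {F} → F ≈ F
  ≈-refl {bot}   = bot
  ≈-refl {V _}   = V ≋-refl
  ≈-refl {E _ _} = E ≋-refl ≋-refl
  ≈-refl {H _ _} = H ≋-refl ≋-refl
  ≈-refl {T _}   = T ≋-refl
  ≈-refl {top}   = top

  ≈-sym : ∀ {F G} → F ≈ G → G ≈ F
  ≈-sym bot     = bot
  ≈-sym (V e)   = V (≋-sym e)
  ≈-sym (E d e) = E (≋-sym d) (≋-sym e)
  ≈-sym (H d e) = H (≋-sym d) (≋-sym e)
  ≈-sym (T e)   = T (≋-sym e)
  ≈-sym top     = top

  ≈-trans : ∀ {F G K} → F ≈ G → G ≈ K → F ≈ K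
  ≈-trans bot     bot       = bot
  ≈-trans (V e)   (V e′)    = V (≋-trans e e′)
  ≈-trans (E d e) (E d′ e′) = E (≋-trans d d′) (≋-trans e e′)
  ≈-trans (H d e) (H d′ e′) = H (≋-trans d d′) (≋-trans e e′)
  ≈-trans (T e)   (T e′)    = T (≋-trans e e′)
  ≈-trans top     top       = top

  ≤-reflexive : ∀ {F G} → F ≈ G → F ≤ G
  ≤-reflexive bot     = bot≤
  ≤-reflexive (V e)   = V≤V e
  ≤-reflexive (E d e) = E≤E d e
  ≤-reflexive (H d e) = H≤H d e
  ≤-reflexive (T e)   = T≤T e
  ≤-reflexive top     = ≤top

  ≤-antisym : ∀ {F G} → F ≤ G → G ≤ F → F ≈ G
  ≤-antisym bot≤      bot≤ = bot
  ≤-antisym ≤top      ≤top = top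
  ≤-antisym (V≤V e)   _    = V e
  ≤-antisym (E≤E d e) _    = E d e
  ≤-antisym (H≤H d e) _    = H d e
  ≤-antisym (T≤T e)   _    = T e

  ≤-trans : ∀ {F G K} → F ≤ G → G ≤ K → F ≤ K
  ≤-trans bot≤      _           = bot≤
  ≤-trans _         ≤top        = ≤top
  ≤-trans (V≤V e)   (V≤V e′)    = V≤V (≋-trans e e′)
  ≤-trans (V≤V e)   (V≤E i)     = V≤E (Sum.map (≋-trans e) (≋-trans e) i)
  ≤-trans (V≤V _)   V≤H         = V≤H
  ≤-trans (V≤V _)   V≤T         = V≤T
  ≤-trans (E≤E d e) (E≤E d′ e′) = E≤E (≋-trans d d′) (≋-trans e e′)
  ≤-trans (E≤E d e) (E≤H {j = j} i) =
    E≤H (≋-trans i (label-cong (≋-sym d) (≋-sym e) (≋-refl {x = j})))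
  ≤-trans (E≤E _ _) E≤T         = E≤T
  ≤-trans (H≤H d e) (H≤H d′ e′) = H≤H (≋-trans d d′) (≋-trans e e′)
  ≤-trans (H≤H d e) (H≤T i)     = H≤T (Sum.map (λ f → ≋-trans f (≋-sym d))
                                    (λ f → ≋-trans f (successor-cong (≋-sym d) (≋-sym e))) i)
  ≤-trans (T≤T e)   (T≤T e′)    = T≤T (≋-trans e e′)
  ≤-trans (V≤E i)   (E≤E d _)   = V≤E (Sum.map (λ f → ≋-trans f d) (λ f → ≋-trans f (+-congʳ (- 1ℤ) d)) i)
  ≤-trans (V≤E _)   (E≤H _)     = V≤H
  ≤-trans (V≤E _)   E≤T         = V≤T
  ≤-trans (E≤H {x} {y} i) (H≤H d e) =
    E≤H (≋-trans (≋-sym e) (≋-trans i (label-cong (≋-refl {x = x}) (≋-refl {x = y}) (mod-r⇒mod-m d))))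
  ≤-trans (E≤H _)   (H≤T _)     = E≤T
  ≤-trans (H≤T i)   (T≤T e)     = H≤T (Sum.map (≋-trans (≋-sym e)) (≋-trans (≋-sym e)) i)
  ≤-trans V≤H       (H≤H _ _)   = V≤H
  ≤-trans V≤H       (H≤T _)     = V≤T
  ≤-trans V≤T       (T≤T _)     = V≤T
  ≤-trans E≤T       (T≤T _)     = E≤T

  faces : Poset 0ℓ 0ℓ 0ℓ
  faces = record
    { Carrier        = Face
    ; _≈_            = _≈_
    ; _≤_            = _≤_
    ; isPartialOrder = record
      { isPreorder = record
        { isEquivalence = record { refl = ≈-refl ; sym = ≈-sym ; trans = ≈-trans }
        ; reflexive     = ≤-reflexive
        ; trans         = ≤-trans
        }
      ; antisym    = ≤-antisym
      }
    }

  open NonStrictToStrict _≈_ _≤_ public using (_<_)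

  rank-cong : ∀ {F G} → F ≈ G → rank F ≡ rank G
  rank-cong bot     = refl
  rank-cong (V _)   = refl
  rank-cong (E _ _) = refl
  rank-cong (H _ _) = refl
  rank-cong (T _)   = refl
  rank-cong top     = refl

  ≤∧rank≡⇒≈ : ∀ {F G} → F ≤ G → rank F ≡ rank G → F ≈ G
  ≤∧rank≡⇒≈ (bot≤ {bot}) refl = bot
  ≤∧rank≡⇒≈ (≤top {top}) refl = top
  ≤∧rank≡⇒≈ (V≤V e)      _    = V e
  ≤∧rank≡⇒≈ (E≤E d e)    _    = E d e
  ≤∧rank≡⇒≈ (H≤H d e)    _    = H d e
  ≤∧rank≡⇒≈ (T≤T e)      _    = T e

  rank-≤ : ∀ {F G} → F ≤ G → rank F Fin.≤ rank G
  rank-≤ bot≤      = ℕ.z≤n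
  rank-≤ {F} ≤top  = Fin.toℕ≤pred[n] (rank F)
  rank-≤ (V≤V _)   = ℕ.≤-refl
  rank-≤ (E≤E _ _) = ℕ.≤-refl
  rank-≤ (H≤H _ _) = ℕ.≤-refl
  rank-≤ (T≤T _)   = ℕ.≤-refl
  rank-≤ (V≤E _)   = ℕ.n≤1+n 1
  rank-≤ (E≤H _)   = ℕ.n≤1+n 2
  rank-≤ (H≤T _)   = ℕ.n≤1+n 3
  rank-≤ V≤H       = ℕ.m≤m+n 1 2
  rank-≤ V≤T       = ℕ.m≤m+n 1 3
  rank-≤ E≤T       = ℕ.m≤m+n 2 2

  rank-mono : ∀ {F G} → F < G → rank F Fin.< rank G
  rank-mono (F≤G , F≉G) = ℕ.≤∧≢⇒< (rank-≤ F≤G) λ e → F≉G (≤∧rank≡⇒≈ F≤G (Fin.toℕ-injective e))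

  strictly : ∀ {F G} → F ≤ G → rank F ≢ rank G → F < G
  strictly F≤G e = F≤G , λ F≈G → e (rank-cong F≈G)

∈-comparable : ∀ {A : Set} {R : A → A → Set} {xs} → AllPairs R xs →
               ∀ {x y} → x ∈ xs → y ∈ xs → x ≡ y ⊎ R x y ⊎ R y x
∈-comparable (_ AllPairs.∷ _)  (here refl) (here refl) = inj₁ refl
∈-comparable (R AllPairs.∷ _)  (here refl) (there y∈)  = inj₂ (inj₁ (All.lookup R y∈))
∈-comparable (R AllPairs.∷ _)  (there x∈)  (here refl) = inj₂ (inj₂ (All.lookup R x∈))
∈-comparable (_ AllPairs.∷ ps) (there x∈)  (there y∈)  = ∈-comparable ps x∈ y∈

lookup-AllPairs : ∀ {A : Set} {R : A → A → Set} {xs} → AllPairs R xs →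
                  ∀ {i j} → i Fin.< j → R (lookup xs i) (lookup xs j)
lookup-AllPairs (R AllPairs.∷ _)  {zero}  {suc j} _           = All.lookup R (∈-lookup j)
lookup-AllPairs (_ AllPairs.∷ ps) {suc i} {suc j} (ℕ.s≤s i<j) = lookup-AllPairs ps i<j

-- Sections of rank 2 as polygons

module Sections (m w κ : ℤ) (1≢0 : ¬ 1ℤ ≋ 0ℤ mod m) where
  open Modulus m w κ
  open Order m w κ

  private
    +1≢ : ∀ x → ¬ x + 1ℤ ≋ x mod m
    +1≢ x e = 1≢0 (≋-linear 1ℤ 0ℤ e (identity x m))
      where
      identity : ∀ x m → 1ℤ - 0ℤ ≡ 1ℤ * (x + 1ℤ - x) + 0ℤ * m
      identity = solve-∀

    -1≢ : ∀ x → ¬ x - 1ℤ ≋ x mod m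
    -1≢ x e = 1≢0 (≋-linear (- 1ℤ) 0ℤ e (identity x m))
      where
      identity : ∀ x m → 1ℤ - 0ℤ ≡ - 1ℤ * (x - 1ℤ - x) + 0ℤ * m
      identity = solve-∀

  predecessor≢ : ∀ j l → ¬ predecessor j l ≋ j mod r
  predecessor≢ j l e = -1≢ j (≋-trans (≋-sym (predecessor-mod-m j l)) (mod-r⇒mod-m e))

  successor≢ : ∀ j l → ¬ successor j l ≋ j mod r
  successor≢ j l e = +1≢ j (≋-trans (≋-sym (successor-mod-m j l)) (mod-r⇒mod-m e))

  V-1≉V : ∀ {x} → ¬ V (x - 1ℤ) ≈ V x
  V-1≉V {x} (V e) = -1≢ x e

  E+1≉E : ∀ {x y y′} → ¬ E (x + 1ℤ) y ≈ E x y′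
  E+1≉E {x} (E e _) = +1≢ x e

  H-predecessor≉H : ∀ {j l l′ l″} → ¬ H (predecessor j l) l′ ≈ H j l″
  H-predecessor≉H {j} {l} (H e _) = predecessor≢ j l e

  T-successor≉T : ∀ {j l} → ¬ T (successor j l) ≈ T j
  T-successor≉T {j} {l} (T e) = successor≢ j l e

  successor⇒predecessor : ∀ {j l t} → t ≋ successor j l mod r → j ≋ predecessor t l mod r
  successor⇒predecessor {j} {l} e = ≋-trans (≡⇒≋ (≡.sym (predecessor-successor j l)))
      (predecessor-cong (≋-sym e) (≋-refl {x = l}))

  E≤H-predecessor : ∀ {x y t l} → l ≋ y + x * (t - 1ℤ) mod m → E x y ≤ H (predecessor t l) l
  E≤H-predecessor {x} {y} {t} {l} e = E≤H (≋-trans e (≋-sym (label-predecessor x y t l)))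

  H-predecessor≤T : ∀ {t l} → H (predecessor t l) l ≤ T t
  H-predecessor≤T {t} {l} = H≤T (inj₂ (≡⇒≋ (≡.sym (successor-predecessor t l))))

  label⇒E≤H : ∀ x j l → E x (l - x * j) ≤ H j l
  label⇒E≤H x j l = E≤H (≡⇒≋ (identity x j l))
    where
    identity : ∀ x j l → l ≡ l - x * j + x * j
    identity = solve-∀

  E≤H⇒≋ : ∀ {x y j l} → E x y ≤ H j l → y ≋ l - x * j mod m
  E≤H⇒≋ {x} {y} {j} {l} (E≤H e) = ≋-linear (- 1ℤ) 0ℤ e (identity x y j l m)
    where
    identity : ∀ x y j l m → y - (l - x * j) ≡ - 1ℤ * (l - (y + x * j)) + 0ℤ * m
    identity = solve-∀

  faceSection : ∀ j l → CyclicSection faces bot (H j l) m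
  faceSection j l = record
    { vertex           = V
    ; edge             = edge
    ; vertex-between   = λ s → strictly bot≤ (λ ()) , strictly V≤H (λ ())
    ; edge-between     = λ s → strictly bot≤ (λ ()) , strictly (label⇒E≤H (s + 1ℤ) j l) (λ ())
    ; vertex-cong      = V
    ; edge-cong        = λ e → E (+-congʳ 1ℤ e)
        (+-congˡ l (neg-cong (*-cong (+-congʳ 1ℤ e) (≋-refl {x = j}))))
    ; vertex-injective = λ { (V e) → e }
    ; edge-injective   = λ { (E e _) → +-cancelʳ 1ℤ e }
    ; exhaustive       = exhaustive
    ; start            = λ s → V≤E (inj₂ (≡⇒≋ (identity s)))
    ; end              = λ s → V≤E (inj₁ ≋-refl)
    ; incident⇒        = λ { {s} {t} (V≤E (inj₁ e)) → inj₂ e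
                           ; {s} {t} (V≤E (inj₂ e)) → inj₁ (≋-trans e (≡⇒≋ (≡.sym (identity t)))) }
    }
    where
    edge : ℤ → Face
    -- `E x y` joins `V (x - 1ℤ)` and `V x`, so the edge leaving `V s` has first coordinate
    -- `s + 1ℤ`; incidence with `H j l` forces the second.
    edge s = E (s + 1ℤ) (l - (s + 1ℤ) * j)

    identity : ∀ s → s ≡ s + 1ℤ - 1ℤ
    identity = solve-∀

    identity′ : ∀ s → s ≡ s - 1ℤ + 1ℤ
    identity′ = solve-∀

    exhaustive : ∀ {F} → bot < F → F < H j l → (∃[ s ] F ≈ V s) ⊎ (∃[ s ] F ≈ edge s)
    exhaustive {bot}   (_ , bot≉bot) _ = contradiction bot bot≉bot
    exhaustive {V i}   _ _             = inj₁ (i , ≈-refl)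
    exhaustive {E x y} _ (E≤H e , _)   = inj₂ (x - 1ℤ , E (≡⇒≋ (identity′ x))
      (≋-trans (E≤H⇒≋ {x} (E≤H e)) (≡⇒≋ (cong (λ t → l - t * j) (identity′ x)))))
    exhaustive {H _ _} _ (H≤H d e , ≉) = contradiction (H d e) ≉

  middleSection : ∀ i t → AlternatingSection faces (V i) (T t) m
  middleSection i t = record
    { vertex           = vertex
    ; edge             = edge
    ; vertex-between   = λ { false s → strictly (V≤E (inj₁ ≋-refl)) (λ ()) , strictly E≤T (λ ())
                           ; true  s → strictly (V≤E (inj₂ (≡⇒≋ (+1-1 i)))) (λ ()) , strictly E≤T (λ ()) }
    ; edge-between     = λ { false s → strictly V≤H (λ ()) , strictly (H≤T (inj₁ ≋-refl)) (λ ())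
                           ; true  s → strictly V≤H (λ ()) , strictly (H-predecessor≤T {t}) (λ ()) }
    ; vertex-cong      = λ { false e → E ≋-refl (neg-cong e)
                           ; true  e → E ≋-refl (+-congʳ (- t) (neg-cong e)) }
    ; edge-cong        = λ { false e → H ≋-refl (+-congˡ (i * t) (neg-cong e))
                           ; true  e → H (predecessor-cong (≋-refl {x = t}) (lower-cong e)) (lower-cong e) }
    ; vertex-injective = vertex-injective
    ; edge-injective   = edge-injective
    ; exhaustive       = exhaustive
    ; even-even        = λ s → E≤H (≡⇒≋ (identity₁ i s t))
    ; odd-even         = λ s → E≤H (≡⇒≋ (identity₂ i s t))
    ; odd-odd          = λ s → E≤H-predecessor {t = t} (≡⇒≋ (identity₃ i s t))
    ; even-odd         = λ s → E≤H-predecessor {t = t} (≡⇒≋ (identity₄ i s t))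
    ; even-even⇒       = λ { {s} {u} (E≤H e) → ≋-linear 1ℤ 0ℤ e (identity₅ i s t u m) }
    ; odd-even⇒        = λ { {s} {u} (E≤H e) → ≋-linear 1ℤ 0ℤ e (identity₆ i s t u m) }
    ; odd-odd⇒         = λ { {s} {u} (E≤H e) → ≋-linear 1ℤ 0ℤ
                               (≋-trans e (label-predecessor (i + 1ℤ) (- s - t) t (lower u)))
                                   (identity₇ i s t u m) }
    ; even-odd⇒        = λ { {s} {u} (E≤H e) → ≋-linear 1ℤ 0ℤ
                               (≋-trans e (label-predecessor i (- s) t (lower u))) (identity₈ i s t u m) }
    }
    where
    -- The label of a 2-face behind `T t`, whose first coordinate is `t - 1` modulo `m`: it is the
    -- value there of both `E (i + 1ℤ) (- s - t)` and the next even vertex `E i (- (s + 1ℤ))`. Two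
    -- edges further on, the second coordinate has dropped by one, which is why the polygon has `2m`
    -- sides.
    lower : ℤ → ℤ
    lower s = i * t - i - 1ℤ - s

    lower-cong : ∀ {s u} → s ≋ u mod m → lower s ≋ lower u mod m
    lower-cong e = +-congˡ (i * t - i - 1ℤ) (neg-cong e)

    vertex edge : Bool → ℤ → Face
    vertex false s = E i (- s)
    vertex true  s = E (i + 1ℤ) (- s - t)
    edge   false s = H t (i * t - s)
    edge   true  s = H (predecessor t (lower s)) (lower s)

    +1-1 : ∀ i → i ≡ i + 1ℤ - 1ℤ
    +1-1 = solve-∀
    identity₁ : ∀ i s t → i * t - s ≡ - s + i * t
    identity₁ = solve-∀
    identity₂ : ∀ i s t → i * t - s ≡ - s - t + (i + 1ℤ) * t
    identity₂ = solve-∀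
    identity₃ : ∀ i s t → i * t - i - 1ℤ - s ≡ - s - t + (i + 1ℤ) * (t - 1ℤ)
    identity₃ = solve-∀
    identity₄ : ∀ i s t → i * t - i - 1ℤ - s ≡ - (s + 1ℤ) + i * (t - 1ℤ)
    identity₄ = solve-∀
    identity₅ : ∀ i s t u m → s - u ≡ 1ℤ * (i * t - u - (- s + i * t)) + 0ℤ * m
    identity₅ = solve-∀
    identity₆ : ∀ i s t u m → s - u ≡ 1ℤ * (i * t - u - (- s - t + (i + 1ℤ) * t)) + 0ℤ * m
    identity₆ = solve-∀
    identity₇ : ∀ i s t u m → s - u ≡ 1ℤ * (i * t - i - 1ℤ - u - (- s - t + (i + 1ℤ) * (t - 1ℤ))) + 0ℤ * m
    identity₇ = solve-∀
    identity₈ : ∀ i s t u m → s - (u + 1ℤ) ≡ 1ℤ * (i * t - i - 1ℤ - u - (- s + i * (t - 1ℤ))) + 0ℤ * m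
    identity₈ = solve-∀
    identity₉ : ∀ s u c m → s - u ≡ - 1ℤ * (c - s - (c - u)) + 0ℤ * m
    identity₉ = solve-∀

    cancel : ∀ {s u} c → c - s ≋ c - u mod m → s ≋ u mod m
    cancel {s} {u} c e = ≋-linear (- 1ℤ) 0ℤ e (identity₉ s u c m)

    neg-injective : ∀ {s u} → - s ≋ - u mod m → s ≋ u mod m
    neg-injective {s} {u} e = cancel 0ℤ (+-congˡ 0ℤ e)

    vertex-injective : ∀ {b c s u} → vertex b s ≈ vertex c u → b ≡ c × s ≋ u mod m
    vertex-injective {false} {false} (E _ e) = refl , neg-injective e
    vertex-injective {true}  {true}  (E _ e) = refl , neg-injective (+-cancelʳ (- t) e)
    vertex-injective {false} {true}  e       = contradiction (≈-sym e) E+1≉E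
    vertex-injective {true}  {false} e       = contradiction e E+1≉E

    edge-injective : ∀ {b c s u} → edge b s ≈ edge c u → b ≡ c × s ≋ u mod m
    edge-injective {false} {false} (H _ e) = refl , cancel (i * t) e
    edge-injective {true}  {true}  (H _ e) = refl , cancel (i * t - i - 1ℤ) e
    edge-injective {false} {true}  {s} {u} e = contradiction (≈-sym e) (H-predecessor≉H {t} {lower u})
    edge-injective {true}  {false} {s} {u} e = contradiction e (H-predecessor≉H {t} {lower s})

    exhaustive : ∀ {F} → V i < F → F < T t →
                 (∃[ b ] ∃[ s ] F ≈ vertex b s) ⊎ (∃[ b ] ∃[ s ] F ≈ edge b s)
    exhaustive {V _}   (V≤V e , ≉) _ = contradiction (V e) ≉
    exhaustive {E x y} (V≤E (inj₁ e) , _) _ =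
      inj₁ (false , - y , E (≋-sym e) (≡⇒≋ (≡.sym (ℤ.neg-involutive y))))
    exhaustive {E x y} (V≤E (inj₂ e) , _) _ =
      inj₁ (true , - y - t , E (≋-linear (- 1ℤ) 0ℤ e (identity i x m)) (≡⇒≋ (identity′ y t)))
      where
      identity : ∀ i x m → x - (i + 1ℤ) ≡ - 1ℤ * (i - (x - 1ℤ)) + 0ℤ * m
      identity = solve-∀
      identity′ : ∀ y t → y ≡ - (- y - t) - t
      identity′ = solve-∀
    exhaustive {H j l} _ (H≤T (inj₁ e) , _) = inj₂
        (false , i * t - l , H (≋-sym e) (≡⇒≋ (identity (i * t) l)))
      where
      identity : ∀ c l → l ≡ c - (c - l)
      identity = solve-∀
    exhaustive {H j l} _ (H≤T (inj₂ e) , _) =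
      inj₂ (true , i * t - i - 1ℤ - l ,
            H (≋-trans (successor⇒predecessor {l = l} e) (predecessor-cong (≋-refl {x = t}) l≋)) l≋)
      where
      identity : ∀ c l → l ≡ c - (c - l)
      identity = solve-∀
      l≋ : l ≋ i * t - i - 1ℤ - (i * t - i - 1ℤ - l) mod m
      l≋ = ≡⇒≋ (identity (i * t - i - 1ℤ) l)
    exhaustive {T _} _ (T≤T e , ≉) = contradiction (T e) ≉

  edgeFigure : ∀ x y → CyclicSection faces (E x y) top r
  edgeFigure x y = record
    { vertex           = vertex
    ; edge             = edge
    ; vertex-between   = λ s → strictly (E≤vertex s) (λ ()) , strictly ≤top (λ ())
    ; edge-between     = λ s → strictly E≤T (λ ()) , strictly ≤top (λ ())
    ; vertex-cong      = λ e → H (spiral-cong x y e) (+-congˡ y (*-congˡ x (mod-r⇒mod-m e)))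
    ; edge-cong        = λ e → T (spiral-cong x y (+-congʳ 1ℤ e))
    ; vertex-injective = λ { (H e _) → spiral-injective x y e }
    ; edge-injective   = λ { (T e) → +-cancelʳ 1ℤ (spiral-injective x y e) }
    ; exhaustive       = exhaustive
    ; start            = λ s → H≤T (inj₂ (≡⇒≋ (spiral-suc x y s)))
    ; end              = λ s → H≤T (inj₁ ≋-refl)
    ; incident⇒        = λ { {s} {t} (H≤T (inj₁ e)) → inj₂ (≋-sym (spiral-injective x y e))
                           ; {s} {t} (H≤T (inj₂ e)) → inj₁ (≋-sym (+-cancelʳ 1ℤ (spiral-injective x y
                               (≋-trans e (≡⇒≋ (≡.sym (spiral-suc x y s))))))) }
    }
    where
    vertex edge : ℤ → Face
    vertex n = H (spiral x y n) (y + x * n)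
    -- The facet reached across the 2-face number `n` is its successor, hence the shift by one.
    edge   n = T (spiral x y (n + 1ℤ))

    E≤vertex : ∀ n → E x y ≤ vertex n
    E≤vertex n = E≤H (≋-sym (label-spiral x y n))

    exhaustive : ∀ {F} → E x y < F → F < top → (∃[ n ] F ≈ vertex n) ⊎ (∃[ n ] F ≈ edge n)
    exhaustive {E _ _} (E≤E d e , ≉) _ = contradiction (E d e) ≉
    exhaustive {H j l} (E≤H e , _) _ = inj₁ (spiral⁻¹ x y j , H (≋-sym (spiral-spiral⁻¹ x y j))
      (≋-trans e (≋-trans (+-congˡ y (*-congˡ x (mod-r⇒mod-m (≋-sym (spiral-spiral⁻¹ x y j)))))
                          (label-spiral x y (spiral⁻¹ x y j)))))
    exhaustive {T t} _ _ = inj₂ (spiral⁻¹ x y t - 1ℤ , T (≋-trans (≋-sym (spiral-spiral⁻¹ x y t))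
      (≡⇒≋ (cong (spiral x y) (identity (spiral⁻¹ x y t))))))
      where
      identity : ∀ s → s ≡ s - 1ℤ + 1ℤ
      identity = solve-∀
    exhaustive {top} _ (_ , ≉) = contradiction top ≉

-- The axioms of a polytope

module Construction (m w κ : ℤ) (1≢0 : ¬ 1ℤ ≋ 0ℤ mod m) where
  open Modulus m w κ
  open Order m w κ
  open Sections m w κ 1≢0

  <-trans : ∀ {F G K} → F < G → G < K → F < K
  <-trans = NonStrictToStrict.<-trans _≈_ _≤_ (Poset.isPartialOrder faces)

  Between : Face → Face → Set
  Between F G = Σ[ A ∈ Face ] (F < A × A < G)

  Connected : Face → Face → Set
  Connected F G = (A B : Between F G) → EqClosure (_≤_ on proj₁) A B

  -- Suitable hubs exist because each vertex lies on all 2-faces and facets and each edge on all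
  -- facets, so every face reaches the hub in a few steps.
  hub : ∀ {F G} (C : Between F G) → (∀ A → EqClosure (_≤_ on proj₁) A C) → Connected F G
  hub C toC A B = toC A ◅◅ EqClosure.symmetric _ (toC B)

  V∈bot-T : ∀ {t} i → Between bot (T t)
  V∈bot-T i = V i , strictly bot≤ (λ ()) , strictly V≤T (λ ())

  H∈bot-T : ∀ t → Between bot (T t)
  H∈bot-T t = H t 0ℤ , strictly bot≤ (λ ()) , strictly (H≤T (inj₁ ≋-refl)) (λ ())

  bot-T-connected : ∀ t → Connected bot (T t)
  bot-T-connected t = hub (H∈bot-T t) λ
    { (bot   , (_ , ≉) , _)       → contradiction bot ≉
    ; (V i   , _)                 → fwd V≤H ◅ ε
    ; (E x y , _)                 → _◅_ {j = V∈bot-T x} (bwd (V≤E (inj₁ ≋-refl))) (fwd V≤H ◅ ε)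
    ; (H j l , _)                 → _◅_ {j = V∈bot-T 0ℤ} (bwd V≤H) (fwd V≤H ◅ ε)
    ; (T t′  , _ , (T≤T e , ≉))   → contradiction (T e) ≉
    }

  bot-top-connected : Connected bot top
  bot-top-connected = hub (T 0ℤ , strictly bot≤ (λ ()) , strictly ≤top (λ ())) λ
    { (bot   , (_ , ≉) , _) → contradiction bot ≉
    ; (V i   , _)           → fwd V≤T ◅ ε
    ; (E x y , _)           → fwd E≤T ◅ ε
    ; (H j l , _)           → _◅_ {j = V₀} (bwd V≤H) (fwd V≤T ◅ ε)
    ; (T t   , _)           → _◅_ {j = V₀} (bwd V≤T) (fwd V≤T ◅ ε)
    ; (top   , _ , (_ , ≉)) → contradiction top ≉
    }
    where
    V₀ : Between bot top
    V₀ = V 0ℤ , strictly bot≤ (λ ()) , strictly ≤top (λ ())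

  V-top-connected : ∀ i → Connected (V i) top
  V-top-connected i = hub (T 0ℤ , strictly V≤T (λ ()) , strictly ≤top (λ ())) λ
    { (V i′  , (V≤V e , ≉) , _) → contradiction (V e) ≉
    ; (E x y , _)               → fwd E≤T ◅ ε
    ; (H j l , _)               → _◅_ {j = T j , strictly V≤T (λ ()) , strictly ≤top (λ ())}
                                    (fwd (H≤T (inj₁ ≋-refl))) (_◅_ {j = E₀} (bwd E≤T) (fwd E≤T ◅ ε))
    ; (T t   , _)               → _◅_ {j = E₀} (bwd E≤T) (fwd E≤T ◅ ε)
    ; (top   , _ , (_ , ≉))     → contradiction top ≉
    }
    where
    E₀ : Between (V i) top
    E₀ = E i 0ℤ , strictly (V≤E (inj₁ ≋-refl)) (λ ()) , strictly ≤top (λ ())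

  connected : ∀ {F G} → F < G → 3 ℕ.+ toℕ (rank F) ℕ.≤ toℕ (rank G) → Connected F G
  connected (bot≤ {bot} , _)   ()
  connected (bot≤ {V _} , _)   (ℕ.s≤s ())
  connected (bot≤ {E _ _} , _) (ℕ.s≤s (ℕ.s≤s ()))
  connected (bot≤ {H j l} , _) _ = CyclicSection.connected (faceSection j l)
  connected (bot≤ {T t} , _)   _ = bot-T-connected t
  connected (bot≤ {top} , _)   _ = bot-top-connected
  connected (≤top {bot} , _)   _ = bot-top-connected
  connected (≤top {V i} , _)   _ = V-top-connected i
  connected (≤top {E x y} , _) _ = CyclicSection.connected (edgeFigure x y)
  connected (≤top {H _ _} , _) (ℕ.s≤s (ℕ.s≤s (ℕ.s≤s (ℕ.s≤s (ℕ.s≤s ())))))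
  connected (≤top {T _} , _)   (ℕ.s≤s (ℕ.s≤s (ℕ.s≤s (ℕ.s≤s (ℕ.s≤s ())))))
  connected (≤top {top} , _)   (ℕ.s≤s (ℕ.s≤s (ℕ.s≤s (ℕ.s≤s (ℕ.s≤s ())))))
  connected (V≤V _ , _)        (ℕ.s≤s ())
  connected (E≤E _ _ , _)      (ℕ.s≤s (ℕ.s≤s ()))
  connected (H≤H _ _ , _)      (ℕ.s≤s (ℕ.s≤s (ℕ.s≤s ())))
  connected (T≤T _ , _)        (ℕ.s≤s (ℕ.s≤s (ℕ.s≤s (ℕ.s≤s ()))))
  connected (V≤E _ , _)        (ℕ.s≤s (ℕ.s≤s ()))
  connected (E≤H _ , _)        (ℕ.s≤s (ℕ.s≤s (ℕ.s≤s ())))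
  connected (H≤T _ , _)        (ℕ.s≤s (ℕ.s≤s (ℕ.s≤s (ℕ.s≤s ()))))
  connected (V≤H , _)          (ℕ.s≤s (ℕ.s≤s (ℕ.s≤s ())))
  connected (V≤T {i} {t} , _)  _ = CyclicSection.connected (alternating⇒cyclic faces (middleSection i t))
  connected (E≤T , _)          (ℕ.s≤s (ℕ.s≤s (ℕ.s≤s (ℕ.s≤s ()))))

  Diamond : Face → Face → Set
  Diamond F G = Σ[ A ∈ Between F G ] Σ[ B ∈ Between F G ]
    (¬ proj₁ A ≈ proj₁ B × ((C : Between F G) → proj₁ C ≈ proj₁ A ⊎ proj₁ C ≈ proj₁ B))

  bot-E-diamond : ∀ x y → Diamond bot (E x y)
  bot-E-diamond x y =
    (V (x - 1ℤ) , strictly bot≤ (λ ()) , strictly (V≤E (inj₂ ≋-refl)) (λ ())) ,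
    (V x , strictly bot≤ (λ ()) , strictly (V≤E (inj₁ ≋-refl)) (λ ())) ,
    V-1≉V ,
    λ { (bot   , (_ , ≉) , _)            → contradiction bot ≉
      ; (V i   , _ , (V≤E (inj₁ e) , _)) → inj₂ (V e)
      ; (V i   , _ , (V≤E (inj₂ e) , _)) → inj₁ (V e)
      ; (E _ _ , _ , (E≤E d e , ≉))      → contradiction (E d e) ≉ }

  private
    -1⇒+1 : ∀ {i x} → i ≋ x - 1ℤ mod m → x ≋ i + 1ℤ mod m
    -1⇒+1 {i} {x} e = ≋-linear (- 1ℤ) 0ℤ e (identity i x m)
      where
      identity : ∀ i x m → x - (i + 1ℤ) ≡ - 1ℤ * (i - (x - 1ℤ)) + 0ℤ * m
      identity = solve-∀

    +1-1 : ∀ i → i ≡ i + 1ℤ - 1ℤ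
    +1-1 = solve-∀

  edge-of : ∀ {x x′ y j l} → x ≋ x′ mod m → E x y ≤ H j l → E x y ≈ E x′ (l - x′ * j)
  edge-of {j = j} {l} x≋x′ E≤H′ = E x≋x′ (≋-trans (E≤H⇒≋ E≤H′)
      (+-congˡ l (neg-cong (*-cong x≋x′ (≋-refl {x = j})))))

  V-H-diamond : ∀ i j l → Diamond (V i) (H j l)
  V-H-diamond i j l =
    (E (i + 1ℤ) (l - (i + 1ℤ) * j) , strictly (V≤E (inj₂ (≡⇒≋ (+1-1 i)))) (λ ()) , strictly
        (label⇒E≤H (i + 1ℤ) j l) (λ ())) ,
    (E i (l - i * j) , strictly (V≤E (inj₁ ≋-refl)) (λ ()) , strictly (label⇒E≤H i j l) (λ ())) ,
    E+1≉E ,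
    λ { (V _   , (V≤V e , ≉) , _)              → contradiction (V e) ≉
      ; (E x y , (V≤E (inj₁ e) , _) , (E≤H′ , _)) → inj₂ (edge-of (≋-sym e) E≤H′)
      ; (E x y , (V≤E (inj₂ e) , _) , (E≤H′ , _)) → inj₁ (edge-of (-1⇒+1 e) E≤H′)
      ; (H _ _ , _ , (H≤H d e , ≉))            → contradiction (H d e) ≉ }

  E-T-diamond : ∀ x y t → Diamond (E x y) (T t)
  E-T-diamond x y t =
    (H (predecessor t l′) l′ , strictly (E≤H-predecessor {t = t} ≋-refl) (λ ()) , strictly
        (H-predecessor≤T {t}) (λ ())) ,
    (H t (y + x * t) , strictly (E≤H ≋-refl) (λ ()) , strictly (H≤T (inj₁ ≋-refl)) (λ ())) ,
    H-predecessor≉H {t} {l′} ,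
    λ { (E _ _ , (E≤E d e , ≉) , _) → contradiction (E d e) ≉
      ; (H j l , (E≤H e , _) , (H≤T (inj₁ f) , _)) →
          inj₂ (H (≋-sym f) (≋-trans e (+-congˡ y (*-congˡ x (mod-r⇒mod-m (≋-sym f))))))
      ; (H j l , (E≤H e , _) , (H≤T (inj₂ f) , _)) → inj₁ (backward e f)
      ; (T _ , _ , (T≤T e , ≉)) → contradiction (T e) ≉ }
    where
    l′ : ℤ
    l′ = y + x * (t - 1ℤ)

    backward : ∀ {j l} → l ≋ y + x * j mod m → t ≋ successor j l mod r → H j l ≈ H (predecessor t l′) l′
    backward {j} {l} e f = H (≋-trans j≋ (predecessor-cong (≋-refl {x = t}) l≋)) l≋
      where
      j≋ : j ≋ predecessor t l mod r
      j≋ = successor⇒predecessor {l = l} f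
      l≋ : l ≋ l′ mod m
      l≋ = ≋-trans e (+-congˡ y (*-congˡ x (≋-trans (mod-r⇒mod-m j≋) (predecessor-mod-m t l))))

  H-top-diamond : ∀ j l → Diamond (H j l) top
  H-top-diamond j l =
    (T (successor j l) , strictly (H≤T (inj₂ ≋-refl)) (λ ()) , strictly ≤top (λ ())) ,
    (T j , strictly (H≤T (inj₁ ≋-refl)) (λ ()) , strictly ≤top (λ ())) ,
    T-successor≉T {j} {l} ,
    λ { (H _ _ , (H≤H d e , ≉) , _)        → contradiction (H d e) ≉
      ; (T t , (H≤T (inj₁ e) , _) , _)     → inj₂ (T e)
      ; (T t , (H≤T (inj₂ e) , _) , _)     → inj₁ (T e)
      ; (top , _ , (_ , ≉))                → contradiction top ≉ }

  diamond : ∀ {F G} → F < G → 2 ℕ.+ toℕ (rank F) ≡ toℕ (rank G) → Diamond F G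
  diamond (bot≤ {bot} , _)   ()
  diamond (bot≤ {V _} , _)   ()
  diamond (bot≤ {E x y} , _) _ = bot-E-diamond x y
  diamond (bot≤ {H _ _} , _) ()
  diamond (bot≤ {T _} , _)   ()
  diamond (bot≤ {top} , _)   ()
  diamond (≤top {bot} , _)   ()
  diamond (≤top {V _} , _)   ()
  diamond (≤top {E _ _} , _) ()
  diamond (≤top {H j l} , _) _ = H-top-diamond j l
  diamond (≤top {T _} , _)   ()
  diamond (≤top {top} , _)   ()
  diamond (V≤H {i} {j} {l} , _) _ = V-H-diamond i j l
  diamond (E≤T {x} {y} {t} , _) _ = E-T-diamond x y t

  -- An arbitrary maximal chain is only known to contain every face comparable with all its members.
  -- So a comparable face is constructed for each rank; then `rank` and `position` are injections
  -- between the places of the chain and the six ranks.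
  module MaximalChains (c : List Face) (chain : Linked _<_ c)
    (complete : ∀ F → All (λ G → F ≤ G ⊎ G ≤ F) c → Any (F ≈_) c) where

    private
      ordered : AllPairs _<_ c
      ordered = Linked.Linked⇒AllPairs <-trans chain

      same : ∀ {F G} → F ∈ c → G ∈ c → rank F ≡ rank G → F ≈ G
      same F∈c G∈c e with ∈-comparable ordered F∈c G∈c
      ... | inj₁ refl              = ≈-refl
      ... | inj₂ (inj₁ (F≤G , _))  = ≤∧rank≡⇒≈ F≤G e
      ... | inj₂ (inj₂ (G≤F , _))  = ≈-sym (≤∧rank≡⇒≈ G≤F (≡.sym e))

      Member : Fin 6 → Set
      Member k = ∃[ F ] (F ∈ c × rank F ≡ k)

      member? : ∀ k → Dec (Member k)
      member? k = map′ find (λ (F , F∈c , e) → lose F∈c e) (Any.any? (λ F → rank F Fin.≟ k) c)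

      -- The chain is a finite list, so it can be searched for a given rank. If that rank is
      -- missing, comparability with the other ranks is comparability with everything, and
      -- completeness applies.
      fill : ∀ F → (∀ {G} → G ∈ c → rank G ≢ rank F → F ≤ G ⊎ G ≤ F) → Member (rank F)
      fill F comparable with member? (rank F)
      ... | yes F∈c = F∈c
      ... | no  F∉c with find (complete F (All.tabulate
          (λ {G} G∈c → comparable G∈c (λ e → F∉c (G , G∈c , e)))))
      ...   | G , G∈c , F≈G = G , G∈c , ≡.sym (rank-cong F≈G)

      -- Vertex and facet are supplied first, as each is constrained by a single neighbour: the edge
      -- and the 2-face, respectively. An edge can then be fitted between the vertex and a 2-face if
      -- there is one, and finally a 2-face between the edge and the facet.
      member₁ : Member (rank (V 0ℤ))
      member₁ with member? 2F
      ... | yes (E x y , E∈c , _) = fill (V x) λ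
        { {bot}   _   _ → inj₂ bot≤
        ; {V _}   _   ≢ → contradiction refl ≢
        ; {E _ _} G∈c _ → inj₁ (≤-trans (V≤E (inj₁ ≋-refl)) (≤-reflexive (same E∈c G∈c refl)))
        ; {H _ _} _   _ → inj₁ V≤H
        ; {T _}   _   _ → inj₁ V≤T
        ; {top}   _   _ → inj₁ ≤top }
      ... | no  E∉c = fill (V 0ℤ) λ
        { {bot}   _   _ → inj₂ bot≤
        ; {V _}   _   ≢ → contradiction refl ≢
        ; {E _ _} G∈c _ → contradiction (_ , G∈c , refl) E∉c
        ; {H _ _} _   _ → inj₁ V≤H
        ; {T _}   _   _ → inj₁ V≤T
        ; {top}   _   _ → inj₁ ≤top }

      member₄ : Member (rank (T 0ℤ))
      member₄ with member? 3F
      ... | yes (H j l , H∈c , _) = fill (T j) λ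
        { {bot}   _   _ → inj₂ bot≤
        ; {V _}   _   _ → inj₂ V≤T
        ; {E _ _} _   _ → inj₂ E≤T
        ; {H _ _} G∈c _ → inj₂ (≤-trans (≤-reflexive (same G∈c H∈c refl)) (H≤T (inj₁ ≋-refl)))
        ; {T _}   _   ≢ → contradiction refl ≢
        ; {top}   _   _ → inj₁ ≤top }
      ... | no  H∉c = fill (T 0ℤ) λ
        { {bot}   _   _ → inj₂ bot≤
        ; {V _}   _   _ → inj₂ V≤T
        ; {E _ _} _   _ → inj₂ E≤T
        ; {H _ _} G∈c _ → contradiction (_ , G∈c , refl) H∉c
        ; {T _}   _   ≢ → contradiction refl ≢
        ; {top}   _   _ → inj₁ ≤top }

      member₂ : Member (rank (E 0ℤ 0ℤ))
      member₂ with member₁ | member? 3F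
      ... | V i , V∈c , _ | yes (H j l , H∈c , _) = fill (E i (l - i * j)) λ
        { {bot}   _   _ → inj₂ bot≤
        ; {V _}   G∈c _ → inj₂ (≤-trans (≤-reflexive (same G∈c V∈c refl)) (V≤E (inj₁ ≋-refl)))
        ; {E _ _} _   ≢ → contradiction refl ≢
        ; {H _ _} G∈c _ → inj₁ (≤-trans (label⇒E≤H i j l) (≤-reflexive (same H∈c G∈c refl)))
        ; {T _}   _   _ → inj₁ E≤T
        ; {top}   _   _ → inj₁ ≤top }
      ... | V i , V∈c , _ | no H∉c = fill (E i 0ℤ) λ
        { {bot}   _   _ → inj₂ bot≤
        ; {V _}   G∈c _ → inj₂ (≤-trans (≤-reflexive (same G∈c V∈c refl)) (V≤E (inj₁ ≋-refl)))
        ; {E _ _} _   ≢ → contradiction refl ≢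
        ; {H _ _} G∈c _ → contradiction (_ , G∈c , refl) H∉c
        ; {T _}   _   _ → inj₁ E≤T
        ; {top}   _   _ → inj₁ ≤top }

      member₃ : Member (rank (H 0ℤ 0ℤ))
      member₃ with member₂ | member₄
      ... | E x y , E∈c , _ | T t , T∈c , _ = fill (H t (y + x * t)) λ
        { {bot}   _   _ → inj₂ bot≤
        ; {V _}   _   _ → inj₂ V≤H
        ; {E _ _} G∈c _ → inj₂ (≤-trans (≤-reflexive (same G∈c E∈c refl)) (E≤H ≋-refl))
        ; {H _ _} _   ≢ → contradiction refl ≢
        ; {T _}   G∈c _ → inj₁ (≤-trans (H≤T (inj₁ ≋-refl)) (≤-reflexive (same T∈c G∈c refl)))
        ; {top}   _   _ → inj₁ ≤top }

      member : ∀ k → Member k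
      member zero = fill bot (λ _ _ → inj₁ bot≤)
      member 1F = member₁
      member 2F = member₂
      member 3F = member₃
      member 4F = member₄
      member 5F = fill top (λ _ _ → inj₂ ≤top)

      position : Fin 6 → Fin (length c)
      position k = Any.index (proj₁ (proj₂ (member k)))

      rank-position : ∀ k → rank (lookup c (position k)) ≡ k
      rank-position k with member k
      ... | F , F∈c , refl = cong rank (≡.sym (lookup-index F∈c))

      rank-lookup-injective : ∀ {i j} → rank (lookup c i) ≡ rank (lookup c j) → i ≡ j
      rank-lookup-injective {i} {j} e with Fin.<-cmp i j
      ... | tri< i<j _ _ = contradiction e (Fin.<⇒≢ (rank-mono (lookup-AllPairs ordered i<j)))
      ... | tri≈ _ i≡j _ = i≡j
      ... | tri> _ _ i>j = contradiction (≡.sym e) (Fin.<⇒≢ (rank-mono (lookup-AllPairs ordered i>j)))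

    length≡6 : length c ≡ 6
    length≡6 = ℕ.≤-antisym
      (Fin.injective⇒≤ {f = λ i → rank (lookup c i)} rank-lookup-injective)
      (Fin.injective⇒≤ {f = position} λ {k} {k′} e →
        ≡.trans (≡.sym (rank-position k)) (≡.trans (cong (λ i → rank (lookup c i)) e) (rank-position k′)))

  polytope : Polytope 4
  polytope = record
    { faces          = faces
    ; rank           = rank
    ; rank-cong      = rank-cong
    ; rank-mono      = rank-mono
    ; least          = bot
    ; least-min      = λ _ → bot≤
    ; greatest       = top
    ; greatest-max   = λ _ → ≤top
    ; maximal-length = λ c (chain , complete) → MaximalChains.length≡6 c chain complete
    ; connected      = connected
    ; diamond        = diamond
    }

-- The type of the polytope

module _ (m r : ℕ) .{{_ : ℕ.NonZero m}} .{{_ : ℕ.NonZero r}} (w κ : ℤ) (1≢0 : ¬ 1ℤ ≋ 0ℤ mod (+ m))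
         (r≡ : w * + m * + m ≡ + r) where
  open Order (+ m) w κ
  open Sections (+ m) w κ 1≢0
  open Construction (+ m) w κ 1≢0

  private instance
    2m≢0 : ℕ.NonZero (2 ℕ.* m)
    2m≢0 = ℕ.m*n≢0 2 m

  hasType : HasType polytope (m ∷ 2 ℕ.* m ∷ r ∷ [])
  hasType zero {bot} {H j l} _ _ _ = cyclic⇒polygon polytope refl (faceSection j l) (λ _ → refl) (λ _ → refl)
  hasType 1F {V i} {T t} _ _ _ = cyclic⇒polygon polytope (≡.sym (ℤ.pos-* 2 m))
    (alternating⇒cyclic faces (middleSection i t)) (λ _ → vertex-rank _ _) (λ _ → edge-rank _ _)
    where
    vertex-rank : ∀ b a → toℕ (rank (AlternatingSection.vertex (middleSection i t) b a)) ≡ 2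
    vertex-rank false a = refl
    vertex-rank true  a = refl

    edge-rank : ∀ b a → toℕ (rank (AlternatingSection.edge (middleSection i t) b a)) ≡ 3
    edge-rank false a = refl
    edge-rank true  a = refl
  hasType 2F {E x y} {top} _ _ _ = cyclic⇒polygon polytope r≡ (edgeFigure x y) (λ _ → refl) (λ _ → refl)

-- The flag graph

module FlagGraph (m w κ : ℤ) (1≢0 : ¬ 1ℤ ≋ 0ℤ mod m) where
  open Modulus m w κ
  open Order m w κ
  open Sections m w κ 1≢0
  open Construction m w κ 1≢0
  open Setoid (flags polytope) public using () renaming
      (_≈_ to _≈ᶠ_; refl to ≈ᶠ-refl; sym to ≈ᶠ-sym; trans to ≈ᶠ-trans)

  vertexOf : Bool → ℤ → ℤ
  vertexOf false x = x
  vertexOf true  x = x - 1ℤ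

  facetOf : Bool → ℤ → ℤ → ℤ
  facetOf false j l = j
  facetOf true  j l = successor j l

  -- Explicit coordinates for all flags: `δ` selects an end of the edge `E x y`, `η` one of the two
  -- facets at the 2-face, and the label of the 2-face is determined by the edge and `j`.
  record FlagIndex : Set where
    constructor ⟪_,_,_,_,_⟫
    field
      δ     : Bool
      x y j : ℤ
      η     : Bool

    l : ℤ
    l = y + x * j

    faceAt : Fin 6 → Face
    faceAt zero = bot
    faceAt 1F = V (vertexOf δ x)
    faceAt 2F = E x y
    faceAt 3F = H j l
    faceAt 4F = T (facetOf η j l)
    faceAt 5F = top

    rank-faceAt : ∀ i → rank (faceAt i) ≡ i
    rank-faceAt zero = refl
    rank-faceAt 1F = refl
    rank-faceAt 2F = refl
    rank-faceAt 3F = refl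
    rank-faceAt 4F = refl
    rank-faceAt 5F = refl

    V≤E-at : ∀ δ → V (vertexOf δ x) ≤ E x y
    V≤E-at false = V≤E (inj₁ ≋-refl)
    V≤E-at true  = V≤E (inj₂ ≋-refl)

    H≤T-at : ∀ η → H j l ≤ T (facetOf η j l)
    H≤T-at false = H≤T (inj₁ ≋-refl)
    H≤T-at true  = H≤T (inj₂ ≋-refl)

    faceAt-mono : ∀ i i′ → i Fin.< i′ → faceAt i ≤ faceAt i′
    faceAt-mono zero _ _ = bot≤
    faceAt-mono _ 5F _ = ≤top
    faceAt-mono 1F 2F _ = V≤E-at δ
    faceAt-mono 1F 3F _ = V≤H
    faceAt-mono 1F 4F _ = V≤T
    faceAt-mono 2F 3F _ = E≤H ≋-refl
    faceAt-mono 2F 4F _ = E≤T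
    faceAt-mono 3F 4F _ = H≤T-at η
    faceAt-mono (suc i) 1F (ℕ.s≤s ())
    faceAt-mono (suc (suc i)) 2F (ℕ.s≤s (ℕ.s≤s ()))
    faceAt-mono (suc (suc (suc i))) 3F (ℕ.s≤s (ℕ.s≤s (ℕ.s≤s ())))
    faceAt-mono (suc (suc (suc (suc i)))) 4F (ℕ.s≤s (ℕ.s≤s (ℕ.s≤s (ℕ.s≤s ()))))

    toFlag : Flag polytope
    toFlag = record
      { face   = faceAt
      ; strict = λ {i} {i′} i<i′ → strictly (faceAt-mono i i′ i<i′) λ e →
          Fin.<⇒≢ i<i′ (≡.trans (≡.sym (rank-faceAt i)) (≡.trans e (rank-faceAt i′)))
      }

  open FlagIndex public using (toFlag)

  ≈ᶠ-intro : ∀ {Φ Ψ : Flag polytope} →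
             let F = face Φ ; G = face Ψ in
             F zero ≈ G zero → F 1F ≈ G 1F →
             F 2F ≈ G 2F →
             F 3F ≈ G 3F →
             F 4F ≈ G 4F →
             F 5F ≈ G 5F → Φ ≈ᶠ Ψ
  ≈ᶠ-intro b v e h t u zero = b
  ≈ᶠ-intro b v e h t u 1F = v
  ≈ᶠ-intro b v e h t u 2F = e
  ≈ᶠ-intro b v e h t u 3F = h
  ≈ᶠ-intro b v e h t u 4F = t
  ≈ᶠ-intro b v e h t u 5F = u

  vertexOf-cong : ∀ δ {x x′} → x ≋ x′ mod m → vertexOf δ x ≋ vertexOf δ x′ mod m
  vertexOf-cong false e = e
  vertexOf-cong true  e = +-congʳ (- 1ℤ) e

  facetOf-cong : ∀ η {j j′ l l′} → j ≋ j′ mod r → l ≋ l′ mod m → facetOf η j l ≋ facetOf η j′ l′ mod r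
  facetOf-cong false d e = d
  facetOf-cong true  d e = successor-cong d e

  toFlag-cong : ∀ δ η {x x′ y y′ j j′} → x ≋ x′ mod m → y ≋ y′ mod m → j ≋ j′ mod r →
                toFlag ⟪ δ , x , y , j , η ⟫ ≈ᶠ toFlag ⟪ δ , x′ , y′ , j′ , η ⟫
  toFlag-cong δ η dx dy dj = ≈ᶠ-intro {toFlag ⟪ δ , _ , _ , _ , η ⟫} {toFlag ⟪ δ , _ , _ , _ , η ⟫} bot
      (V (vertexOf-cong δ dx)) (E dx dy) (H dj dl) (T (facetOf-cong η dj dl)) top
    where dl = label-cong dx dy (mod-r⇒mod-m dj)

  adj : Fin 4 → FlagIndex → FlagIndex
  adj zero ⟪ δ , x , y , j , η ⟫ = ⟪ not δ , x , y , j , η ⟫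
  adj 1F ⟪ false , x , y , j , η ⟫ = ⟪ true , x + 1ℤ , y - j , j , η ⟫
  adj 1F ⟪ true , x , y , j , η ⟫ = ⟪ false , x - 1ℤ , y + j , j , η ⟫
  -- The first coordinate of the new 2-face is `j - 1` modulo `m`, so its label is computed from
  -- `j - 1ℤ` beforehand.
  adj 2F ⟪ δ , x , y , j , false ⟫ = ⟪ δ , x , y , predecessor j (y + x * (j - 1ℤ)) , true ⟫
  adj 2F ⟪ δ , x , y , j , true ⟫ = ⟪ δ , x , y , successor j (y + x * j) , false ⟫
  adj 3F ⟪ δ , x , y , j , η ⟫ = ⟪ δ , x , y , j , not η ⟫

  private
    label₊ : ∀ x y j → y + x * j ≡ y - j + (x + 1ℤ) * j
    label₊ = solve-∀
    label₋ : ∀ x y j → y + x * j ≡ y + j + (x - 1ℤ) * j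
    label₋ = solve-∀
    +1-1 : ∀ x → x ≡ x + 1ℤ - 1ℤ
    +1-1 = solve-∀
    -1+1 : ∀ x → x - 1ℤ + 1ℤ ≡ x
    -1+1 = solve-∀

  adj-adjacent : ∀ k p → Adjacent polytope k (toFlag p) (toFlag (adj k p))
  adj-adjacent zero ⟪ δ , x , y , j , η ⟫ =
    (λ { zero _ → bot ; 1F ≢ → contradiction refl ≢ ; 2F _ → ≈-refl
       ; 3F _ → ≈-refl ; 4F _ → ≈-refl
       ; 5F _ → top }) , differ δ
    where
    differ : ∀ δ → ¬ V (vertexOf δ x) ≈ V (vertexOf (not δ) x)
    differ false e = V-1≉V (≈-sym e)
    differ true  e = V-1≉V e
  adj-adjacent 1F ⟪ false , x , y , j , η ⟫ =
    (λ { zero _ → bot ; 1F _ → V (≡⇒≋ (+1-1 x)) ; 2F ≢ → contradiction refl ≢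
       ; 3F _ → H ≋-refl l≋
       ; 4F _ → T (facetOf-cong η (≋-refl {x = j}) l≋)
       ; 5F _ → top }) , λ e → E+1≉E (≈-sym e)
    where
    l≋ : y + x * j ≋ y - j + (x + 1ℤ) * j mod m
    l≋ = ≡⇒≋ (label₊ x y j)
  adj-adjacent 1F ⟪ true , x , y , j , η ⟫ =
    (λ { zero _ → bot ; 1F _ → ≈-refl ; 2F ≢ → contradiction refl ≢
       ; 3F _ → H ≋-refl l≋
       ; 4F _ → T (facetOf-cong η (≋-refl {x = j}) l≋)
       ; 5F _ → top }) ,
    λ e → E+1≉E {x - 1ℤ} (≈-trans (E (≡⇒≋ (-1+1 x)) ≋-refl) e)
    where
    l≋ : y + x * j ≋ y + j + (x - 1ℤ) * j mod m
    l≋ = ≡⇒≋ (label₋ x y j)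
  adj-adjacent 2F ⟪ δ , x , y , j , false ⟫ =
    (λ { zero _ → bot ; 1F _ → ≈-refl ; 2F _ → ≈-refl
       ; 3F ≢ → contradiction refl ≢
       ; 4F _ → T (≋-trans (≡⇒≋ (≡.sym (successor-predecessor j l′)))
                                         (successor-cong (≋-refl {x = predecessor j l′})
                                             (≋-sym (label-predecessor x y j l′))))
       ; 5F _ → top }) , λ e → H-predecessor≉H {j} {l′} (≈-sym e)
    where
    l′ : ℤ
    l′ = y + x * (j - 1ℤ)
  adj-adjacent 2F ⟪ δ , x , y , j , true ⟫ =
    (λ { zero _ → bot ; 1F _ → ≈-refl ; 2F _ → ≈-refl
       ; 3F ≢ → contradiction refl ≢
       ; 4F _ → ≈-refl
       ; 5F _ → top }) , λ { (H e _) → successor≢ j (y + x * j) (≋-sym e) }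
  adj-adjacent 3F ⟪ δ , x , y , j , η ⟫ =
    (λ { zero _ → bot ; 1F _ → ≈-refl ; 2F _ → ≈-refl
       ; 3F _ → ≈-refl ; 4F ≢ → contradiction refl ≢
       ; 5F _ → top }) , differ η
    where
    differ : ∀ η → ¬ T (facetOf η j (y + x * j)) ≈ T (facetOf (not η) j (y + x * j))
    differ false e = T-successor≉T {j} {y + x * j} (≈-sym e)
    differ true  e = T-successor≉T {j} {y + x * j} e

  adj-unique : ∀ k p {Φ Ψ : Flag polytope} → toFlag p ≈ᶠ Φ → Adjacent polytope k Φ Ψ → toFlag (adj k p) ≈ᶠ Ψ
  adj-unique k p {Φ} {Ψ} e a = adjacent-unique polytope {k} {Φ} {toFlag (adj k p)} {Ψ}
    (adjacent-resp polytope {k} {toFlag p} {Φ} {toFlag (adj k p)} {toFlag (adj k p)} e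
        (≈ᶠ-refl {toFlag (adj k p)}) (adj-adjacent k p)) a

  private
    rank₀ : ∀ {F} → rank F ≡ zero → F ≡ bot
    rank₀ {bot} _ = refl

    rank₁ : ∀ {F} → rank F ≡ suc zero → ∃[ i ] F ≡ V i
    rank₁ {V i} _ = i , refl

    rank₂ : ∀ {F} → rank F ≡ suc 1F → ∃[ x ] ∃[ y ] F ≡ E x y
    rank₂ {E x y} _ = x , y , refl

    rank₃ : ∀ {F} → rank F ≡ suc 2F → ∃[ j ] ∃[ l ] F ≡ H j l
    rank₃ {H j l} _ = j , l , refl

    rank₄ : ∀ {F} → rank F ≡ suc 3F → ∃[ t ] F ≡ T t
    rank₄ {T t} _ = t , refl

    rank₅ : ∀ {F} → rank F ≡ suc 4F → F ≡ top
    rank₅ {top} _ = refl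

  flag-index : ∀ (Φ : Flag polytope) → ∃[ p ] toFlag p ≈ᶠ Φ
  flag-index Φ
    with rank₁ (rank-face polytope Φ 1F) | rank₂ (rank-face polytope Φ 2F)
       | rank₃ (rank-face polytope Φ 3F) | rank₄ (rank-face polytope Φ 4F)
  ... | i , V-eq | x , y , E-eq | j , l , H-eq | t , T-eq
    with subst₂ _≤_ V-eq E-eq (proj₁ (Flag.strict Φ {suc zero} {suc 1F} (ℕ.s≤s (ℕ.s≤s ℕ.z≤n))))
       | subst₂ _≤_ E-eq H-eq (proj₁ (Flag.strict Φ {suc 1F} {suc 2F} (ℕ.s≤s (ℕ.s≤s (ℕ.s≤s ℕ.z≤n)))))
       | subst₂ _≤_ H-eq T-eq (proj₁ (Flag.strict Φ {suc 2F} {suc 3F} (ℕ.s≤s (ℕ.s≤s (ℕ.s≤s (ℕ.s≤s ℕ.z≤n))))))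
  ... | V≤E v | E≤H e | H≤T t∈ = ⟪ proj₁ δ , x , y , j , proj₁ η′ ⟫ , ≈ᶠ-intro
      {toFlag ⟪ proj₁ δ , x , y , j , proj₁ η′ ⟫} {Φ}
      (≈-reflexive (≡.sym (rank₀ (rank-face polytope Φ zero))))
      (≈-trans (V (proj₂ δ)) (≈-reflexive (≡.sym V-eq)))
      (≈-reflexive (≡.sym E-eq))
      (≈-trans (H ≋-refl (≋-sym e)) (≈-reflexive (≡.sym H-eq)))
      (≈-trans (T (proj₂ η′)) (≈-reflexive (≡.sym T-eq)))
      (≈-reflexive (≡.sym (rank₅ (rank-face polytope Φ 5F))))
    where
    ≈-reflexive : ∀ {F G} → F ≡ G → F ≈ G
    ≈-reflexive refl = ≈-refl

    δ : ∃[ δ ] vertexOf δ x ≋ i mod m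
    δ = [ (λ f → false , ≋-sym f) , (λ f → true , ≋-sym f) ]′ v

    η′ : ∃[ η ] facetOf η j (y + x * j) ≋ t mod r
    η′ = [ (λ f → false , ≋-sym f) , (λ f → true , ≋-trans (successor-cong (≋-refl {x = j}) (≋-sym e))
        (≋-sym f)) ]′ t∈

  base : FlagIndex
  base = ⟪ false , 0ℤ , 0ℤ , 0ℤ , false ⟫

  -- Connectedness of the flag graph in the form of an induction principle, so that no paths have to
  -- be stored.
  module Reach (P : FlagIndex → Set)
    (resp : ∀ {p q} → toFlag p ≈ᶠ toFlag q → P p → P q)
    (step : ∀ k p → P p → P (adj k p)) where

    P₀ : ℤ → ℤ → ℤ → Set
    P₀ x y j = P ⟪ false , x , y , j , false ⟫

    P₀-resp : ∀ {x x′ y y′ j j′} → x ≋ x′ mod m → y ≋ y′ mod m → j ≋ j′ mod r → P₀ x y j → P₀ x′ y′ j′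
    P₀-resp d e f = resp (toFlag-cong false false d e f)

    facet-walk : ∀ x y {j} → P₀ x y j → ∀ j′ → P₀ x y j′
    facet-walk x y {j} h j′ = P₀-resp ≋-refl ≋-refl
      (≋-trans (≡⇒≋ (cong (spiral x y) (identity (spiral⁻¹ x y j) (spiral⁻¹ x y j′))))
          (spiral-spiral⁻¹ x y j′))
      -- The induction runs over positions on the spiral, counted from the starting facet: a step
      -- raises the position by one, but changes `j` by a correction as well.
      (ℤ-induction (λ i → P₀ x y (spiral x y (n + i))) start up down (spiral⁻¹ x y j′ - n))
      where
      n : ℤ
      n = spiral⁻¹ x y j

      identity : ∀ n n′ → n + (n′ - n) ≡ n′
      identity = solve-∀
      assoc⁺ : ∀ n i → n + (i + 1ℤ) ≡ n + i + 1ℤ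
      assoc⁺ = solve-∀

      start : P₀ x y (spiral x y (n + 0ℤ))
      start = P₀-resp ≋-refl ≋-refl
        (≋-sym (≋-trans (≡⇒≋ (cong (spiral x y) (ℤ.+-identityʳ n))) (spiral-spiral⁻¹ x y j))) h

      spiral-next : ∀ i → spiral x y (n + (i + 1ℤ)) ≋ successor (spiral x y (n + i))
          (y + x * spiral x y (n + i)) mod r
      spiral-next i = ≋-trans (≡⇒≋ (≡.trans (cong (spiral x y) (assoc⁺ n i)) (spiral-suc x y (n + i))))
        (successor-cong (≋-refl {x = spiral x y (n + i)}) (≋-sym (label-spiral x y (n + i))))

      up : ∀ i → P₀ x y (spiral x y (n + i)) → P₀ x y (spiral x y (n + (i + 1ℤ)))
      up i h = P₀-resp ≋-refl ≋-refl (≋-sym (spiral-next i)) (step 2F _ (step 3F _ h))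

      down : ∀ i → P₀ x y (spiral x y (n + (i + 1ℤ))) → P₀ x y (spiral x y (n + i))
      down i h = P₀-resp ≋-refl ≋-refl previous (step 3F _ (step 2F _ h))
        where
        a = spiral x y (n + i)
        b = spiral x y (n + (i + 1ℤ))
        previous : predecessor b (y + x * (b - 1ℤ)) ≋ a mod r
        previous = ≋-trans (predecessor-cong (spiral-next i) (+-congˡ y (*-congˡ x
          (≋-trans (+-congʳ (- 1ℤ) (≋-trans (mod-r⇒mod-m (spiral-next i)) (successor-mod-m a (y + x * a))))
              (≡⇒≋ (≡.sym (+1-1 a)))))))
          (≡⇒≋ (predecessor-successor a (y + x * a)))

    -- A change of edge followed by a change of vertex moves one edge along the boundary of a fixed
    -- 2-face; `y` drops by `j` to keep the label `y + x * j`.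
    edge-walk : ∀ {x y j} → P₀ x y j → ∀ n → P₀ (x + n) (y - n * j) j
    edge-walk {x} {y} {j} h = ℤ-induction (λ n → P₀ (x + n) (y - n * j) j)
      (P₀-resp (≡⇒≋ (≡.sym (ℤ.+-identityʳ x))) (≡⇒≋ (identity₁ y j)) ≋-refl h)
      (λ n h → P₀-resp (≡⇒≋ (identity₂ x n)) (≡⇒≋ (identity₃ y n j)) ≋-refl (step zero _ (step 1F _ h)))
      (λ n h → P₀-resp (≡⇒≋ (identity₄ x n)) (≡⇒≋ (identity₅ y n j)) ≋-refl (step 1F _ (step zero _ h)))
      where
      identity₁ : ∀ y j → y ≡ y - 0ℤ * j
      identity₁ = solve-∀
      identity₂ : ∀ x n → x + n + 1ℤ ≡ x + (n + 1ℤ)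
      identity₂ = solve-∀
      identity₃ : ∀ y n j → y - n * j - j ≡ y - (n + 1ℤ) * j
      identity₃ = solve-∀
      identity₄ : ∀ x n → x + (n + 1ℤ) - 1ℤ ≡ x + n
      identity₄ = solve-∀
      identity₅ : ∀ y n j → y - (n + 1ℤ) * j + j ≡ y - n * j
      identity₅ = solve-∀

    all-flips : (∀ x y j → P₀ x y j) → ∀ p → P p
    all-flips h ⟪ false , x , y , j , false ⟫ = h x y j
    all-flips h ⟪ false , x , y , j , true ⟫ = step 3F _ (h x y j)
    all-flips h ⟪ true  , x , y , j , false ⟫ = step zero _ (h x y j)
    all-flips h ⟪ true , x , y , j , true ⟫ = step zero _ (step 3F _ (h x y j))

    -- Go along the facets on E 0 0 to H j 0, along H j 0 to E 1 (- j), along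
    -- the facets on that edge to any H j (y + j), and along it to E x y.
    reach : P base → ∀ p → P p
    reach h = all-flips λ x y j → P₀-resp (≡⇒≋ (identity₁ x)) (≡⇒≋ (identity₂ x y j)) ≋-refl
      (edge-walk (facet-walk 1ℤ _ (P₀-resp ≋-refl (≡⇒≋ (identity₃ (y + (x - 1ℤ) * j))) ≋-refl
        (edge-walk (facet-walk 0ℤ 0ℤ h (- (y + (x - 1ℤ) * j))) 1ℤ)) j) (x - 1ℤ))
      where
      identity₁ : ∀ x → 1ℤ + (x - 1ℤ) ≡ x
      identity₁ = solve-∀
      identity₂ : ∀ x y j → y + (x - 1ℤ) * j - (x - 1ℤ) * j ≡ y
      identity₂ = solve-∀
      identity₃ : ∀ y → 0ℤ - 1ℤ * - y ≡ y
      identity₃ = solve-∀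

  -- Uniqueness of adjacent flags spreads the agreement from `base`. The target is arbitrary because
  -- this serves both for automorphisms of the polytope and for their descent to a covered one.
  adjacency-rigid : ∀ {Q : Polytope 4} (f g : FlagIndex → Flag Q) →
    let open Setoid (flags Q) using () renaming (_≈_ to _≈ᵠ_) in
    (∀ {p q} → toFlag p ≈ᶠ toFlag q → f p ≈ᵠ f q) → (∀ {p q} → toFlag p ≈ᶠ toFlag q → g p ≈ᵠ g q) →
    (∀ k p → Adjacent Q k (f p) (f (adj k p))) → (∀ k p → Adjacent Q k (g p) (g (adj k p))) →
    f base ≈ᵠ g base → ∀ p → f p ≈ᵠ g p
  adjacency-rigid {Q} f g f-resp g-resp f-adj g-adj =
    Reach.reach (λ p → f p ≈ᵠ g p)
      (λ {p} {q} e h → transᵠ {f q} {f p} {g q} (symᵠ {f p} {f q} (f-resp e))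
          (transᵠ {f p} {g p} {g q} h (g-resp e)))
      (λ k p h → adjacent-unique Q {k} {f p} {f (adj k p)} {g (adj k p)} (f-adj k p)
        (adjacent-resp Q {k} {g p} {f p} {g (adj k p)} {g (adj k p)} (symᵠ {f p} {g p} h)
            (reflᵠ {g (adj k p)}) (g-adj k p)))
    where open Setoid (flags Q) using () renaming (_≈_ to _≈ᵠ_; refl to reflᵠ; sym to symᵠ; trans to transᵠ)

  face-on-flag : (P : Face → Set) → (∀ {F G} → F ≈ G → P F → P G) →
                 (∀ p i → P (FlagIndex.faceAt p i)) → ∀ F → P F
  face-on-flag P resp h bot     = h base zero
  face-on-flag P resp h (V i) = h ⟪ false , i , 0ℤ , 0ℤ , false ⟫ 1F
  face-on-flag P resp h (E x y) = h ⟪ false , x , y , 0ℤ , false ⟫ 2F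
  face-on-flag P resp h (H j l) = resp (H ≋-refl (≡⇒≋ (identity l j))) (h ⟪ false , 0ℤ , l , j , false ⟫ 3F)
    where
    identity : ∀ l j → l + 0ℤ * j ≡ l
    identity = solve-∀
  face-on-flag P resp h (T t) = h ⟪ false , 0ℤ , 0ℤ , t , false ⟫ 4F
  face-on-flag P resp h top = h base 5F

-- Automorphisms

module _ {m n} (P : Polytope m) (Q : Polytope n) where
  private
    module P = Polytope P
    module Q = Polytope Q

  mutually-inverse⇒isomorphism : (f : P.Face → Q.Face) (g : Q.Face → P.Face) →
    (∀ {F G} → F P.≤ G → f F Q.≤ f G) → (∀ {F G} → F Q.≤ G → g F P.≤ g G) →
    (∀ F → g (f F) P.≈ F) → (∀ F → f (g F) Q.≈ F) → Isomorphism P Q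
  mutually-inverse⇒isomorphism f g f-mono g-mono gf fg = record
    { to                 = f
    ; isOrderIsomorphism = record
      { isOrderMonomorphism = record
        { isOrderHomomorphism = record { cong = f-cong ; mono = f-mono }
        ; injective           = λ {F} {G} e → P.Eq.trans (P.Eq.sym (gf F)) (P.Eq.trans (g-cong e) (gf G))
        ; cancel              = λ {F} {G} e → Poset.≤-respˡ-≈ P.faces (gf F)
            (Poset.≤-respʳ-≈ P.faces (gf G) (g-mono e))
        }
      ; surjective = λ F → g F , λ e → Q.Eq.trans (f-cong e) (fg F)
      }
    }
    where
    f-cong : ∀ {F G} → F P.≈ G → f F Q.≈ f G
    f-cong e = Poset.antisym Q.faces (f-mono (Poset.reflexive P.faces e))
        (f-mono (Poset.reflexive P.faces (P.Eq.sym e)))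

    g-cong : ∀ {F G} → F Q.≈ G → g F P.≈ g G
    g-cong e = Poset.antisym P.faces (g-mono (Poset.reflexive Q.faces e))
        (g-mono (Poset.reflexive Q.faces (Q.Eq.sym e)))

module Automorphisms (m w κ : ℤ) (1≢0 : ¬ 1ℤ ≋ 0ℤ mod m) where
  open Modulus m w κ
  open Order m w κ
  open Sections m w κ 1≢0
  open Construction m w κ 1≢0
  open FlagGraph m w κ 1≢0

  -- Monotonicity has to be checked on standard representatives of the incidences only; congruence
  -- of `f` supplies the rest.
  record PreservesIncidence (f : Face → Face) : Set where
    no-eta-equality
    field
      f-cong : ∀ {F G} → F ≈ G → f F ≈ f G
      f-bot  : ∀ {F} → f bot ≤ F
      f-top  : ∀ {F} → F ≤ f top
      v-e    : ∀ x y → f (V x) ≤ f (E x y)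
      v-e′   : ∀ x y → f (V (x - 1ℤ)) ≤ f (E x y)
      e-h    : ∀ x y j → f (E x y) ≤ f (H j (y + x * j))
      h-t    : ∀ j l → f (H j l) ≤ f (T j)
      h-t′   : ∀ j l → f (H j l) ≤ f (T (successor j l))
      v-h    : ∀ {i j l} → f (V i) ≤ f (H j l)
      v-t    : ∀ {i t} → f (V i) ≤ f (T t)
      e-t    : ∀ {x y t} → f (E x y) ≤ f (T t)

    f-mono : ∀ {F G} → F ≤ G → f F ≤ f G
    f-mono bot≤      = f-bot
    f-mono ≤top      = f-top
    f-mono (V≤V e)   = ≤-reflexive (f-cong (V e))
    f-mono (E≤E d e) = ≤-reflexive (f-cong (E d e))
    f-mono (H≤H d e) = ≤-reflexive (f-cong (H d e))
    f-mono (T≤T e)   = ≤-reflexive (f-cong (T e))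
    f-mono V≤H       = v-h
    f-mono V≤T       = v-t
    f-mono E≤T       = e-t
    f-mono {G = E x y} (V≤E (inj₁ e)) = ≤-trans (≤-reflexive (f-cong (V e))) (v-e x y)
    f-mono {G = E x y} (V≤E (inj₂ e)) = ≤-trans (≤-reflexive (f-cong (V e))) (v-e′ x y)
    f-mono (E≤H {x} {y} {j} e) = ≤-trans (e-h x y j) (≤-reflexive (f-cong (H ≋-refl (≋-sym e))))
    f-mono (H≤T {j} {l} (inj₁ e)) = ≤-trans (h-t j l) (≤-reflexive (f-cong (T (≋-sym e))))
    f-mono (H≤T {j} {l} (inj₂ e)) = ≤-trans (h-t′ j l) (≤-reflexive (f-cong (T (≋-sym e))))

  Automorphism : Set
  Automorphism = Isomorphism polytope polytope

  automorphism : ∀ {f g} → PreservesIncidence f → PreservesIncidence g →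
                 (∀ F → g (f F) ≈ F) → (∀ F → f (g F) ≈ F) → Automorphism
  automorphism {f} {g} f-preserves g-preserves = mutually-inverse⇒isomorphism polytope polytope f g
    (PreservesIncidence.f-mono f-preserves) (PreservesIncidence.f-mono g-preserves)

  private
    +-1 : ∀ x n → x - 1ℤ + n ≡ x + n - 1ℤ
    +-1 = solve-∀

  -- The powers of `σ₁`, `σ₃` and `σ₂ ^ʷ 2`; `τᶠ` below is `σ₁ · σ₂`. The spirals dictate the
  -- corrections: as `αᶠ n` takes `E x y` to `E (x + n) y`, it must take `T (spiral x y t)` to
  -- `T (spiral (x + n) y t)`, and these differ by `s * (n * (t * (t - 1ℤ)))`. For `ζᶠ n`, which
  -- adds `n` to `y`, the difference is `s * ((n + n) * t)`.
  αᶠ γᶠ ζᶠ : ℤ → Face → Face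
  αᶠ n bot     = bot
  αᶠ n (V i)   = V (i + n)
  αᶠ n (E x y) = E (x + n) y
  αᶠ n (H j l) = H (j + s * (n * (j * (j - 1ℤ)))) (l + n * j)
  αᶠ n (T t)   = T (t + s * (n * (t * (t - 1ℤ))))
  αᶠ n top     = top

  γᶠ n bot     = bot
  γᶠ n (V i)   = V i
  γᶠ n (E x y) = E x (y - n * x)
  γᶠ n (H j l) = H (j + n) l
  γᶠ n (T t)   = T (t + n)
  γᶠ n top     = top

  ζᶠ n bot     = bot
  ζᶠ n (V i)   = V i
  ζᶠ n (E x y) = E x (y + n)
  ζᶠ n (H j l) = H (j + s * ((n + n) * j)) (l + n)
  ζᶠ n (T t)   = T (t + s * ((n + n) * t))
  ζᶠ n top     = top

  τᶠ : Face → Face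
  τᶠ bot     = bot
  τᶠ (V i)   = V (- 1ℤ - i)
  τᶠ (E x y) = E (- x) (y - x)
  τᶠ (H j l) = H (- successor j l) l
  τᶠ (T t)   = T (- t)
  τᶠ top     = top

  α-preserves : ∀ n → PreservesIncidence (αᶠ n)
  α-preserves n = record
    { f-cong = λ { bot → bot ; (V e) → V (+-congʳ n e) ; (E d e) → E (+-congʳ n d) e
                 ; (H d e) → H (shift-cong d) (+-cong e (*-congˡ n (mod-r⇒mod-m d)))
                 ; (T e) → T (shift-cong e) ; top → top }
    ; f-bot = bot≤ ; f-top = ≤top ; v-h = V≤H ; v-t = V≤T ; e-t = E≤T
    ; v-e   = λ x y → V≤E (inj₁ ≋-refl)
    ; v-e′  = λ x y → V≤E (inj₂ (≡⇒≋ (+-1 x n)))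
    ; e-h   = λ x y j → E≤H (≋-trans (≡⇒≋ (identity x y j n))
        (label-cong {x + n} {x + n} {y} {y} ≋-refl ≋-refl (≋-sym (+s*≋ j _))))
    ; h-t   = λ j l → H≤T (inj₁ ≋-refl)
    ; h-t′  = λ j l → H≤T (inj₂ (≋-trans
        (+-congˡ (successor j l) (s*-cong (*-congˡ n
            (*-cong (successor-mod-m j l) (+-congʳ (- 1ℤ) (successor-mod-m j l))))))
        (≡⇒≋ (identity′ j l n s))))
    }
    where
    shift-cong : ∀ {j j′} → j ≋ j′ mod r → j + s * (n * (j * (j - 1ℤ))) ≋ j′ + s *
        (n * (j′ * (j′ - 1ℤ))) mod r
    shift-cong d = +-cong d (s*-cong (*-congˡ n (*-cong (mod-r⇒mod-m d) (+-congʳ (- 1ℤ) (mod-r⇒mod-m d)))))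

    identity : ∀ x y j n → y + x * j + n * j ≡ y + (x + n) * j
    identity = solve-∀
    identity′ : ∀ j l n s → j + 1ℤ + s * (l + l) + s * (n * ((j + 1ℤ) * (j + 1ℤ - 1ℤ))) ≡
                j + s * (n * (j * (j - 1ℤ))) + 1ℤ + s * (l + n * j + (l + n * j))
    identity′ = solve-∀

  γ-preserves : ∀ n → PreservesIncidence (γᶠ n)
  γ-preserves n = record
    { f-cong = λ { bot → bot ; (V e) → V e ; (E d e) → E d (+-cong e (neg-cong (*-congˡ n d)))
                 ; (H d e) → H (+-congʳ n d) e ; (T e) → T (+-congʳ n e) ; top → top }
    ; f-bot = bot≤ ; f-top = ≤top ; v-h = V≤H ; v-t = V≤T ; e-t = E≤T
    ; v-e   = λ x y → V≤E (inj₁ ≋-refl)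
    ; v-e′  = λ x y → V≤E (inj₂ ≋-refl)
    ; e-h   = λ x y j → E≤H (≡⇒≋ (identity x y j n))
    ; h-t   = λ j l → H≤T (inj₁ ≋-refl)
    ; h-t′  = λ j l → H≤T (inj₂ (≡⇒≋ (identity′ j l n s)))
    }
    where
    identity : ∀ x y j n → y + x * j ≡ y - n * x + x * (j + n)
    identity = solve-∀
    identity′ : ∀ j l n s → j + 1ℤ + s * (l + l) + n ≡ j + n + 1ℤ + s * (l + l)
    identity′ = solve-∀

  ζ-preserves : ∀ n → PreservesIncidence (ζᶠ n)
  ζ-preserves n = record
    { f-cong = λ { bot → bot ; (V e) → V e ; (E d e) → E d (+-congʳ n e)
                 ; (H d e) → H (shift-cong d) (+-congʳ n e) ; (T e) → T (shift-cong e) ; top → top }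
    ; f-bot = bot≤ ; f-top = ≤top ; v-h = V≤H ; v-t = V≤T ; e-t = E≤T
    ; v-e   = λ x y → V≤E (inj₁ ≋-refl)
    ; v-e′  = λ x y → V≤E (inj₂ ≋-refl)
    ; e-h   = λ x y j → E≤H (≋-trans (≡⇒≋ (identity x y j n))
        (label-cong {x} {x} {y + n} {y + n} ≋-refl ≋-refl (≋-sym (+s*≋ j _))))
    ; h-t   = λ j l → H≤T (inj₁ ≋-refl)
    ; h-t′  = λ j l → H≤T (inj₂ (≋-trans
        (+-congˡ (successor j l) (s*-cong (*-congˡ (n + n) (successor-mod-m j l))))
        (≡⇒≋ (identity′ j l n s))))
    }
    where
    shift-cong : ∀ {j j′} → j ≋ j′ mod r → j + s * ((n + n) * j) ≋ j′ + s * ((n + n) * j′) mod r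
    shift-cong d = +-cong d (s*-cong (*-congˡ (n + n) (mod-r⇒mod-m d)))

    identity : ∀ x y j n → y + x * j + n ≡ y + n + x * j
    identity = solve-∀
    identity′ : ∀ j l n s → j + 1ℤ + s * (l + l) + s * ((n + n) * (j + 1ℤ)) ≡
                j + s * ((n + n) * j) + 1ℤ + s * (l + n + (l + n))
    identity′ = solve-∀

  τ-preserves : PreservesIncidence τᶠ
  τ-preserves = record
    { f-cong = λ { bot → bot ; (V e) → V (+-congˡ (- 1ℤ) (neg-cong e)) ; (E d e) → E (neg-cong d)
        (+-cong e (neg-cong d))
                 ; (H d e) → H (neg-cong (successor-cong d e)) e ; (T e) → T (neg-cong e) ; top → top }
    ; f-bot = bot≤ ; f-top = ≤top ; v-h = V≤H ; v-t = V≤T ; e-t = E≤T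
    ; v-e   = λ x y → V≤E (inj₂ (≡⇒≋ (identity₁ x)))
    ; v-e′  = λ x y → V≤E (inj₁ (≡⇒≋ (identity₂ x)))
    ; e-h   = λ x y j → E≤H (≋-trans (≡⇒≋ (identity₃ x y j))
        (label-cong { - x} { - x} {y - x} {y - x} ≋-refl ≋-refl
            (neg-cong (≋-sym (successor-mod-m j (y + x * j))))))
    ; h-t   = λ j l → H≤T (inj₂ (≡⇒≋ (identity₄ j l s)))
    ; h-t′  = λ j l → H≤T (inj₁ ≋-refl)
    }
    where
    identity₁ : ∀ x → - 1ℤ - x ≡ - x - 1ℤ
    identity₁ = solve-∀
    identity₂ : ∀ x → - 1ℤ - (x - 1ℤ) ≡ - x
    identity₂ = solve-∀
    identity₃ : ∀ x y j → y + x * j ≡ y - x + - x * - (j + 1ℤ)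
    identity₃ = solve-∀
    identity₄ : ∀ j l s → - j ≡ - (j + 1ℤ + s * (l + l)) + 1ℤ + s * (l + l)
    identity₄ = solve-∀

  αᶠ-+ : ∀ a b F → αᶠ b (αᶠ a F) ≈ αᶠ (a + b) F
  αᶠ-+ a b = λ
    { bot → bot ; (V i) → V (≡⇒≋ (ℤ.+-assoc i a b)) ; (E x y) → E (≡⇒≋ (ℤ.+-assoc x a b)) ≋-refl
    ; (H j l) → H (facet j) (≋-trans (+-congˡ (l + a * j) (*-congˡ b (+s*≋ j _))) (≡⇒≋ (identity l j a b)))
    ; (T t) → T (facet t) ; top → top }
    where
    identity : ∀ l j a b → l + a * j + b * j ≡ l + (a + b) * j
    identity = solve-∀
    identity′ : ∀ j a b s u → j + s * (a * u) + s * (b * u) ≡ j + s * ((a + b) * u)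
    identity′ = solve-∀

    facet : ∀ j → let j′ = j + s * (a * (j * (j - 1ℤ))) in
            j′ + s * (b * (j′ * (j′ - 1ℤ))) ≋ j + s * ((a + b) * (j * (j - 1ℤ))) mod r
    facet j = ≋-trans (+-congˡ (j + s * (a * (j * (j - 1ℤ))))
        (s*-cong (*-congˡ b (*-cong j′≋j (+-congʳ (- 1ℤ) j′≋j)))))
      (≡⇒≋ (identity′ j a b s (j * (j - 1ℤ))))
      where
      j′≋j : j + s * (a * (j * (j - 1ℤ))) ≋ j mod m
      j′≋j = +s*≋ j _

  γᶠ-+ : ∀ a b F → γᶠ b (γᶠ a F) ≈ γᶠ (a + b) F
  γᶠ-+ a b = λ
    { bot → bot ; (V i) → ≈-refl ; (E x y) → E ≋-refl (≡⇒≋ (identity x y a b))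
    ; (H j l) → H (≡⇒≋ (ℤ.+-assoc j a b)) ≋-refl ; (T t) → T (≡⇒≋ (ℤ.+-assoc t a b)) ; top → top }
    where
    identity : ∀ x y a b → y - a * x - b * x ≡ y - (a + b) * x
    identity = solve-∀

  ζᶠ-+ : ∀ a b F → ζᶠ b (ζᶠ a F) ≈ ζᶠ (a + b) F
  ζᶠ-+ a b = λ
    { bot → bot ; (V i) → ≈-refl ; (E x y) → E ≋-refl (≡⇒≋ (ℤ.+-assoc y a b))
    ; (H j l) → H (facet j) (≡⇒≋ (ℤ.+-assoc l a b)) ; (T t) → T (facet t) ; top → top }
    where
    identity : ∀ j a b s → j + s * ((a + a) * j) + s * ((b + b) * j) ≡ j + s * ((a + b + (a + b)) * j)
    identity = solve-∀

    facet : ∀ j → let j′ = j + s * ((a + a) * j) in j′ + s * ((b + b) * j′) ≋ j + s *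
        ((a + b + (a + b)) * j) mod r
    facet j = ≋-trans (+-congˡ (j + s * ((a + a) * j)) (s*-cong (*-congˡ (b + b) (+s*≋ j _))))
        (≡⇒≋ (identity j a b s))

  αᶠ-≋ : ∀ {a b} → a ≋ b mod m → ∀ F → αᶠ a F ≈ αᶠ b F
  αᶠ-≋ e = λ
    { bot → bot ; (V i) → V (+-congˡ i e) ; (E x y) → E (+-congˡ x e) ≋-refl
    ; (H j l) → H (+-congˡ j (s*-cong (*-cong e ≋-refl))) (+-congˡ l (*-cong e (≋-refl {x = j})))
    ; (T t) → T (+-congˡ t (s*-cong (*-cong e ≋-refl))) ; top → top }

  γᶠ-≋ : ∀ {a b} → a ≋ b mod r → ∀ F → γᶠ a F ≈ γᶠ b F
  γᶠ-≋ e = λ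
    { bot → bot ; (V i) → ≈-refl ; (E x y) → E ≋-refl
        (+-congˡ y (neg-cong (*-cong (mod-r⇒mod-m e) (≋-refl {x = x}))))
    ; (H j l) → H (+-congˡ j e) ≋-refl ; (T t) → T (+-congˡ t e) ; top → top }

  ζᶠ-≋ : ∀ {a b} → a ≋ b mod m → ∀ F → ζᶠ a F ≈ ζᶠ b F
  ζᶠ-≋ e = λ
    { bot → bot ; (V i) → ≈-refl ; (E x y) → E ≋-refl (+-congˡ y e)
    ; (H j l) → H (+-congˡ j (s*-cong (*-cong (+-cong e e) (≋-refl {x = j})))) (+-congˡ l e)
    ; (T t) → T (+-congˡ t (s*-cong (*-cong (+-cong e e) (≋-refl {x = t})))) ; top → top }

  private
    +s*0 : ∀ j {u} → u ≡ 0ℤ → j + s * u ≡ j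
    +s*0 j refl = ≡.trans (cong (λ a → j + a) (ℤ.*-zeroʳ s)) (ℤ.+-identityʳ j)

  αᶠ-0 : ∀ F → αᶠ 0ℤ F ≈ F
  αᶠ-0 = λ
    { bot → bot ; (V i) → V (≡⇒≋ (ℤ.+-identityʳ i)) ; (E x y) → E (≡⇒≋ (ℤ.+-identityʳ x)) ≋-refl
    ; (H j l) → H (≡⇒≋ (+s*0 j refl)) (≡⇒≋ (ℤ.+-identityʳ l)) ; (T t) → T (≡⇒≋ (+s*0 t refl)) ; top → top }

  γᶠ-0 : ∀ F → γᶠ 0ℤ F ≈ F
  γᶠ-0 = λ
    { bot → bot ; (V i) → ≈-refl ; (E x y) → E ≋-refl (≡⇒≋ (ℤ.+-identityʳ y))
    ; (H j l) → H (≡⇒≋ (ℤ.+-identityʳ j)) ≋-refl ; (T t) → T (≡⇒≋ (ℤ.+-identityʳ t)) ; top → top }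

  ζᶠ-0 : ∀ F → ζᶠ 0ℤ F ≈ F
  ζᶠ-0 = λ
    { bot → bot ; (V i) → ≈-refl ; (E x y) → E ≋-refl (≡⇒≋ (ℤ.+-identityʳ y))
    ; (H j l) → H (≡⇒≋ (+s*0 j refl)) (≡⇒≋ (ℤ.+-identityʳ l)) ; (T t) → T (≡⇒≋ (+s*0 t refl)) ; top → top }

  τᶠ-τᶠ : ∀ F → τᶠ (τᶠ F) ≈ F
  τᶠ-τᶠ = λ
    { bot → bot ; (V i) → V (≡⇒≋ (identity₁ i)) ; (E x y) → E (≡⇒≋ (ℤ.neg-involutive x)) (≡⇒≋ (identity₂ x y))
    ; (H j l) → H (≡⇒≋ (identity₃ j l s)) ≋-refl ; (T t) → T (≡⇒≋ (ℤ.neg-involutive t)) ; top → top }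
    where
    identity₁ : ∀ i → - 1ℤ - (- 1ℤ - i) ≡ i
    identity₁ = solve-∀
    identity₂ : ∀ x y → y - x - - x ≡ y
    identity₂ = solve-∀
    identity₃ : ∀ j l s → - (- (j + 1ℤ + s * (l + l)) + 1ℤ + s * (l + l)) ≡ j
    identity₃ = solve-∀

  private
    one-parameter : (f : ℤ → Face → Face) → (∀ n → PreservesIncidence (f n)) →
                    (∀ a b F → f b (f a F) ≈ f (a + b) F) → (∀ F → f 0ℤ F ≈ F) → ℤ → Automorphism
    one-parameter f f-preserves f-+ f-0 n = automorphism (f-preserves n) (f-preserves (- n))
      (λ F → ≈-trans (f-+ n (- n) F) (≈-trans (≈-reflexive (cong (λ a → f a F) (ℤ.+-inverseʳ n))) (f-0 F)))
      (λ F → ≈-trans (f-+ (- n) n F) (≈-trans (≈-reflexive (cong (λ a → f a F) (ℤ.+-inverseˡ n))) (f-0 F)))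
      where
      ≈-reflexive : ∀ {F G} → F ≡ G → F ≈ G
      ≈-reflexive refl = ≈-refl

  α γ ζ : ℤ → Automorphism
  α = one-parameter αᶠ α-preserves αᶠ-+ αᶠ-0
  γ = one-parameter γᶠ γ-preserves γᶠ-+ γᶠ-0
  ζ = one-parameter ζᶠ ζ-preserves ζᶠ-+ ζᶠ-0

  τ : Automorphism
  τ = automorphism τ-preserves τ-preserves τᶠ-τᶠ τᶠ-τᶠ

  module Aut = Group (Aut polytope)
  open Aut public using (_∙_) renaming (_≈_ to _≈ᵃ_)

  Φ : Flag polytope
  Φ = toFlag base

  automorphism-rigid : ∀ {f g : Automorphism} → Φ ▹ f ≈ᶠ Φ ▹ g → f ≈ᵃ g
  automorphism-rigid {f} {g} e = face-on-flag (λ F → to f F ≈ to g F)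
    (λ {F} {G} F≈G h → ≈-trans (≈-sym (Isomorphism.cong f F≈G)) (≈-trans h (Isomorphism.cong g F≈G)))
    (adjacency-rigid {polytope} (λ p → toFlag p ▹ f) (λ p → toFlag p ▹ g)
      (λ h i → Isomorphism.cong f (h i)) (λ h i → Isomorphism.cong g (h i))
      (λ k p → ▹-adjacent polytope {k} {toFlag p} {toFlag (adj k p)} f (adj-adjacent k p))
      (λ k p → ▹-adjacent polytope {k} {toFlag p} {toFlag (adj k p)} g (adj-adjacent k p)) e)

module _ {n} (P : Polytope n) where
  open Polytope P
  private module Aut = Group (Aut P)
  open Setoid (flags P) using () renaming (_≈_ to _≈ᶠ_)

  sameOrbit-sym : ∀ {Φ Ψ : Flag P} → SameOrbit P Φ Ψ → SameOrbit P Ψ Φ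
  sameOrbit-sym {Φ} (f , e) = f Aut.⁻¹ , λ i →
    Eq.trans (Isomorphism.cong (f Aut.⁻¹) (Eq.sym (e i))) (Aut.inverseʳ f (face Φ i))

  sameOrbit-trans : ∀ {Φ Ψ Υ : Flag P} → SameOrbit P Φ Ψ → SameOrbit P Ψ Υ → SameOrbit P Φ Υ
  sameOrbit-trans (f , d) (g , e) = f Aut.∙ g , λ i → Eq.trans (Isomorphism.cong g (d i)) (e i)

  ≈⇒sameOrbit : ∀ {Φ Ψ : Flag P} → Φ ≈ᶠ Ψ → SameOrbit P Φ Ψ
  ≈⇒sameOrbit e = Aut.ε , e

-- The action of the presented group

module Orbits (m w κ : ℤ) (1≢0 : ¬ 1ℤ ≋ 0ℤ mod m) where
  open Modulus m w κ
  open Order m w κ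
  open Sections m w κ 1≢0
  open Construction m w κ 1≢0
  open FlagGraph m w κ 1≢0
  open Automorphisms m w κ 1≢0

  φ : Word (Fin 3) → Automorphism
  φ (gen zero) = α 1ℤ
  -- The inverse of `σ₁` followed by `σ₁ · σ₂`; composition is from left to right.
  φ (gen 1F) = α (- 1ℤ) ∙ τ
  φ (gen 2F) = γ 1ℤ
  φ 1ʷ = Aut.ε
  φ (u · v) = φ u ∙ φ v
  φ (u ⁻¹ʷ) = φ u Aut.⁻¹

  -- Not the usual meaning of the word: these are the automorphisms induced by words in the
  -- generators, and the ones that will descend to covered polytopes.
  Inner : Automorphism → Set
  Inner f = ∃[ u ] φ u ≈ᵃ f

  ∙-inner : ∀ {f g} → Inner f → Inner g → Inner (f ∙ g)
  ∙-inner {f} {g} (u , d) (v , e) = u · v , Aut.∙-cong {φ u} {f} {φ v} {g} d e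

  ⁻¹-inner : ∀ {f} → Inner f → Inner (f Aut.⁻¹)
  ⁻¹-inner {f} (u , e) = u ⁻¹ʷ , Aut.⁻¹-cong {φ u} {f} e

  ≈-inner : ∀ {f g} → f ≈ᵃ g → Inner f → Inner g
  ≈-inner {f} {g} e (u , d) = u , Aut.trans {φ u} {f} {g} d e

  private
    one-parameter-inner : (f : ℤ → Automorphism) → (∀ a b → f a ∙ f b ≈ᵃ f (a + b)) → f 0ℤ ≈ᵃ Aut.ε →
                          Inner (f 1ℤ) → ∀ n → Inner (f n)
    one-parameter-inner f f-+ f-0 inner = ℤ-induction (λ n → Inner (f n))
      (≈-inner {Aut.ε} {f 0ℤ} (Aut.sym {f 0ℤ} {Aut.ε} f-0) (1ʷ , Aut.refl {Aut.ε}))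
      (λ n h → ≈-inner {f n ∙ f 1ℤ} {f (n + 1ℤ)} (f-+ n 1ℤ) (∙-inner {f n} {f 1ℤ} h inner))
      (λ n h → ≈-inner {f (n + 1ℤ) ∙ f 1ℤ Aut.⁻¹} {f n} (cancel n)
          (∙-inner {f (n + 1ℤ)} {f 1ℤ Aut.⁻¹} h (⁻¹-inner {f 1ℤ} inner)))
      where
      cancel : ∀ n → f (n + 1ℤ) ∙ f 1ℤ Aut.⁻¹ ≈ᵃ f n
      cancel n F = ≈-trans (≈-sym (Isomorphism.cong (f 1ℤ Aut.⁻¹) (f-+ n 1ℤ F)))
          (Aut.inverseʳ (f 1ℤ) (to (f n) F))

  α-inner : ∀ n → Inner (α n)
  α-inner = one-parameter-inner α αᶠ-+ αᶠ-0 (gen zero , Aut.refl {α 1ℤ})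

  γ-inner : ∀ n → Inner (γ n)
  γ-inner = one-parameter-inner γ γᶠ-+ γᶠ-0 (gen 2F , Aut.refl {γ 1ℤ})

  φ-σ₁σ₂ : φ (σ₁ · σ₂) ≈ᵃ τ
  φ-σ₁σ₂ F = Isomorphism.cong τ {to (α (- 1ℤ)) (to (α 1ℤ) F)} {F} (≈-trans (αᶠ-+ 1ℤ (- 1ℤ) F) (αᶠ-0 F))

  τ-inner : Inner τ
  τ-inner = σ₁ · σ₂ , φ-σ₁σ₂

  base▹ : ∀ (f : Automorphism) p → let open FlagIndex p hiding (toFlag) in
          to f bot ≈ bot → to f (V 0ℤ) ≈ V (vertexOf δ x) → to f (E 0ℤ 0ℤ) ≈ E x y → to f (H 0ℤ 0ℤ) ≈ H j l →
          to f (T 0ℤ) ≈ T (facetOf η j l) → to f top ≈ top → Φ ▹ f ≈ᶠ toFlag p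
  base▹ f p = ≈ᶠ-intro {Φ ▹ f} {toFlag p}

  -- By this criterion, relations between automorphisms reduce to congruences for the six faces of
  -- the base flag.
  base-rigid : ∀ {f g : Automorphism} → to f bot ≈ to g bot → to f (V 0ℤ) ≈ to g (V 0ℤ) → to f (E 0ℤ 0ℤ) ≈
      to g (E 0ℤ 0ℤ) →
               to f (H 0ℤ 0ℤ) ≈ to g (H 0ℤ 0ℤ) → to f (T 0ℤ) ≈ to g (T 0ℤ) → to f top ≈ to g top → f ≈ᵃ g
  base-rigid {f} {g} b v e h t u = automorphism-rigid {f} {g} (≈ᶠ-intro {Φ ▹ f} {Φ ▹ g} b v e h t u)

  private
    +s*0 : ∀ j {u} → u ≡ 0ℤ → j + s * u ≡ j
    +s*0 j refl = ≡.trans (cong (λ a → j + a) (ℤ.*-zeroʳ s)) (ℤ.+-identityʳ j)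

  α-H₀ : ∀ n l → to (α n) (H 0ℤ l) ≈ H 0ℤ l
  α-H₀ n l = H (≡⇒≋ (+s*0 0ℤ (ℤ.*-zeroʳ n))) (≡⇒≋
      (≡.trans (cong (λ a → l + a) (ℤ.*-zeroʳ n)) (ℤ.+-identityʳ l)))

  α-T₀ : ∀ n → to (α n) (T 0ℤ) ≈ T 0ℤ
  α-T₀ n = T (≡⇒≋ (+s*0 0ℤ (ℤ.*-zeroʳ n)))

  ζ-H₀ : ∀ n l → to (ζ n) (H 0ℤ l) ≈ H 0ℤ (l + n)
  ζ-H₀ n l = H (≡⇒≋ (+s*0 0ℤ (ℤ.*-zeroʳ (n + n)))) ≋-refl

  ζ-T₀ : ∀ n → to (ζ n) (T 0ℤ) ≈ T 0ℤ
  ζ-T₀ n = T (≡⇒≋ (+s*0 0ℤ (ℤ.*-zeroʳ (n + n))))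

  τ-H₀ : to τ (H 0ℤ 0ℤ) ≈ H (- 1ℤ) 0ℤ
  τ-H₀ = H (≡⇒≋ (identity s)) ≋-refl
    where
    identity : ∀ s → - (0ℤ + 1ℤ + s * 0ℤ) ≡ - 1ℤ
    identity = solve-∀

  σ₂-H₀ : to (φ σ₂) (H 0ℤ 0ℤ) ≈ H (- 1ℤ) 0ℤ
  σ₂-H₀ = ≈-trans (Isomorphism.cong τ (α-H₀ (- 1ℤ) 0ℤ)) τ-H₀

  σ₂-T₀ : to (φ σ₂) (T 0ℤ) ≈ T 0ℤ
  σ₂-T₀ = Isomorphism.cong τ (α-T₀ (- 1ℤ))

  φ-σ₂² : φ (σ₂ ^ʷ 2) ≈ᵃ ζ 1ℤ
  φ-σ₂² = base-rigid {φ (σ₂ ^ʷ 2)} {ζ 1ℤ} bot ≈-refl ≈-refl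
    (≈-trans (≈-trans (Isomorphism.cong (φ σ₂) σ₂-H₀) (H (≡⇒≋ (identity s)) ≋-refl)) (≈-sym (ζ-H₀ 1ℤ 0ℤ)))
    (≈-trans (≈-trans (Isomorphism.cong (φ σ₂) σ₂-T₀) σ₂-T₀) (≈-sym (ζ-T₀ 1ℤ)))
    top
    where
    identity : ∀ s → - (- 1ℤ + s * ℤ.-[1+ 1 ] + 1ℤ + s * (1ℤ + 1ℤ)) ≡ 0ℤ
    identity = solve-∀

  ζ-inner : ∀ n → Inner (ζ n)
  ζ-inner = one-parameter-inner ζ ζᶠ-+ ζᶠ-0 (σ₂ ^ʷ 2 , φ-σ₂²)

  φ-^ : ∀ (f : ℤ → Automorphism) → (∀ a b → f a ∙ f b ≈ᵃ f (a + b)) → f 0ℤ ≈ᵃ Aut.ε →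
        ∀ {u} → φ u ≈ᵃ f 1ℤ → ∀ n → φ (u ^ʷ n) ≈ᵃ f (+ n)
  φ-^ f f-+ f-0 {u} e zero    = Aut.sym {f 0ℤ} {Aut.ε} f-0
  φ-^ f f-+ f-0 {u} e (suc n) = Aut.trans {φ (u ^ʷ suc n)} {f 1ℤ ∙ f (+ n)} {f (+ suc n)}
    (Aut.∙-cong {φ u} {f 1ℤ} {φ (u ^ʷ n)} {f (+ n)} e (φ-^ f f-+ f-0 e n)) (f-+ 1ℤ (+ n))

  φ-σ₁^ : ∀ n → φ (σ₁ ^ʷ n) ≈ᵃ α (+ n)
  φ-σ₁^ = φ-^ α αᶠ-+ αᶠ-0 {σ₁} (Aut.refl {α 1ℤ})

  φ-σ₃^ : ∀ n → φ (σ₃ ^ʷ n) ≈ᵃ γ (+ n)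
  φ-σ₃^ = φ-^ γ γᶠ-+ γᶠ-0 {σ₃} (Aut.refl {γ 1ℤ})

  φ-σ₂^ : ∀ n → φ (σ₂ ^ʷ (n ℕ.* 2)) ≈ᵃ ζ (+ n)
  φ-σ₂^ zero    = Aut.sym {ζ 0ℤ} {Aut.ε} ζᶠ-0
  φ-σ₂^ (suc n) = Aut.trans {φ (σ₂ ^ʷ (suc n ℕ.* 2))} {ζ 1ℤ ∙ ζ (+ n)} {ζ (+ suc n)}
    (Aut.∙-cong {φ (σ₂ ^ʷ 2)} {ζ 1ℤ} {φ (σ₂ ^ʷ (n ℕ.* 2))} {ζ (+ n)} φ-σ₂² (φ-σ₂^ n)) (ζᶠ-+ 1ℤ (+ n))

  σ-standard : ∀ i → IsStandardGenerator polytope Φ i (φ (gen i))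
  σ-standard i = toFlag (adj (suc i) base) , adj-adjacent (suc i) base ,
    adjacent-resp polytope {inject₁ i} {Ψ} {Ψ} {toFlag (adj (inject₁ i) (adj (suc i) base))} {Φ ▹ φ (gen i)}
      (≈ᶠ-refl {Ψ}) (≈ᶠ-sym {Φ ▹ φ (gen i)} {toFlag (adj (inject₁ i) (adj (suc i) base))} (image i))
          (adj-adjacent (inject₁ i) (adj (suc i) base))
    where
    Ψ : Flag polytope
    Ψ = toFlag (adj (suc i) base)

    identity₁ : ∀ s → 1ℤ ≡ 0ℤ - (0ℤ - 1ℤ - s * 0ℤ)
    identity₁ = solve-∀
    identity₂ : ∀ s → - 1ℤ ≡ 0ℤ - 1ℤ - s * 0ℤ
    identity₂ = solve-∀
    identity₃ : ∀ s → 0ℤ ≡ 0ℤ - (0ℤ - 1ℤ - s * 0ℤ) + 1ℤ * (0ℤ - 1ℤ - s * 0ℤ)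
    identity₃ = solve-∀
    identity₄ : ∀ s → 0ℤ ≡ 0ℤ - 1ℤ - s * 0ℤ + 1ℤ + s * 0ℤ
    identity₄ = solve-∀
    identity₅ : ∀ s → 1ℤ ≡ 0ℤ + 1ℤ + s * 0ℤ
    identity₅ = solve-∀

    image : ∀ i → Φ ▹ φ (gen i) ≈ᶠ toFlag (adj (inject₁ i) (adj (suc i) base))
    image zero = base▹ (φ σ₁) (adj zero (adj 1F base)) bot ≈-refl ≈-refl (α-H₀ 1ℤ 0ℤ) (α-T₀ 1ℤ) top
    image 1F = base▹ (φ σ₂) (adj 1F (adj 2F base)) bot ≈-refl
      (E ≋-refl (≡⇒≋ (identity₁ s)))
      (≈-trans σ₂-H₀ (H (≡⇒≋ (identity₂ s)) (≡⇒≋ (identity₃ s))))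
      (≈-trans σ₂-T₀ (T (≋-trans (≡⇒≋ (identity₄ s))
          (successor-cong (≋-refl {x = 0ℤ - 1ℤ - s * 0ℤ}) (≡⇒≋ (identity₃ s))))))
      top
    image 2F = base▹ (φ σ₃) (adj 2F (adj 3F base)) bot ≈-refl ≈-refl
      (H (≡⇒≋ (identity₅ s)) ≋-refl) (T (≡⇒≋ (identity₅ s))) top

  φ-[σ₁σ₂]² : φ ((σ₁ · σ₂) ^ʷ 2) ≈ᵃ Aut.ε
  φ-[σ₁σ₂]² F = ≈-trans (≈-trans (φ-σ₁σ₂ (to (φ (σ₁ · σ₂)) F)) (Isomorphism.cong τ (φ-σ₁σ₂ F))) (τᶠ-τᶠ F)

  φ-[σ₂σ₃]² : φ ((σ₂ · σ₃) ^ʷ 2) ≈ᵃ Aut.ε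
  φ-[σ₂σ₃]² = base-rigid {φ ((σ₂ · σ₃) ^ʷ 2)} {Aut.ε} bot ≈-refl ≈-refl
    (≈-trans (Isomorphism.cong (φ (σ₂ · σ₃)) σ₂σ₃-H₀) σ₂σ₃-H₀)
    (≈-trans (Isomorphism.cong (φ (σ₂ · σ₃)) (Isomorphism.cong (φ σ₃) σ₂-T₀)) (T (≡⇒≋ (identity s))))
    top
    where
    σ₂σ₃-H₀ : to (φ (σ₂ · σ₃)) (H 0ℤ 0ℤ) ≈ H 0ℤ 0ℤ
    σ₂σ₃-H₀ = Isomorphism.cong (φ σ₃) σ₂-H₀
    identity : ∀ s → - (1ℤ + s * 0ℤ) + 1ℤ ≡ 0ℤ
    identity = solve-∀

  φ-[σ₁σ₂σ₃]² : φ ((σ₁ · σ₂ · σ₃) ^ʷ 2) ≈ᵃ Aut.ε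
  φ-[σ₁σ₂σ₃]² F = ≈-trans (≈-trans (step (to (φ (σ₁ · σ₂ · σ₃)) F)) (Isomorphism.cong (τ ∙ γ 1ℤ) (step F)))
      (involution F)
    where
    step : φ (σ₁ · σ₂ · σ₃) ≈ᵃ τ ∙ γ 1ℤ
    step F = Isomorphism.cong (γ 1ℤ) (φ-σ₁σ₂ F)

    identity : ∀ s → - (- (0ℤ + 1ℤ + s * 0ℤ) + 1ℤ + 1ℤ + s * 0ℤ) + 1ℤ ≡ 0ℤ
    identity = solve-∀

    involution : (τ ∙ γ 1ℤ) ∙ (τ ∙ γ 1ℤ) ≈ᵃ Aut.ε
    involution = base-rigid {(τ ∙ γ 1ℤ) ∙ (τ ∙ γ 1ℤ)} {Aut.ε} bot ≈-refl ≈-refl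
        (H (≡⇒≋ (identity s)) ≋-refl) ≈-refl top

  φ-σ₂²σ₁ : φ (σ₂ ^ʷ 2 · σ₁) ≈ᵃ φ (σ₁ · σ₂ ^ʷ 2)
  φ-σ₂²σ₁ = Aut.trans {φ (σ₂ ^ʷ 2 · σ₁)} {ζ 1ℤ ∙ α 1ℤ} {φ (σ₁ · σ₂ ^ʷ 2)}
    (λ F → Isomorphism.cong (α 1ℤ) (φ-σ₂² F))
    (Aut.trans {ζ 1ℤ ∙ α 1ℤ} {α 1ℤ ∙ ζ 1ℤ} {φ (σ₁ · σ₂ ^ʷ 2)} commute (λ F → ≈-sym (φ-σ₂² (to (α 1ℤ) F))))
    where
    commute : ζ 1ℤ ∙ α 1ℤ ≈ᵃ α 1ℤ ∙ ζ 1ℤ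
    commute = base-rigid {ζ 1ℤ ∙ α 1ℤ} {α 1ℤ ∙ ζ 1ℤ} bot ≈-refl ≈-refl
      (≈-trans (≈-trans (Isomorphism.cong (α 1ℤ) (ζ-H₀ 1ℤ 0ℤ)) (α-H₀ 1ℤ 1ℤ))
        (≈-sym (≈-trans (Isomorphism.cong (ζ 1ℤ) (α-H₀ 1ℤ 0ℤ)) (ζ-H₀ 1ℤ 0ℤ))))
      (≈-trans (≈-trans (Isomorphism.cong (α 1ℤ) (ζ-T₀ 1ℤ)) (α-T₀ 1ℤ))
        (≈-sym (≈-trans (Isomorphism.cong (ζ 1ℤ) (α-T₀ 1ℤ)) (ζ-T₀ 1ℤ))))
      top

  -- `ζ 1ℤ` fixes `T 0ℤ` and takes `T 1ℤ` to the facet with index `1ℤ + (s + s)`. Matching this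
  -- exponent with the second extra relation determines `s`.
  γ-ζ : ∀ {n} → n ≋ 1ℤ + (s + s) mod r → γ 1ℤ ∙ ζ 1ℤ ≈ᵃ ζ 1ℤ ∙ γ n
  γ-ζ {n} e = base-rigid {γ 1ℤ ∙ ζ 1ℤ} {ζ 1ℤ ∙ γ n} bot ≈-refl
    (E ≋-refl (≡⇒≋ (≡.sym (cong (λ a → 1ℤ - a) (ℤ.*-zeroʳ n)))))
    (≈-trans (H shift ≋-refl) (≈-sym (Isomorphism.cong (γ n) (ζ-H₀ 1ℤ 0ℤ))))
    (≈-trans (T shift) (≈-sym (Isomorphism.cong (γ n) (ζ-T₀ 1ℤ))))
    top
    where
    identity : ∀ s → 1ℤ + s * + 2 ≡ 0ℤ + (1ℤ + (s + s))
    identity = solve-∀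
    shift : 1ℤ + s * + 2 ≋ 0ℤ + n mod r
    shift = ≋-trans (≡⇒≋ (identity s)) (+-congˡ 0ℤ (≋-sym e))

  φ-σ₃σ₂² : ∀ {n} → + n ≋ 1ℤ + (s + s) mod r → φ (σ₃ · σ₂ ^ʷ 2) ≈ᵃ φ (σ₂ ^ʷ 2 · σ₃ ^ʷ n)
  φ-σ₃σ₂² {n} e = Aut.trans {φ (σ₃ · σ₂ ^ʷ 2)} {γ 1ℤ ∙ ζ 1ℤ} {φ (σ₂ ^ʷ 2 · σ₃ ^ʷ n)}
      (λ F → φ-σ₂² (to (γ 1ℤ) F))
    (Aut.trans {γ 1ℤ ∙ ζ 1ℤ} {ζ 1ℤ ∙ γ (+ n)} {φ (σ₂ ^ʷ 2 · σ₃ ^ʷ n)} (γ-ζ e)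
      (Aut.sym {φ (σ₂ ^ʷ 2 · σ₃ ^ʷ n)} {ζ 1ℤ ∙ γ (+ n)}
        (Aut.∙-cong {φ (σ₂ ^ʷ 2)} {ζ 1ℤ} {φ (σ₃ ^ʷ n)} {γ (+ n)} φ-σ₂² (φ-σ₃^ n))))

-- Chirality

module Chirality (m w κ : ℤ) (1≢0 : ¬ 1ℤ ≋ 0ℤ mod m)
                 (4s≢0 : ¬ Modulus.s m w κ * + 4 ≋ 0ℤ mod (Modulus.r m w κ)) where
  open Modulus m w κ
  open Order m w κ
  open Sections m w κ 1≢0
  open Construction m w κ 1≢0
  open FlagGraph m w κ 1≢0
  open Automorphisms m w κ 1≢0
  open Orbits m w κ 1≢0

  baseFlag : Bool → FlagIndex
  baseFlag false = base
  baseFlag true  = adj zero base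

  -- A 2-colouring of the flag graph: every adjacency flips exactly one of the bits `δ` and `η`. Its
  -- classes turn out to be the orbits.
  parity : FlagIndex → Bool
  parity ⟪ δ , _ , _ , _ , η ⟫ = δ xor η

  parity-adj : ∀ k p → parity (adj k p) ≡ not (parity p)
  parity-adj zero ⟪ false , _ , _ , _ , η ⟫ = refl
  parity-adj zero ⟪ true , _ , _ , _ , η ⟫ = ≡.sym (not-involutive η)
  parity-adj 1F ⟪ false , _ , _ , _ , η ⟫ = refl
  parity-adj 1F ⟪ true , _ , _ , _ , η ⟫ = ≡.sym (not-involutive η)
  parity-adj 2F ⟪ false , _ , _ , _ , false ⟫ = refl
  parity-adj 2F ⟪ false , _ , _ , _ , true ⟫ = refl
  parity-adj 2F ⟪ true , _ , _ , _ , false ⟫ = refl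
  parity-adj 2F ⟪ true , _ , _ , _ , true ⟫ = refl
  parity-adj 3F ⟪ false , _ , _ , _ , η ⟫ = refl
  parity-adj 3F ⟪ true , _ , _ , _ , η ⟫ = refl

  InnerOrbit : FlagIndex → FlagIndex → Set
  InnerOrbit p q = ∃[ f ] (Inner f × toFlag p ▹ f ≈ᶠ toFlag q)

  innerOrbit-adj : ∀ k {p q} → InnerOrbit p q → InnerOrbit (adj k p) (adj k q)
  innerOrbit-adj k {p} {q} (f , inner , e) = f , inner ,
    ≈ᶠ-sym {toFlag (adj k q)} {toFlag (adj k p) ▹ f} (adj-unique k q {toFlag p ▹ f} {toFlag (adj k p) ▹ f}
      (≈ᶠ-sym {toFlag p ▹ f} {toFlag q} e)
      (▹-adjacent polytope {k} {toFlag p} {toFlag (adj k p)} f (adj-adjacent k p)))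

  even-orbit : ∀ δ x y j → InnerOrbit base ⟪ δ , x , y , j , δ ⟫
  -- The three factors take `E 0ℤ 0ℤ` through `E x 0ℤ` and `E x l` to `E x (l - j * x)`, which is
  -- `E x y`, and `H 0ℤ 0ℤ` to `H j l`.
  even-orbit false x y j = (α x ∙ ζ l) ∙ γ j ,
    ∙-inner {α x ∙ ζ l} {γ j} (∙-inner {α x} {ζ l} (α-inner x) (ζ-inner l)) (γ-inner j) ,
    base▹ ((α x ∙ ζ l) ∙ γ j) ⟪ false , x , y , j , false ⟫ bot
      (V (≡⇒≋ (ℤ.+-identityˡ x)))
      (E (≡⇒≋ (ℤ.+-identityˡ x)) (≡⇒≋ (identity₁ x y j)))
      (≈-trans (Isomorphism.cong (γ j) {y = H 0ℤ (0ℤ + l)}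
          (≈-trans (Isomorphism.cong (ζ l) {y = H 0ℤ 0ℤ} (α-H₀ x 0ℤ)) (ζ-H₀ l 0ℤ)))
        (H (≡⇒≋ (ℤ.+-identityˡ j)) (≡⇒≋ (ℤ.+-identityˡ l))))
      (≈-trans (Isomorphism.cong (γ j) {y = T 0ℤ}
          (≈-trans (Isomorphism.cong (ζ l) {y = T 0ℤ} (α-T₀ x)) (ζ-T₀ l)))
        (T (≡⇒≋ (ℤ.+-identityˡ j))))
      top
    where
    l : ℤ
    l = y + x * j
    identity₁ : ∀ x y j → 0ℤ + (y + x * j) - j * (0ℤ + x) ≡ y
    identity₁ = solve-∀
  -- `τ` exchanges the ends of `E 0ℤ 0ℤ` and keeps `T 0ℤ`, which must now become the successor
  -- facet; hence the shift is by `n` instead of `j`.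
  even-orbit true x y j = ((τ ∙ α x) ∙ ζ l) ∙ γ n ,
    ∙-inner {(τ ∙ α x) ∙ ζ l} {γ n} (∙-inner {τ ∙ α x} {ζ l} (∙-inner {τ} {α x} τ-inner (α-inner x))
        (ζ-inner l)) (γ-inner n) ,
    base▹ (((τ ∙ α x) ∙ ζ l) ∙ γ n) ⟪ true , x , y , j , true ⟫ bot
      (V (≡⇒≋ (ℤ.+-comm (- 1ℤ) x)))
      (E (≡⇒≋ (ℤ.+-identityˡ x)) (≡⇒≋ (identity₁ x y n)))
      (≈-trans (Isomorphism.cong (γ n) {y = to (ζ l) (to (α x) (H (- 1ℤ) 0ℤ))}
          (Isomorphism.cong (ζ l) {y = to (α x) (H (- 1ℤ) 0ℤ)}
          (Isomorphism.cong (α x) {y = H (- 1ℤ) 0ℤ} τ-H₀)))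
        (H facet label))
      (≈-trans (Isomorphism.cong (γ n) {y = T 0ℤ}
          (≈-trans (Isomorphism.cong (ζ l) {y = T 0ℤ} (α-T₀ x)) (ζ-T₀ l)))
        (T (≡⇒≋ (ℤ.+-identityˡ n))))
      top
    where
    n l : ℤ
    n = successor j (y + x * j)
    l = y + x * n
    identity₁ : ∀ x y n → 0ℤ + (y + x * n) - n * (0ℤ + x) ≡ y
    identity₁ = solve-∀
    identity₂ : ∀ x y n → 0ℤ + x * - 1ℤ + (y + x * n) ≡ y + x * (n - 1ℤ)
    identity₂ = solve-∀
    identity₃ : ∀ j → j + 1ℤ - 1ℤ ≡ j
    identity₃ = solve-∀
    identity₄ : ∀ x y j s → - 1ℤ + s * (x * + 2) + s * ((y + x * (j + 1ℤ) + (y + x * (j + 1ℤ))) * - 1ℤ) +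
                (j + 1ℤ + s * (y + x * j + (y + x * j))) ≡ j
    identity₄ = solve-∀
    n≋j+1 : n ≋ j + 1ℤ mod m
    n≋j+1 = successor-mod-m j (y + x * j)
    l≋ : l ≋ y + x * (j + 1ℤ) mod m
    l≋ = +-congˡ y (*-congˡ x n≋j+1)
    label : 0ℤ + x * - 1ℤ + l ≋ y + x * j mod m
    label = ≋-trans (≡⇒≋ (identity₂ x y n)) (+-congˡ y
        (*-congˡ x (≋-trans (+-congʳ (- 1ℤ) n≋j+1) (≡⇒≋ (identity₃ j)))))
    facet : - 1ℤ + s * (x * + 2) + s * ((l + l) * (- 1ℤ + s * (x * + 2))) + n ≋ j mod r
    facet = ≋-trans (+-congʳ n (+-congˡ (- 1ℤ + s * (x * + 2))
        (s*-cong (*-cong (+-cong l≋ l≋) (+s*≋ (- 1ℤ) (x * + 2))))))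
                    (≡⇒≋ (identity₄ x y j s))

  orbit : ∀ p → InnerOrbit (baseFlag (parity p)) p
  orbit ⟪ false , x , y , j , false ⟫ = even-orbit false x y j
  orbit ⟪ true , x , y , j , true ⟫   = even-orbit true x y j
  orbit ⟪ true , x , y , j , false ⟫  = innerOrbit-adj zero {base} {⟪ false , x , y , j , false ⟫}
      (even-orbit false x y j)
  orbit ⟪ false , x , y , j , true ⟫  = innerOrbit-adj zero {base} {⟪ true , x , y , j , true ⟫}
      (even-orbit true x y j)

  module _ (f : Automorphism) (reflects : Φ ▹ f ≈ᶠ toFlag (adj zero base)) where

    private
      Maps : FlagIndex → FlagIndex → Set
      Maps p q = toFlag p ▹ f ≈ᶠ toFlag q

      step : ∀ k {p q} → Maps p q → Maps (adj k p) (adj k q)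
      step k {p} {q} e = ≈ᶠ-sym {toFlag (adj k q)} {toFlag (adj k p) ▹ f}
          (adj-unique k q {toFlag p ▹ f} {toFlag (adj k p) ▹ f}
        (≈ᶠ-sym {toFlag p ▹ f} {toFlag q} e)
        (▹-adjacent polytope {k} {toFlag p} {toFlag (adj k p)} f (adj-adjacent k p)))

      Fixes : ℤ → Set
      Fixes n = Maps ⟪ false , 0ℤ , 0ℤ , n , false ⟫ ⟪ true , 0ℤ , 0ℤ , n , false ⟫

      fixes-resp : ∀ {n n′} → n ≋ n′ mod r → Fixes n → Fixes n′
      fixes-resp {n} {n′} e h i = ≈-trans (Isomorphism.cong f
          (≈ᶠ-sym {toFlag ⟪ false , 0ℤ , 0ℤ , n , false ⟫} {toFlag ⟪ false , 0ℤ , 0ℤ , n′ , false ⟫}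
          (toFlag-cong false false {0ℤ} {0ℤ} {0ℤ} {0ℤ} ≋-refl ≋-refl e) i))
        (≈-trans (h i) (toFlag-cong true false {0ℤ} {0ℤ} {0ℤ} {0ℤ} ≋-refl ≋-refl e i))

      up : ∀ n → successor n (0ℤ + 0ℤ * n) ≡ n + 1ℤ
      up n = identity n s
        where
        identity : ∀ n s → n + 1ℤ + s * (0ℤ + 0ℤ * n + (0ℤ + 0ℤ * n)) ≡ n + 1ℤ
        identity = solve-∀

      down : ∀ n → predecessor (n + 1ℤ) (0ℤ + 0ℤ * (n + 1ℤ - 1ℤ)) ≡ n
      down n = identity n s
        where
        identity : ∀ n s → n + 1ℤ - 1ℤ - s * (0ℤ + 0ℤ * (n + 1ℤ - 1ℤ) + (0ℤ + 0ℤ * (n + 1ℤ - 1ℤ))) ≡ n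
        identity = solve-∀

      fixes : ∀ n → Fixes n
      fixes = ℤ-induction Fixes reflects
        (λ n h → fixes-resp (≡⇒≋ (up n)) (step 2F {⟪ false , 0ℤ , 0ℤ , n , true ⟫}
            {⟪ true , 0ℤ , 0ℤ , n , true ⟫}
          (step 3F {⟪ false , 0ℤ , 0ℤ , n , false ⟫} {⟪ true , 0ℤ , 0ℤ , n , false ⟫} h)))
        (λ n h → fixes-resp (≡⇒≋ (down n)) (step 3F {adj 2F ⟪ false , 0ℤ , 0ℤ , n + 1ℤ , false ⟫}
            {adj 2F ⟪ true , 0ℤ , 0ℤ , n + 1ℤ , false ⟫}
          (step 2F {⟪ false , 0ℤ , 0ℤ , n + 1ℤ , false ⟫} {⟪ true , 0ℤ , 0ℤ , n + 1ℤ , false ⟫} h)))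

      walk : List (Fin 4) → FlagIndex → FlagIndex
      walk List.[]       p = p
      walk (k List.∷ ks) p = walk ks (adj k p)

      walk-maps : ∀ ks {p q} → Maps p q → Maps (walk ks p) (walk ks q)
      walk-maps List.[]       e = e
      walk-maps (k List.∷ ks) {p} {q} e = walk-maps ks {adj k p} {adj k q} (step k {p} {q} e)

      path : List (Fin 4)
      path = 1F List.∷ 3F List.∷ 2F List.∷ 3F List.∷ 2F List.∷ List.[]

      -- The walk passes over to the edge E 1 0, which f maps to E (- 1) 0,
      -- and proceeds along the facets T 0, T 1, T (2 + 2s) on it; their images
      -- are the facets T 0, T 1, T (2 - 2s) on E (- 1) 0.
      moves : to f (T (+ 2 + s * + 2)) ≈ T (+ 2 + s * - + 2)
      moves = ≈-trans (Isomorphism.cong f {T (+ 2 + s * + 2)} (T (≡⇒≋ (identity₁ s))))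
        (≈-trans (walk-maps path {base} {adj zero base} reflects 4F) (T (≡⇒≋ (identity₂ s))))
        where
        identity₁ : ∀ s → + 2 + s * + 2 ≡ 0ℤ + 1ℤ + s * 0ℤ + 1ℤ + s *
            (0ℤ + 1ℤ * (0ℤ + 1ℤ + s * 0ℤ) + (0ℤ + 1ℤ * (0ℤ + 1ℤ + s * 0ℤ)))
        identity₁ = solve-∀
        identity₂ : ∀ s → 0ℤ + 1ℤ + s * 0ℤ + 1ℤ + s *
            (0ℤ + - 1ℤ * (0ℤ + 1ℤ + s * 0ℤ) + (0ℤ + - 1ℤ * (0ℤ + 1ℤ + s * 0ℤ))) ≡ + 2 + s * - + 2
        identity₂ = solve-∀

    no-reflection : ⊥
    no-reflection = 4s≢0 (≋-linear (- 1ℤ) 0ℤ (T-injective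
        (≈-trans (≈-sym moves) (fixes (+ 2 + s * + 2) 4F))) (identity s r))
      where
      T-injective : ∀ {t t′} → T t ≈ T t′ → t ≋ t′ mod r
      T-injective (T e) = e
      identity : ∀ s r → s * + 4 - 0ℤ ≡ - 1ℤ * (+ 2 + s * - + 2 - (+ 2 + s * + 2)) + 0ℤ * r
      identity = solve-∀

  flag-orbit : ∀ Ψ → ∃[ b ] SameOrbit polytope (toFlag (baseFlag b)) Ψ
  flag-orbit Ψ with flag-index Ψ
  ... | p , e with orbit p
  ...   | f , _ , e′ = parity p , f , ≈ᶠ-trans {toFlag (baseFlag (parity p)) ▹ f} {toFlag p} {Ψ} e′ e

  ¬sameOrbit : ∀ b → ¬ SameOrbit polytope (toFlag (baseFlag b)) (toFlag (baseFlag (not b)))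
  ¬sameOrbit false (f , e) = no-reflection f e
  ¬sameOrbit true  o with sameOrbit-sym polytope {toFlag (adj zero base)} {Φ} o
  ... | f , e = no-reflection f e

  chiral : Chiral polytope
  chiral = (Φ , toFlag (adj zero base) , ¬sameOrbit false , λ Ψ → split Ψ (flag-orbit Ψ)) , adjacent-orbits
    where
    split : ∀ Ψ → ∃[ b ] SameOrbit polytope (toFlag (baseFlag b)) Ψ →
            SameOrbit polytope Φ Ψ ⊎ SameOrbit polytope (toFlag (adj zero base)) Ψ
    split Ψ (false , o) = inj₁ o
    split Ψ (true  , o) = inj₂ o

    adjacent-orbits : ∀ k Ψ Υ → Adjacent polytope k Ψ Υ → ¬ SameOrbit polytope Ψ Υ
    adjacent-orbits k Ψ Υ a o with flag-index Ψ
    ... | p , e = ¬sameOrbit (parity p) (trans′ {toFlag (baseFlag (parity p))} {toFlag p}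
        {toFlag (baseFlag (not (parity p)))} (to-orbit p)
        (trans′ {toFlag p} {Ψ} {toFlag (baseFlag (not (parity p)))} (≈⇒sameOrbit polytope {toFlag p} {Ψ} e)
        (trans′ {Ψ} {Υ} {toFlag (baseFlag (not (parity p)))} o
        (trans′ {Υ} {toFlag (adj k p)} {toFlag (baseFlag (not (parity p)))}
          (≈⇒sameOrbit polytope {Υ} {toFlag (adj k p)}
              (≈ᶠ-sym {toFlag (adj k p)} {Υ} (adj-unique k p {Ψ} {Υ} e a)))
          (subst (λ b → SameOrbit polytope (toFlag (adj k p)) (toFlag (baseFlag b))) (parity-adj k p)
            (sameOrbit-sym polytope {toFlag (baseFlag (parity (adj k p)))} {toFlag (adj k p)}
                (to-orbit (adj k p))))))))
      where
      trans′ : ∀ {Φ Ψ Υ : Flag polytope} → SameOrbit polytope Φ Ψ → SameOrbit polytope Ψ Υ → SameOrbit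
          polytope Φ Υ
      trans′ {Φ} {Ψ} {Υ} = sameOrbit-trans polytope {Φ} {Ψ} {Υ}

      to-orbit : ∀ p → SameOrbit polytope (toFlag (baseFlag (parity p))) (toFlag p)
      to-orbit p with orbit p
      ... | f , _ , e = f , e

-- Chiral polytopes covered by the polytope

module CoveredBy (m w κ : ℤ) (1≢0 : ¬ 1ℤ ≋ 0ℤ mod m)
    (4s≢0 : ¬ Modulus.s m w κ * + 4 ≋ 0ℤ mod (Modulus.r m w κ))
    (invertible-m : ∀ {d} → ¬ d ≋ 0ℤ mod m → ∃[ n ] n * d ≋ 1ℤ mod m)
    (invertible-r : ∀ {d} → ¬ d ≋ 0ℤ mod m → ∃[ n ] n * d ≋ 1ℤ mod (Modulus.r m w κ))
    (reaches-s : ∀ {d} → ¬ d ≋ 0ℤ mod (Modulus.r m w κ) → ∃[ n ] n * d ≋ Modulus.s m w κ mod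
        (Modulus.r m w κ))
    (2≢0 : ¬ + 2 ≋ 0ℤ mod m)
    (Q : Polytope 4) (Q-chiral : Chiral Q) (covering : Covering (Construction.polytope m w κ 1≢0) Q) where
  open Modulus m w κ
  open Order m w κ
  open Sections m w κ 1≢0
  open Construction m w κ 1≢0
  open FlagGraph m w κ 1≢0
  open Automorphisms m w κ 1≢0
  open Orbits m w κ 1≢0

  private
    module Q = Polytope Q
    module QAut = Group (Aut Q)
    module C = Covering covering
    open Setoid (flags Q) using () renaming (_≈_ to _≈ᵠ_)

  infix 4 _~_ _⊑_

  -- Equality and order of `Q` pulled back along the covering, so that the coordinates of faces
  -- remain available.
  _~_ _⊑_ : Face → Face → Set
  F ~ G = C.map F Q.≈ C.map G
  F ⊑ G = C.map F Q.≤ C.map G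

  ≈⇒~ : ∀ {F G} → F ≈ G → F ~ G
  ≈⇒~ = C.cong

  ~-sym : ∀ {F G} → F ~ G → G ~ F
  ~-sym = Q.Eq.sym

  ~-trans : ∀ {F G K} → F ~ G → G ~ K → F ~ K
  ~-trans = Q.Eq.trans

  ~-coerce : ∀ {F F′ G G′} → F ≈ F′ → G ≈ G′ → F ~ G → F′ ~ G′
  ~-coerce d e h = ~-trans (≈⇒~ (≈-sym d)) (~-trans h (≈⇒~ e))

  ≤⇒⊑ : ∀ {F G} → F ≤ G → F ⊑ G
  ≤⇒⊑ = C.mono

  ⊑-trans : ∀ {F G K} → F ⊑ G → G ⊑ K → F ⊑ K
  ⊑-trans = Poset.trans Q.faces

  ~⇒⊑ : ∀ {F G} → F ~ G → F ⊑ G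
  ~⇒⊑ = Poset.reflexive Q.faces

  ~⇒rank : ∀ {F G} → F ~ G → rank F ≡ rank G
  ~⇒rank {F} {G} e = ≡.trans (≡.sym (C.rank-map F)) (≡.trans (Q.rank-cong e) (C.rank-map G))

  rank-< : ∀ {F G} → C.map F Q.< C.map G → rank F Fin.< rank G
  rank-< {F} {G} e = subst₂ Fin._<_ (C.rank-map F) (C.rank-map G) (Q.rank-mono e)

  ⊑-strict : ∀ {F G} → F ⊑ G → rank F ≢ rank G → C.map F Q.< C.map G
  ⊑-strict e r≢ = e , λ h → r≢ (~⇒rank h)

  ⊑∧≁⇒rank≢ : ∀ {F G} → F ⊑ G → ¬ F ~ G → rank F ≢ rank G
  ⊑∧≁⇒rank≢ e ≁ r≡ = Fin.<⇒≢ (rank-< (e , ≁)) r≡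

  ⋢ : ∀ {F G} → F ⊑ G → {_ : True (rank G Fin.<? rank F)} → ⊥
  ⋢ {F} {G} e {lt} = ℕ.<-asym (toWitness lt) (rank-< (⊑-strict e (λ r≡ → Fin.<⇒≢ (toWitness lt) (≡.sym r≡))))

  LiftsTo : Automorphism → Isomorphism Q Q → Set
  LiftsTo f g = ∀ F → to g (C.map F) Q.≈ C.map (to f F)

  -- There are two orbits and each adjacency changes the orbit, so two of them lead back.
  two-steps : ∀ j k {Ψ₀ Ψ₁ Ψ₂ : Flag Q} → Adjacent Q j Ψ₀ Ψ₁ → Adjacent Q k Ψ₁ Ψ₂ → SameOrbit Q Ψ₀ Ψ₂
  two-steps j k {Ψ₀} {Ψ₁} {Ψ₂} a b = choose (orbits Ψ₀) (orbits Ψ₁) (orbits Ψ₂)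
    where
    Ω Ω′ : Flag Q
    Ω  = proj₁ (proj₁ Q-chiral)
    Ω′ = proj₁ (proj₂ (proj₁ Q-chiral))

    orbits : ∀ Υ → SameOrbit Q Ω Υ ⊎ SameOrbit Q Ω′ Υ
    orbits = proj₂ (proj₂ (proj₂ (proj₁ Q-chiral)))

    distinct : ∀ j Ψ Υ → Adjacent Q j Ψ Υ → ¬ SameOrbit Q Ψ Υ
    distinct = proj₂ Q-chiral

    join : ∀ {Ω Ψ Υ : Flag Q} → SameOrbit Q Ω Ψ → SameOrbit Q Ω Υ → SameOrbit Q Ψ Υ
    join {Ω} {Ψ} {Υ} o o′ = sameOrbit-trans Q {Ψ} {Ω} {Υ} (sameOrbit-sym Q {Ω} {Ψ} o) o′

    choose : SameOrbit Q Ω Ψ₀ ⊎ SameOrbit Q Ω′ Ψ₀ → SameOrbit Q Ω Ψ₁ ⊎ SameOrbit Q Ω′ Ψ₁ →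
             SameOrbit Q Ω Ψ₂ ⊎ SameOrbit Q Ω′ Ψ₂ → SameOrbit Q Ψ₀ Ψ₂
    choose (inj₁ o) _        (inj₁ o″) = join {Ω} {Ψ₀} {Ψ₂} o o″
    choose (inj₂ o) _        (inj₂ o″) = join {Ω′} {Ψ₀} {Ψ₂} o o″
    choose (inj₁ o) (inj₁ o′) _        = contradiction (join {Ω} {Ψ₀} {Ψ₁} o o′) (distinct j Ψ₀ Ψ₁ a)
    choose (inj₂ o) (inj₂ o′) _        = contradiction (join {Ω′} {Ψ₀} {Ψ₁} o o′) (distinct j Ψ₀ Ψ₁ a)
    choose _ (inj₁ o) (inj₁ o′)        = contradiction (join {Ω} {Ψ₁} {Ψ₂} o o′) (distinct k Ψ₁ Ψ₂ b)
    choose _ (inj₂ o) (inj₂ o′)        = contradiction (join {Ω′} {Ψ₁} {Ψ₂} o o′) (distinct k Ψ₁ Ψ₂ b)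

  -- A standard generator moves the base flag by two adjacencies, which the covering preserves. By
  -- `two-steps` an automorphism of `Q` makes the same move, and rigidity extends the agreement to
  -- all faces.
  lift-generator : ∀ i → ∃[ g ] LiftsTo (φ (gen i)) g
  lift-generator i with σ-standard i
  ... | Ψ , a , b with two-steps (suc i) (inject₁ i) {C.mapFlag Φ} {C.mapFlag Ψ} {C.mapFlag (Φ ▹ φ (gen i))}
      (C.adjacency (suc i) Φ Ψ a) (C.adjacency (inject₁ i) Ψ (Φ ▹ φ (gen i)) b)
  ...   | g , e = g , face-on-flag (λ F → to g (C.map F) Q.≈ C.map (to f F))
      (λ {F} {G} F≈G h → Q.Eq.trans (Isomorphism.cong g {C.map G} {C.map F} (C.cong (≈-sym F≈G)))
          (Q.Eq.trans h (C.cong (Isomorphism.cong f F≈G))))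
      (adjacency-rigid {Q} (λ p → C.mapFlag (toFlag p) ▹ g) (λ p → C.mapFlag (toFlag p ▹ f))
        (λ {p} {q} h i → Isomorphism.cong g {C.map (FlagIndex.faceAt p i)} {C.map (FlagIndex.faceAt q i)}
            (C.cong (h i)))
        (λ {p} {q} h i → C.cong (Isomorphism.cong f {FlagIndex.faceAt p i} {FlagIndex.faceAt q i} (h i)))
        (λ k p → ▹-adjacent Q {k} {C.mapFlag (toFlag p)} {C.mapFlag (toFlag (adj k p))} g
            (C.adjacency k (toFlag p) (toFlag (adj k p)) (adj-adjacent k p)))
        (λ k p → C.adjacency k (toFlag p ▹ f) (toFlag (adj k p) ▹ f)
            (▹-adjacent polytope {k} {toFlag p} {toFlag (adj k p)} f (adj-adjacent k p)))
        e)
    where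
    f : Automorphism
    f = φ (gen i)

  lift : ∀ u → ∃[ g ] LiftsTo (φ u) g
  lift (gen i) = lift-generator i
  lift 1ʷ      = QAut.ε , λ F → Q.Eq.refl
  lift (u · v) with lift u | lift v
  ... | g , d | h , e = g QAut.∙ h , λ F → Q.Eq.trans (Isomorphism.cong h (d F)) (e (to (φ u) F))
  lift (u ⁻¹ʷ) with lift u
  ... | g , e = g QAut.⁻¹ , λ F → Q.Eq.trans
      (Isomorphism.cong (g QAut.⁻¹) (Q.Eq.trans (C.cong (≈-sym (Aut.inverseˡ (φ u) F)))
          (Q.Eq.sym (e (to (φ u Aut.⁻¹) F)))))
      (QAut.inverseʳ g (C.map (to (φ u Aut.⁻¹) F)))

  inner-~ : ∀ {f} → Inner f → ∀ {F G} → F ~ G → to f F ~ to f G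
  inner-~ {f} (u , e) {F} {G} h with lift u
  ... | g , lifts = Q.Eq.trans (Q.Eq.sym (image F)) (Q.Eq.trans (Isomorphism.cong g h) (image G))
    where
    image : ∀ F → to g (C.map F) Q.≈ C.map (to f F)
    image F = Q.Eq.trans (lifts F) (C.cong (e F))

  α-~ : ∀ n {F G} → F ~ G → αᶠ n F ~ αᶠ n G
  α-~ n = inner-~ {α n} (α-inner n)

  γ-~ : ∀ n {F G} → F ~ G → γᶠ n F ~ γᶠ n G
  γ-~ n = inner-~ {γ n} (γ-inner n)

  ζ-~ : ∀ n {F G} → F ~ G → ζᶠ n F ~ ζᶠ n G
  ζ-~ n = inner-~ {ζ n} (ζ-inner n)

  τ-~ : ∀ {F G} → F ~ G → τᶠ F ~ τᶠ G
  τ-~ = inner-~ {τ} τ-inner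

  adjacent-≁ : ∀ k p → ¬ FlagIndex.faceAt p (suc (inject₁ k)) ~ FlagIndex.faceAt (adj k p) (suc (inject₁ k))
  adjacent-≁ k p = proj₂ (C.adjacency k (toFlag p) (toFlag (adj k p)) (adj-adjacent k p))

  V≁V : ∀ x → ¬ V x ~ V (x - 1ℤ)
  V≁V x = adjacent-≁ zero ⟪ false , x , 0ℤ , 0ℤ , false ⟫

  E≁E : ∀ x y y′ → ¬ E x y ~ E (x + 1ℤ) y′
  E≁E x y y′ e = adjacent-≁ 1F ⟪ false , x , y , y - y′ , false ⟫
      (~-trans e (≈⇒~ (E ≋-refl (≡⇒≋ (identity y y′)))))
    where
    identity : ∀ y y′ → y′ ≡ y - (y - y′)
    identity = solve-∀

  H≁H : ∀ x y t → let l = y + x * (t - 1ℤ) in ¬ H t (y + x * t) ~ H (predecessor t l) l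
  H≁H x y t e = adjacent-≁ 2F ⟪ false , x , y , t , false ⟫
    (~-trans e (≈⇒~ (H ≋-refl (≋-sym (label-predecessor x y t (y + x * (t - 1ℤ)))))))

  T≁T : ∀ j l → ¬ T j ~ T (successor j l)
  T≁T j l e = adjacent-≁ 3F ⟪ false , 0ℤ , l , j , false ⟫
    (~-trans e (≈⇒~ (T (≡⇒≋ (cong (successor j) (≡.sym (identity l j)))))))
    where
    identity : ∀ l j → l + 0ℤ * j ≡ l
    identity = solve-∀

  -- The diamond condition of `Q`, made applicable to images of explicit faces: ranks survive the
  -- covering, and `¬ A ~ B` is available for faces exchanged by an adjacency.
  third : ∀ {F G} → 2 ℕ.+ toℕ (rank F) ≡ toℕ (rank G) → ∀ {A B D} →
          suc (toℕ (rank F)) ≡ toℕ (rank A) → rank A ≡ rank B → rank A ≡ rank D →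
          F ⊑ A × A ⊑ G → F ⊑ B × B ⊑ G → F ⊑ D × D ⊑ G → ¬ A ~ B → D ~ A ⊎ D ~ B
  third {F} {G} F-G {A} F-A A-B A-D (F⊑A , A⊑G) b d =
    diamond-third Q (⊑-strict (⊑-trans F⊑A A⊑G)
        (λ e → ℕ.<⇒≢ (ℕ.m≤n+m (suc (toℕ (rank F))) 1) (≡.trans (cong toℕ e) (≡.sym F-G))))
      (subst₂ (λ i j → 2 ℕ.+ toℕ i ≡ toℕ j) (≡.sym (C.rank-map F)) (≡.sym (C.rank-map G)) F-G)
      (between refl (F⊑A , A⊑G)) (between A-B b) (between A-D d)
    where
    between : ∀ {D} → rank A ≡ rank D → F ⊑ D × D ⊑ G → C.map F Q.< C.map D × C.map D Q.< C.map G
    between A-D (F⊑D , D⊑G) =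
      ⊑-strict F⊑D (λ e → ℕ.<⇒≢ (ℕ.n<1+n (toℕ (rank F)))
          (≡.trans (cong toℕ (≡.trans e (≡.sym A-D))) (≡.sym F-A))) ,
      ⊑-strict D⊑G (λ e → ℕ.<⇒≢ (ℕ.n<1+n (suc (toℕ (rank F))))
          (≡.trans F-A (≡.trans (cong toℕ (≡.trans A-D e)) (≡.sym F-G))))

  V⊑E : ∀ {i x y} → V i ⊑ E x y → V i ~ V x ⊎ V i ~ V (x - 1ℤ)
  V⊑E {i} {x} {y} e = third {bot} {E x y} refl refl refl refl
    (≤⇒⊑ bot≤ , ≤⇒⊑ (V≤E (inj₁ ≋-refl))) (≤⇒⊑ bot≤ , ≤⇒⊑ (V≤E (inj₂ ≋-refl))) (≤⇒⊑ bot≤ , e) (V≁V x)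

  E⊑H′ : ∀ {x y j l} → E x y ⊑ H j l → E x y ~ E x (l - x * j) ⊎ E x y ~ E (x + 1ℤ) (l - (x + 1ℤ) * j)
  E⊑H′ {x} {y} {j} {l} e = third {V x} {H j l} refl refl refl refl
    (≤⇒⊑ (V≤E (inj₁ ≋-refl)) , ≤⇒⊑ (label⇒E≤H x j l))
    (≤⇒⊑ (V≤E (inj₂ (≡⇒≋ (identity x)))) , ≤⇒⊑ (label⇒E≤H (x + 1ℤ) j l))
    (≤⇒⊑ (V≤E (inj₁ ≋-refl)) , e) (E≁E x _ _)
    where
    identity : ∀ x → x ≡ x + 1ℤ - 1ℤ
    identity = solve-∀

  E⊑H⊑T : ∀ {x y j l t} → E x y ⊑ H j l → H j l ⊑ T t →
          let l′ = y + x * (t - 1ℤ) in H j l ~ H t (y + x * t) ⊎ H j l ~ H (predecessor t l′) l′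
  E⊑H⊑T {x} {y} {j} {l} {t} d e = third {E x y} {T t} refl refl refl refl
    (≤⇒⊑ (E≤H ≋-refl) , ≤⇒⊑ (H≤T (inj₁ ≋-refl)))
    (≤⇒⊑ (E≤H-predecessor {t = t} ≋-refl) , ≤⇒⊑ (H-predecessor≤T {t})) (d , e) (H≁H x y t)

  H⊑T : ∀ {j l t} → H j l ⊑ T t → T t ~ T j ⊎ T t ~ T (successor j l)
  H⊑T {j} {l} {t} e = third {H j l} {top} refl refl refl refl
    (≤⇒⊑ (H≤T (inj₁ ≋-refl)) , ≤⇒⊑ ≤top) (≤⇒⊑ (H≤T (inj₂ ≋-refl)) , ≤⇒⊑ ≤top) (e , ≤⇒⊑ ≤top) (T≁T j l)

  Shiftable : (ℤ → Face) → ℤ → Set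
  Shiftable u n = (∀ {a b} → a ≋ b mod n → u a ~ u b) × (∀ c {a b} → u a ~ u b → u (a + c) ~ u (b + c))

  -- The integers a with u 0 ~ u a form a subgroup containing n.
  generates : ∀ {n} u → Shiftable u n → ∀ {d} → u 0ℤ ~ u d → ∀ {k c} → k * d ≋ c mod n → u 0ℤ ~ u c
  generates u (resp , shift) {d} h {k} e = ~-trans (multiple k) (resp e)
    where
    multiple : ∀ k → u 0ℤ ~ u (k * d)
    multiple = ℤ-induction (λ k → u 0ℤ ~ u (k * d)) (resp ≋-refl)
      (λ k h′ → ~-trans h (~-trans (resp (≡⇒≋ (≡.sym (ℤ.+-identityˡ d))))
          (~-trans (shift d h′) (resp (≡⇒≋ (identity k d))))))
      (λ k h′ → ~-trans (~-trans (resp (≡⇒≋ (≡.sym (ℤ.+-inverseʳ d))))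
          (~-trans (shift (- d) (~-sym h)) (shift (- d) h′))) (resp (≡⇒≋ (identity′ k d))))
      where
      identity : ∀ k d → k * d + d ≡ (k + 1ℤ) * d
      identity = solve-∀
      identity′ : ∀ k d → (k + 1ℤ) * d + - d ≡ k * d
      identity′ = solve-∀

  generates-all : ∀ {n} u → Shiftable u n → ∀ {d} → ∃[ k ] k * d ≋ 1ℤ mod n → u 0ℤ ~ u d → ∀ c → u 0ℤ ~ u c
  generates-all u shiftable {d} (k , e) h c = generates u shiftable h {c * k}
    (≋-trans (≡⇒≋ (ℤ.*-assoc c k d)) (≋-trans (*-congˡ c e) (≡⇒≋ (ℤ.*-identityʳ c))))

  V-shiftable : Shiftable V m
  V-shiftable = (λ e → ≈⇒~ (V e)) , λ c → α-~ c

  E₁-shiftable : ∀ y → Shiftable (λ x → E x y) m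
  E₁-shiftable y = (λ e → ≈⇒~ (E e ≋-refl)) , λ c → α-~ c

  E₂-shiftable : ∀ x → Shiftable (E x) m
  E₂-shiftable x = (λ e → ≈⇒~ (E ≋-refl e)) , λ c → ζ-~ c

  H₁-shiftable : ∀ l → Shiftable (λ j → H j l) r
  H₁-shiftable l = (λ e → ≈⇒~ (H e ≋-refl)) , λ c → γ-~ c

  T-shiftable : Shiftable T r
  T-shiftable = (λ e → ≈⇒~ (T e)) , λ c → γ-~ c

  private
    ≋-by-contradiction : ∀ {x y n} → ¬ ¬ y - x ≋ 0ℤ mod n → x ≋ y mod n
    ≋-by-contradiction {x} {y} {n} h with (y - x) ≋? 0ℤ
    ... | yes e = ≋-linear (- 1ℤ) 0ℤ e (identity x y n)
      where
      identity : ∀ x y n → x - y ≡ - 1ℤ * (y - x - 0ℤ) + 0ℤ * n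
      identity = solve-∀
    ... | no d≢0 = contradiction d≢0 h

  -- A nonzero difference is a unit modulo `m`, so one identification would spread to all vertices,
  -- including the two ends of an edge.
  V-injective : ∀ {i i′} → V i ~ V i′ → i ≋ i′ mod m
  V-injective {i} {i′} h = ≋-by-contradiction λ d≢0 →
    V≁V 1ℤ (~-sym (generates-all V V-shiftable (invertible-m d≢0)
      (~-coerce (V (≡⇒≋ (ℤ.+-inverseʳ i))) ≈-refl (α-~ (- i) h)) 1ℤ))

  -- After translation, `E 0ℤ 0ℤ ~ E d e`. Since `γ 1ℤ` fixes the former and takes the latter to
  -- `E d (e - d)`, edges whose second coordinates differ by `d` are identified. If `d` were a unit,
  -- `y` would become irrelevant and then `x` too, contrary to `E≁E`.
  E-injective₁ : ∀ {x x′ y y′} → E x y ~ E x′ y′ → x ≋ x′ mod m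
  E-injective₁ {x} {x′} {y} {y′} h = ≋-by-contradiction λ d≢0 →
    E≁E 0ℤ 0ℤ 0ℤ (generates-all (λ x → E x 0ℤ) (E₁-shiftable 0ℤ) (invertible-m d≢0) (along-x d≢0) 1ℤ)
    where
    d e : ℤ
    d = x′ - x
    e = y′ - y

    identity₁ : ∀ x e → e - 1ℤ * x ≡ e - x
    identity₁ = solve-∀
    identity₂ : ∀ d e → e - d + - e ≡ - d
    identity₂ = solve-∀
    identity₃ : ∀ d → d + - d ≡ 0ℤ
    identity₃ = solve-∀
    identity₄ : ∀ d m → d - 0ℤ ≡ - 1ℤ * (- d - 0ℤ) + 0ℤ * m
    identity₄ = solve-∀

    from-origin : E 0ℤ 0ℤ ~ E d e
    from-origin = ~-coerce (E (≡⇒≋ (ℤ.+-inverseʳ x)) (≡⇒≋ (ℤ.+-inverseʳ y))) ≈-refl (ζ-~ (- y) (α-~ (- x) h))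

    twist : E d e ~ E d (e - d)
    twist = ~-trans (~-sym from-origin) (~-coerce ≈-refl (E ≋-refl (≡⇒≋ (identity₁ d e)))
        (γ-~ 1ℤ from-origin))

    along-y : E 0ℤ 0ℤ ~ E 0ℤ (- d)
    along-y = ~-coerce (E (≡⇒≋ (ℤ.+-inverseʳ d)) (≡⇒≋ (ℤ.+-inverseʳ e)))
        (E (≡⇒≋ (ℤ.+-inverseʳ d)) (≡⇒≋ (identity₂ d e)))
      (α-~ (- d) (ζ-~ (- e) twist))

    along-x : ¬ d ≋ 0ℤ mod m → E 0ℤ 0ℤ ~ E d 0ℤ
    along-x d≢0 = ~-trans from-origin (~-coerce (E (≡⇒≋ (ℤ.+-identityˡ d)) (≡⇒≋ (ℤ.+-identityˡ e)))
      (E (≡⇒≋ (ℤ.+-identityˡ d)) (≡⇒≋ (ℤ.+-inverseˡ e))) (ζ-~ e (α-~ d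
        (generates-all (E 0ℤ) (E₂-shiftable 0ℤ)
            (invertible-m (λ h → d≢0 (≋-linear (- 1ℤ) 0ℤ h (identity₄ d m)))) along-y (- e)))))

  ≋+1⇒⊥ : ∀ {x x′} → x ≋ x′ mod m → x ≋ x′ + 1ℤ mod m → ⊥
  ≋+1⇒⊥ {x} {x′} d e = 1≢0 (≋-combine 1ℤ (- 1ℤ) 0ℤ d e (identity x x′ m))
    where
    identity : ∀ x x′ m → 1ℤ - 0ℤ ≡ 1ℤ * (x - x′) + - 1ℤ * (x - (x′ + 1ℤ)) + 0ℤ * m
    identity = solve-∀

  E⊑H : ∀ {x y j l} → E x y ⊑ H j l → E x y ~ E x (l - x * j)
  E⊑H {x} h with E⊑H′ h
  ... | inj₁ e = e
  ... | inj₂ e = ⊥-elim (≋+1⇒⊥ (≋-refl {x = x}) (E-injective₁ e))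

  Lifted : Face → Face → Set
  Lifted F G = ∃[ F′ ] ∃[ G′ ] (F ~ F′ × G ~ G′ × F′ ≤ G′)

  -- A covering is only monotone, so the order of `Q` might be finer than expected from above. The
  -- diamond condition excludes this: it leaves no room for faces beyond the images of those already
  -- incident. Both the isomorphism and the reflection need this.
  lift-⊑ : ∀ F G → F ⊑ G → Lifted F G
  lift-⊑ bot G _ = bot , G , Q.Eq.refl , Q.Eq.refl , bot≤
  lift-⊑ F top _ = F , top , Q.Eq.refl , Q.Eq.refl , ≤top
  lift-⊑ (V i) (V i′) h with V⊑E (⊑-trans h (≤⇒⊑ (V≤E {i′} {i′} {0ℤ} (inj₁ ≋-refl))))
  ... | inj₁ e = V i′ , V i′ , e , Q.Eq.refl , V≤V ≋-refl
  ... | inj₂ e = contradiction refl (⊑∧≁⇒rank≢ h (λ e′ → V≁V i′ (~-trans (~-sym e′) e)))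
  lift-⊑ (V i) (E x y) h with V⊑E h
  ... | inj₁ e = V x , E x y , e , Q.Eq.refl , V≤E (inj₁ ≋-refl)
  ... | inj₂ e = V (x - 1ℤ) , E x y , e , Q.Eq.refl , V≤E (inj₂ ≋-refl)
  lift-⊑ (V i) (H j l) _ = V i , H j l , Q.Eq.refl , Q.Eq.refl , V≤H
  lift-⊑ (V i) (T t)   _ = V i , T t , Q.Eq.refl , Q.Eq.refl , V≤T
  lift-⊑ (E x y) (E x′ y′) h = E x′ y′ , E x′ y′ , same , Q.Eq.refl , ≤-reflexive ≈-refl
    where
    vertex : ∀ {i} → V i ≤ E x y → V i ~ V x′ ⊎ V i ~ V (x′ - 1ℤ)
    vertex V≤E′ = V⊑E (⊑-trans (≤⇒⊑ V≤E′) h)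

    identity₁ : ∀ x x′ m → x - x′ ≡ 1ℤ * (x - 1ℤ - (x′ - 1ℤ)) + 0ℤ * m
    identity₁ = solve-∀
    identity₂ : ∀ x x′ m → + 2 - 0ℤ ≡ 1ℤ * (x - (x′ - 1ℤ)) + - 1ℤ * (x - 1ℤ - x′) + 0ℤ * m
    identity₂ = solve-∀
    identity₄ : ∀ x y → y ≡ y + x * 0ℤ
    identity₄ = solve-∀
    identity₅ : ∀ x y → y - x * 0ℤ ≡ y
    identity₅ = solve-∀

    x≋x′ : x ≋ x′ mod m
    x≋x′ with vertex (V≤E (inj₁ ≋-refl)) | vertex (V≤E (inj₂ ≋-refl))
    ... | inj₁ d | _      = V-injective d
    ... | inj₂ d | inj₂ e = ≋-linear 1ℤ 0ℤ (V-injective e) (identity₁ x x′ m)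
    -- If the two edges shared their ends in opposite order, `x` would be both `x′ - 1` and `x′ + 1`
    -- modulo `m`.
    ... | inj₂ d | inj₁ e = contradiction (≋-combine 1ℤ (- 1ℤ) 0ℤ (V-injective d) (V-injective e)
        (identity₂ x x′ m)) 2≢0

    same : E x y ~ E x′ y′
    same = ~-trans (E⊑H (⊑-trans h (≤⇒⊑ (E≤H {x′} {y′} {0ℤ} {y′} (≡⇒≋ (identity₄ x′ y′))))))
      (≈⇒~ (E x≋x′ (≡⇒≋ (identity₅ x y′))))
  lift-⊑ (E x y) (H j l) h = E x (l - x * j) , H j l , E⊑H h , Q.Eq.refl , label⇒E≤H x j l
  lift-⊑ (E x y) (T t)   _ = E x y , T t , Q.Eq.refl , Q.Eq.refl , E≤T
  lift-⊑ (H j l) (H j′ l′) h = H j′ l′ , H j′ l′ , same , Q.Eq.refl , ≤-reflexive ≈-refl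
    where
    identity₁ : ∀ l j → l ≡ l + 0ℤ * j
    identity₁ = solve-∀
    identity₂ : ∀ l j → l - 0ℤ * j ≡ l
    identity₂ = solve-∀

    E⊑Hjl : E 0ℤ l′ ⊑ H j l
    E⊑Hjl = ⊑-trans (~⇒⊑ (~-coerce (E ≋-refl (≡⇒≋ (identity₂ l′ j′))) ≈-refl
        (~-sym (E⊑H (⊑-trans (≤⇒⊑ E≤Hjl) h))))) (≤⇒⊑ E≤Hjl)
      where
      E≤Hjl : E 0ℤ l ≤ H j l
      E≤Hjl = E≤H (≡⇒≋ (identity₁ l j))

    same : H j l ~ H j′ l′
    same = [ (λ e → ~-trans e (≈⇒~ here′)) , (λ e → ⊥-elim (elsewhere e)) ]′
      (E⊑H⊑T {0ℤ} {l′} {j} {l} {j′} E⊑Hjl (⊑-trans h (≤⇒⊑ (H≤T {j′} {l′} {j′} (inj₁ ≋-refl)))))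
      where
      here′ : H j′ (l′ + 0ℤ * j′) ≈ H j′ l′
      here′ = H ≋-refl (≡⇒≋ (≡.sym (identity₁ l′ j′)))

      l″ : ℤ
      l″ = l′ + 0ℤ * (j′ - 1ℤ)

      elsewhere : ¬ H j l ~ H (predecessor j′ l″) l″
      elsewhere e = ⊑∧≁⇒rank≢ {H j l} {H j′ l′} h
          (λ e′ → H≁H 0ℤ l′ j′ (~-trans (≈⇒~ here′) (~-trans (~-sym e′) e))) refl
  lift-⊑ (H j l) (T t) h with H⊑T h
  ... | inj₁ e = H j l , T j , Q.Eq.refl , e , H≤T (inj₁ ≋-refl)
  ... | inj₂ e = H j l , T (successor j l) , Q.Eq.refl , e , H≤T (inj₂ ≋-refl)
  lift-⊑ (T t) (T t′) h with H⊑T (⊑-trans (≤⇒⊑ (H≤T {t} {0ℤ} {t} (inj₁ ≋-refl))) h)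
  ... | inj₁ e = T t′ , T t′ , ~-sym e , Q.Eq.refl , T≤T ≋-refl
  ... | inj₂ e = contradiction refl (⊑∧≁⇒rank≢ h (λ e′ → T≁T t 0ℤ (~-trans e′ e)))
  lift-⊑ (V _)   bot     h = ⊥-elim (⋢ h)
  lift-⊑ (E _ _) bot     h = ⊥-elim (⋢ h)
  lift-⊑ (E _ _) (V _)   h = ⊥-elim (⋢ h)
  lift-⊑ (H _ _) bot     h = ⊥-elim (⋢ h)
  lift-⊑ (H _ _) (V _)   h = ⊥-elim (⋢ h)
  lift-⊑ (H _ _) (E _ _) h = ⊥-elim (⋢ h)
  lift-⊑ (T _)   bot     h = ⊥-elim (⋢ h)
  lift-⊑ (T _)   (V _)   h = ⊥-elim (⋢ h)
  lift-⊑ (T _)   (E _ _) h = ⊥-elim (⋢ h)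
  lift-⊑ (T _)   (H _ _) h = ⊥-elim (⋢ h)
  lift-⊑ top     bot     h = ⊥-elim (⋢ h)
  lift-⊑ top     (V _)   h = ⊥-elim (⋢ h)
  lift-⊑ top     (E _ _) h = ⊥-elim (⋢ h)
  lift-⊑ top     (H _ _) h = ⊥-elim (⋢ h)
  lift-⊑ top     (T _)   h = ⊥-elim (⋢ h)

  s≢0 : ¬ s ≋ 0ℤ mod r
  s≢0 e = 4s≢0 (*-cong e (≋-refl {x = + 4}))

  s*-injective : ∀ {x} → s * x ≋ 0ℤ mod r → x ≋ 0ℤ mod m
  s*-injective {x} e with x ≋? 0ℤ
  ... | yes x≋0 = x≋0
  ... | no  x≢0 with invertible-m x≢0
  ...   | n , f = contradiction (≋-trans (≋-trans (≡⇒≋ (≡.sym (ℤ.*-identityʳ s))) (s*-cong (≋-sym f)))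
                    (≋-trans (≡⇒≋ (identity n x s)) (≋-trans (*-congˡ n e) (≡⇒≋ (ℤ.*-zeroʳ n))))) s≢0
    where
    identity : ∀ n x s → s * (n * x) ≡ n * (s * x)
    identity = solve-∀

  halving : ∀ {n} → ∃[ h ] h * + 2 ≋ 1ℤ mod n → ∀ {d} → d + d ≋ 0ℤ mod n → d ≋ 0ℤ mod n
  halving (h , e) {d} f = ≋-trans (≋-trans (≡⇒≋ (≡.sym (ℤ.*-identityˡ d)))
      (*-cong (≋-sym e) (≋-refl {x = d})))
    (≋-trans (≡⇒≋ (identity h d)) (≋-trans (*-congˡ h f) (≡⇒≋ (ℤ.*-zeroʳ h))))
    where
    identity : ∀ h d → h * + 2 * d ≡ h * (d + d)
    identity = solve-∀

  private
    d≋0⇒≋ : ∀ {x y n} → y - x ≋ 0ℤ mod n → x ≋ y mod n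
    d≋0⇒≋ {x} {y} {n} e = ≋-linear (- 1ℤ) 0ℤ e (identity x y n)
      where
      identity : ∀ x y n → x - y ≡ - 1ℤ * (y - x - 0ℤ) + 0ℤ * n
      identity = solve-∀

  module Faithful (T₀≁Tₛ : ¬ T 0ℤ ~ T s) where

    T-injective : ∀ {t t′} → T t ~ T t′ → t ≋ t′ mod r
    T-injective {t} {t′} h with (t′ - t) ≋? 0ℤ
    ... | yes e   = d≋0⇒≋ e
    ... | no  d≢0 with reaches-s d≢0
    ...   | n , e = contradiction (generates T T-shiftable
                      (~-coerce (T (≡⇒≋ (ℤ.+-inverseʳ t))) ≈-refl (γ-~ (- t) h)) {n} e) T₀≁Tₛ

    -- A 2-face is recovered from its two facets, which are already told apart: one gives `j`, the
    -- other `s * (l + l)` and thereby `l` modulo `m`. Facets matched in the opposite order would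
    -- make 2 vanish modulo `m`.
    H-injective : ∀ {j j′ l l′} → H j l ~ H j′ l′ → j ≋ j′ mod r × l ≋ l′ mod m
    H-injective {j} {j′} {l} {l′} h = cases
      (facet {j′} (H≤T (inj₁ ≋-refl))) (facet {successor j′ l′} (H≤T (inj₂ ≋-refl)))
      where
      facet : ∀ {t} → H j′ l′ ≤ T t → t ≋ j mod r ⊎ t ≋ successor j l mod r
      facet i = Sum.map T-injective T-injective (H⊑T {j} {l} (⊑-trans (~⇒⊑ h) (≤⇒⊑ i)))

      identity₁ : ∀ l l′ j s r → s * (l′ - l + (l′ - l)) - 0ℤ ≡
                  1ℤ * (j + 1ℤ + s * (l′ + l′) - (j + 1ℤ + s * (l + l))) + 0ℤ * r
      identity₁ = solve-∀
      identity₂ : ∀ j j′ m → + 2 - 0ℤ ≡ 1ℤ * (j′ + 1ℤ - j) + - 1ℤ * (j′ - (j + 1ℤ)) + 0ℤ * m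
      identity₂ = solve-∀

      cases : j′ ≋ j mod r ⊎ j′ ≋ successor j l mod r →
              successor j′ l′ ≋ j mod r ⊎ successor j′ l′ ≋ successor j l mod r → j ≋ j′ mod r × l ≋ l′ mod m
      cases (inj₁ d) (inj₁ e) = contradiction (≋-trans e (≋-sym d)) (successor≢ j′ l′)
      cases (inj₂ d) (inj₂ e) = contradiction (≋-trans e (≋-sym d)) (successor≢ j′ l′)
      cases (inj₁ d) (inj₂ e) = ≋-sym d , d≋0⇒≋ (halving (invertible-m 2≢0) (s*-injective
        (≋-linear 1ℤ 0ℤ (≋-trans (successor-cong (≋-sym d) (≋-refl {x = l′})) e) (identity₁ l l′ j s r))))
      cases (inj₂ d) (inj₁ e) = contradiction (≋-combine 1ℤ (- 1ℤ) 0ℤ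
        (≋-trans (≋-sym (successor-mod-m j′ l′)) (mod-r⇒mod-m e))
            (≋-trans (mod-r⇒mod-m d) (successor-mod-m j l))
        (identity₂ j j′ m)) 2≢0

    -- Otherwise `E 0ℤ 0ℤ ~ E 0ℤ 1ℤ`, and `H 0ℤ 1ℤ` would be a third 2-face between this edge and
    -- `T 0ℤ`, as `H-injective` separates it from the other two.
    E-injective₂ : ∀ {x x′ y y′} → E x y ~ E x′ y′ → y ≋ y′ mod m
    E-injective₂ {x} {x′} {y} {y′} h with (y′ - y) ≋? 0ℤ
    ... | yes e   = d≋0⇒≋ e
    ... | no  e≢0 = ⊥-elim (collapsed (generates-all (E 0ℤ) (E₂-shiftable 0ℤ) (invertible-m e≢0) origin 1ℤ))
      where
      origin : E 0ℤ 0ℤ ~ E 0ℤ (y′ - y)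
      origin = ~-coerce (E (≡⇒≋ (ℤ.+-inverseʳ x)) (≡⇒≋ (ℤ.+-inverseʳ y)))
        (E (≋-trans (+-congʳ (- x) (≋-sym (E-injective₁ h))) (≡⇒≋ (ℤ.+-inverseʳ x))) ≋-refl)
            (ζ-~ (- y) (α-~ (- x) h))

      collapsed : ¬ E 0ℤ 0ℤ ~ E 0ℤ 1ℤ
      collapsed e = [ (λ f → 1≢0 (proj₂ (H-injective f))) ,
          (λ f → predecessor≢ 0ℤ 0ℤ (≋-sym (proj₁ (H-injective f)))) ]′
        (E⊑H⊑T {0ℤ} {0ℤ} {0ℤ} {1ℤ} {0ℤ} (⊑-trans (~⇒⊑ e) (≤⇒⊑ (E≤H ≋-refl))) (≤⇒⊑ (H≤T (inj₁ ≋-refl))))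

    ~⇒≈ : ∀ F G → F ~ G → F ≈ G
    ~⇒≈ F G h = same F G (~⇒rank {F} {G} h) h
      where
      same : ∀ F G → rank F ≡ rank G → F ~ G → F ≈ G
      same bot     bot       _ _ = bot
      same (V _)   (V _)     _ h = V (V-injective h)
      same (E _ _) (E _ _)   _ h = E (E-injective₁ h) (E-injective₂ h)
      same (H _ _) (H _ _)   _ h = H (proj₁ (H-injective h)) (proj₂ (H-injective h))
      same (T _)   (T _)     _ h = T (T-injective h)
      same top     top       _ _ = top

    isomorphism : Isomorphism polytope Q
    isomorphism = record
      { to                 = C.map
      ; isOrderIsomorphism = record
        { isOrderMonomorphism = record
          { isOrderHomomorphism = record { cong = C.cong ; mono = C.mono }
          ; injective           = λ {F} {G} → ~⇒≈ F G
          ; cancel              = λ {F} {G} → cancel F G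
          }
        ; surjective = λ G → proj₁ (C.surjective G) , λ e → Q.Eq.trans (C.cong e) (proj₂ (C.surjective G))
        }
      }
      where
      cancel : ∀ F G → F ⊑ G → F ≤ G
      cancel F G h with lift-⊑ F G h
      ... | F′ , G′ , d , e , F′≤G′ = ≤-trans (≤-reflexive (~⇒≈ F F′ d))
          (≤-trans F′≤G′ (≤-reflexive (≈-sym (~⇒≈ G G′ e))))

  -- If the central element γ s acts trivially on Q then so do the defects of
  -- the reflection ϑ, which therefore acts on Q.
  module Reflexible (T₀~Tₛ : T 0ℤ ~ T s) where

    T-shift : ∀ t k → T t ~ T (t + s * k)
    T-shift t k = ~-coerce (T (≡⇒≋ (ℤ.+-identityˡ t))) (T (≡⇒≋ (ℤ.+-comm (s * k) t)))
      (γ-~ t (generates T T-shiftable T₀~Tₛ {k} (≡⇒≋ (ℤ.*-comm k s))))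

    -- As `T s` is identified with `T 0ℤ`, the 2-face `H s 0ℤ` lies between `E 0ℤ 0ℤ` and `T 0ℤ`, so
    -- it is `H 0ℤ 0ℤ` or `H (- 1ℤ) 0ℤ`. The latter would identify `H 0ℤ 0ℤ` with its shift by
    -- `-1 - s`, a unit modulo `r`, and hence all `H j 0ℤ`.
    H-shift₀ : H 0ℤ 0ℤ ~ H s 0ℤ
    H-shift₀ = [ ~-sym , (λ e → ⊥-elim (H≁H 0ℤ 0ℤ 0ℤ
        (generates-all (λ j → H j 0ℤ) (H₁-shiftable 0ℤ) (invertible-r -1-s≢0) (turn e) (0ℤ - 1ℤ - s * 0ℤ))))
        ]′
      (E⊑H⊑T {0ℤ} {0ℤ} {s} {0ℤ} {0ℤ} (≤⇒⊑ (E≤H (≡⇒≋ refl)))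
          (⊑-trans (≤⇒⊑ (H≤T {s} {0ℤ} {s} (inj₁ ≋-refl))) (~⇒⊑ (~-sym T₀~Tₛ))))
      where
      identity : ∀ s → 0ℤ - 1ℤ - s * 0ℤ + - s ≡ - 1ℤ - s * 1ℤ
      identity = solve-∀

      turn : H s 0ℤ ~ H (0ℤ - 1ℤ - s * 0ℤ) 0ℤ → H 0ℤ 0ℤ ~ H (- 1ℤ - s * 1ℤ) 0ℤ
      turn e = ~-coerce (H (≡⇒≋ (ℤ.+-inverseʳ s)) ≋-refl) (H (≡⇒≋ (identity s)) ≋-refl) (γ-~ (- s) e)

      -1-s≢0 : ¬ - 1ℤ - s * 1ℤ ≋ 0ℤ mod m
      -1-s≢0 e = 1≢0 (≋-trans (neg-cong (≋-trans (≋-sym (-s*≋ (- 1ℤ) 1ℤ)) e)) ≋-refl)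

    H-shift : ∀ j l k → H j l ~ H (j + s * k) l
    H-shift j l k = ~-coerce (H (≡⇒≋ (ℤ.+-identityˡ j)) ≋-refl) (H (≡⇒≋ (ℤ.+-comm (s * k) j)) ≋-refl)
      (γ-~ j (~-coerce (≈-trans (ζ-H₀ l 0ℤ) (H ≋-refl (≡⇒≋ (ℤ.+-identityˡ l))))
          (H shift (≡⇒≋ (ℤ.+-identityˡ l)))
        (ζ-~ l (generates (λ j → H j 0ℤ) (H₁-shiftable 0ℤ) H-shift₀ {k} (≡⇒≋ (ℤ.*-comm k s))))))
      where
      shift : s * k + s * ((l + l) * (s * k)) ≋ s * k mod r
      shift = ≋-trans (+-congˡ (s * k) (≋-trans
          (s*-cong (≋-trans (*-congˡ (l + l) (s*≋0 k)) (≡⇒≋ (ℤ.*-zeroʳ (l + l))))) (≡⇒≋ (ℤ.*-zeroʳ s))))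
        (≡⇒≋ (ℤ.+-identityʳ (s * k)))

    -- `H-shift` absorbs the correction in `ζᶠ`, which thus acts on labels as a plain translation.
    ζ-H : ∀ n {j j′ l l′} → H j l ~ H j′ l′ → H j (l + n) ~ H j′ (l′ + n)
    ζ-H n {j} {j′} h = ~-trans (H-shift j _ ((n + n) * j))
        (~-trans (ζ-~ n h) (~-sym (H-shift j′ _ ((n + n) * j′))))

    ϑ : Face → Face
    ϑ bot     = bot
    ϑ (V i)   = V (- 1ℤ - i)
    ϑ (E x y) = E (- x) (- y)
    ϑ (H j l) = H j (- l)
    ϑ (T t)   = T t
    ϑ top     = top

    ϑ-ϑ : ∀ F → ϑ (ϑ F) ≈ F
    ϑ-ϑ bot     = bot
    ϑ-ϑ (V i)   = V (≡⇒≋ (identity i))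
      where
      identity : ∀ i → - 1ℤ - (- 1ℤ - i) ≡ i
      identity = solve-∀
    ϑ-ϑ (E x y) = E (≡⇒≋ (ℤ.neg-involutive x)) (≡⇒≋ (ℤ.neg-involutive y))
    ϑ-ϑ (H j l) = H ≋-refl (≡⇒≋ (ℤ.neg-involutive l))
    ϑ-ϑ (T t)   = ≈-refl
    ϑ-ϑ top     = top

    ϑ-mono : ∀ {F G} → F ≤ G → ϑ F ⊑ ϑ G
    ϑ-mono bot≤      = ≤⇒⊑ bot≤
    ϑ-mono ≤top      = ≤⇒⊑ ≤top
    ϑ-mono (V≤V e)   = ~⇒⊑ (≈⇒~ (V (+-congˡ (- 1ℤ) (neg-cong e))))
    ϑ-mono (E≤E d e) = ~⇒⊑ (≈⇒~ (E (neg-cong d) (neg-cong e)))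
    ϑ-mono (H≤H d e) = ~⇒⊑ (≈⇒~ (H d (neg-cong e)))
    ϑ-mono (T≤T e)   = ~⇒⊑ (≈⇒~ (T e))
    ϑ-mono (V≤E {i} {x} (inj₁ e)) = ≤⇒⊑ (V≤E (inj₂
        (≋-trans (+-congˡ (- 1ℤ) (neg-cong e)) (≡⇒≋ (ℤ.+-comm (- 1ℤ) (- x))))))
    ϑ-mono (V≤E {i} {x} (inj₂ e)) = ≤⇒⊑ (V≤E (inj₁
        (≋-trans (+-congˡ (- 1ℤ) (neg-cong e)) (≡⇒≋ (identity x)))))
      where
      identity : ∀ x → - 1ℤ - (x - 1ℤ) ≡ - x
      identity = solve-∀
    ϑ-mono (E≤H {x} {y} {j} e) = ≤⇒⊑ (E≤H (≋-trans (neg-cong e) (≡⇒≋ (identity x y j))))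
      where
      identity : ∀ x y j → - (y + x * j) ≡ - y + - x * j
      identity = solve-∀
    ϑ-mono (H≤T (inj₁ e)) = ≤⇒⊑ (H≤T (inj₁ e))
    -- The only incidence that `ϑ` disturbs. The facets disagree by `4sl`, which `T-shift` absorbs.
    ϑ-mono (H≤T {j} {l} (inj₂ e)) = ⊑-trans (≤⇒⊑ (H≤T {t = successor j (- l)} (inj₂ ≋-refl)))
      (~⇒⊑ (~-coerce ≈-refl (T (≋-trans (≡⇒≋ (identity j l s)) (≋-sym e)))
          (T-shift (successor j (- l)) (l + l + (l + l)))))
      where
      identity : ∀ j l s → j + 1ℤ + s * (- l + - l) + s * (l + l + (l + l)) ≡ j + 1ℤ + s * (l + l)
      identity = solve-∀
    ϑ-mono V≤H = ≤⇒⊑ V≤H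
    ϑ-mono V≤T = ≤⇒⊑ V≤T
    ϑ-mono E≤T = ≤⇒⊑ E≤T

    -- Applying `τ` and `γ 1ℤ` gives `H 0ℤ 0ℤ ~ H (- d) e` as well. Comparison of the two yields a
    -- shift by `d + d` with no change of label; 2 is a unit modulo `r`, so `d` can be split off.
    -- What remains is a translation of the label by `e`, which can be inverted.
    ϑ-H₀ : ∀ {d e} → H 0ℤ 0ℤ ~ H d e → H 0ℤ 0ℤ ~ H d (- e)
    ϑ-H₀ {d} {e} h = ~-trans base~d d~d-e
      where
      identity₁ : ∀ e → - (0ℤ + 1ℤ + e * 0ℤ) + 1ℤ ≡ 0ℤ
      identity₁ = solve-∀
      identity₂ : ∀ d e s → - (d + 1ℤ + s * (e + e)) + 1ℤ + s * (e + e) ≡ - d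
      identity₂ = solve-∀
      identity₃ : ∀ k d → k * (d + d) ≡ k * + 2 * d
      identity₃ = solve-∀

      opposite : H 0ℤ 0ℤ ~ H (- d) e
      opposite = ~-trans (~-coerce (H (≡⇒≋ (identity₁ s)) ≋-refl) ≈-refl (γ-~ 1ℤ (τ-~ h)))
        (~-coerce ≈-refl (H (≡⇒≋ (identity₂ d e s)) ≋-refl) (H-shift (- successor d e + 1ℤ) e (e + e)))

      doubled : H 0ℤ 0ℤ ~ H (d + d) 0ℤ
      doubled = ~-sym (~-coerce (H ≋-refl (≡⇒≋ (ℤ.+-inverseʳ e)))
          (H (≡⇒≋ (ℤ.+-inverseˡ d)) (≡⇒≋ (ℤ.+-inverseʳ e)))
        (ζ-H (- e) (γ-~ d (~-trans (~-sym h) opposite))))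

      base~d : H 0ℤ 0ℤ ~ H d 0ℤ
      base~d = generates (λ j → H j 0ℤ) (H₁-shiftable 0ℤ) doubled {proj₁ (invertible-r 2≢0)}
        (≋-trans (≡⇒≋ (identity₃ (proj₁ (invertible-r 2≢0)) d))
          (≋-trans (*-cong (proj₂ (invertible-r 2≢0)) (≋-refl {x = d})) (≡⇒≋ (ℤ.*-identityˡ d))))

      d~d-e : H d 0ℤ ~ H d (- e)
      d~d-e = ~-coerce (H ≋-refl (≡⇒≋ (ℤ.+-inverseʳ e))) (H ≋-refl (≡⇒≋ (ℤ.+-identityˡ (- e))))
        (ζ-H (- e) (~-trans (~-sym h) base~d))

    ϑ-~ : ∀ F G → F ~ G → ϑ F ~ ϑ G
    ϑ-~ F G h = same F G (~⇒rank {F} {G} h) h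
      where
      same : ∀ F G → rank F ≡ rank G → F ~ G → ϑ F ~ ϑ G
      same bot     bot       _ _ = Q.Eq.refl
      same (V _)   (V _)     _ h = ≈⇒~ (V (+-congˡ (- 1ℤ) (neg-cong (V-injective h))))
      -- Translation by `- (x + x′)` and `- (y + y′)` takes each edge of the pair to the negative of
      -- the other.
      same (E x y) (E x′ y′) _ h = ~-sym (~-coerce
        (E (≡⇒≋ (identity₁ x x′)) (≡⇒≋ (identity₁ y y′))) (E (≡⇒≋ (identity₂ x x′)) (≡⇒≋ (identity₂ y y′)))
        (ζ-~ (- (y + y′)) (α-~ (- (x + x′)) h)))
        where
        identity₁ : ∀ x x′ → x + - (x + x′) ≡ - x′
        identity₁ = solve-∀
        identity₂ : ∀ x x′ → x′ + - (x + x′) ≡ - x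
        identity₂ = solve-∀
      same (H j l) (H j′ l′) _ h = ~-coerce (H (≡⇒≋ (ℤ.+-identityˡ j)) (≡⇒≋ (ℤ.+-identityˡ (- l))))
          (H (≡⇒≋ (identity₁ j j′)) (≡⇒≋ (identity₂ l l′)))
        (γ-~ j (ζ-H (- l) (ϑ-H₀ (~-coerce (H (≡⇒≋ (ℤ.+-inverseʳ j)) (≡⇒≋ (ℤ.+-inverseʳ l))) ≈-refl
            (ζ-H (- l) (γ-~ (- j) h))))))
        where
        identity₁ : ∀ j j′ → j′ + - j + j ≡ j′
        identity₁ = solve-∀
        identity₂ : ∀ l l′ → - (l′ + - l) + - l ≡ - l′
        identity₂ = solve-∀
      same (T _)   (T _)     _ h = h
      same top     top       _ _ = Q.Eq.refl

    ϑ-⊑ : ∀ F G → F ⊑ G → ϑ F ⊑ ϑ G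
    ϑ-⊑ F G h with lift-⊑ F G h
    ... | F′ , G′ , d , e , F′≤G′ = ⊑-trans (~⇒⊑ (ϑ-~ F F′ d))
        (⊑-trans (ϑ-mono F′≤G′) (~⇒⊑ (~-sym (ϑ-~ G G′ e))))

    reflection : Isomorphism Q Q
    reflection = mutually-inverse⇒isomorphism Q Q ϱ ϱ ϱ-mono ϱ-mono ϱ-ϱ ϱ-ϱ
      where
      preimage : Q.Face → Face
      preimage G = proj₁ (C.surjective G)

      map-preimage : ∀ G → C.map (preimage G) Q.≈ G
      map-preimage G = proj₂ (C.surjective G)

      ϱ : Q.Face → Q.Face
      ϱ G = C.map (ϑ (preimage G))

      ϱ-mono : ∀ {F G} → F Q.≤ G → ϱ F Q.≤ ϱ G
      ϱ-mono {F} {G} h = ϑ-⊑ (preimage F) (preimage G)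
        (Poset.≤-respˡ-≈ Q.faces (Q.Eq.sym (map-preimage F))
            (Poset.≤-respʳ-≈ Q.faces (Q.Eq.sym (map-preimage G)) h))

      ϱ-ϱ : ∀ G → ϱ (ϱ G) Q.≈ G
      ϱ-ϱ G = Q.Eq.trans (ϑ-~ (preimage (ϱ G)) (ϑ (preimage G)) (map-preimage (ϱ G)))
        (Q.Eq.trans (≈⇒~ (ϑ-ϑ (preimage G))) (map-preimage G))

    impossible : ⊥
    impossible = proj₂ Q-chiral zero (C.mapFlag Φ) (C.mapFlag (toFlag (adj zero base)))
      (C.adjacency zero Φ (toFlag (adj zero base)) (adj-adjacent zero base))
      (reflection , λ i → Q.Eq.trans (ϑ-~ (proj₁ (C.surjective (C.map (face Φ i)))) (face Φ i)
          (proj₂ (C.surjective (C.map (face Φ i)))))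
        (≈⇒~ (image i)))
      where
      image : ∀ i → ϑ (face Φ i) ≈ face (toFlag (adj zero base)) i
      image zero = bot
      image 1F = ≈-refl
      image 2F = ≈-refl
      image 3F = ≈-refl
      image 4F = ≈-refl
      image 5F = top

  -- Whether `T 0ℤ ~ T s` holds cannot be decided for an arbitrary `Q`, but `Reflexible` refutes it
  -- outright, and its negation is what `Faithful` requires.
  covering-not-proper : ¬ ¬ Isomorphism polytope Q
  covering-not-proper ≇ = T₀≁Tₛ (λ e → Reflexible.impossible e)
    where
    T₀≁Tₛ : ¬ ¬ T 0ℤ ~ T s
    T₀≁Tₛ h = ≇ (Faithful.isomorphism h)

-- Counting flags

bit : Fin 2 → Bool
bit zero = false
bit 1F = true

bit⁻¹ : Bool → Fin 2
bit⁻¹ false = zero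
bit⁻¹ true  = suc zero

bit-bit⁻¹ : ∀ b → bit (bit⁻¹ b) ≡ b
bit-bit⁻¹ false = refl
bit-bit⁻¹ true  = refl

bit⁻¹-bit : ∀ a → bit⁻¹ (bit a) ≡ a
bit⁻¹-bit zero       = refl
bit⁻¹-bit 1F = refl

module FlagCount (m r : ℕ) .{{_ : ℕ.NonZero m}} .{{_ : ℕ.NonZero r}} (w κ : ℤ) (1≢0 : ¬ 1ℤ ≋ 0ℤ mod (+ m))
                 (r≡ : w * + m * + m ≡ + r) where
  open Modulus (+ m) w κ using (successor; successor-cong)
  open Order (+ m) w κ
  open Sections (+ m) w κ 1≢0
  open Construction (+ m) w κ 1≢0
  open FlagGraph (+ m) w κ 1≢0

  -- The bracketing is that of `2 * p * q * r` in `Tight` with `q = 2 * m`: one factor `2 * m` holds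
  -- `δ` and `x`, the other `η` and `y`.
  Code : Set
  Code = Fin (2 ℕ.* m ℕ.* (2 ℕ.* m) ℕ.* r)

  encode : Fin 2 → Fin m → Fin 2 → Fin m → Fin r → Code
  encode a x b y j = combine (combine (combine a x) (combine b y)) j

  indexOf : Fin 2 → Fin m → Fin 2 → Fin m → Fin r → FlagIndex
  indexOf a x b y j = ⟪ bit a , + toℕ x , + toℕ y , + toℕ j , bit b ⟫

  decode₁ : Fin 2 × Fin m → Fin 2 × Fin m → Fin r → FlagIndex
  decode₁ (a , x) (b , y) = indexOf a x b y

  decode₂ : Fin (2 ℕ.* m) × Fin (2 ℕ.* m) → Fin r → FlagIndex
  decode₂ (c , d) = decode₁ (remQuot m c) (remQuot m d)

  decode₃ : Fin (2 ℕ.* m ℕ.* (2 ℕ.* m)) × Fin r → FlagIndex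
  decode₃ (u , j) = decode₂ (remQuot (2 ℕ.* m) u) j

  decode : Code → FlagIndex
  decode i = decode₃ (remQuot r i)

  code : FlagIndex → Code
  code ⟪ δ , x , y , j , η ⟫ = encode (bit⁻¹ δ) (class m x) (bit⁻¹ η) (class m y) (class r j)

  decode-encode : ∀ a x b y j → decode (encode a x b y j) ≡ indexOf a x b y j
  decode-encode a x b y j =
    ≡.trans (cong decode₃ (Fin.remQuot-combine (combine (combine a x) (combine b y)) j))
    (≡.trans (cong (λ z → decode₂ z j) (Fin.remQuot-combine (combine a x) (combine b y)))
             (cong₂ (λ z z′ → decode₁ z z′ j) (Fin.remQuot-combine a x) (Fin.remQuot-combine b y)))

  code-decode : ∀ i → code (decode i) ≡ i
  code-decode i = ≡.trans (code₃ (remQuot r i)) (Fin.combine-remQuot {2 ℕ.* m ℕ.* (2 ℕ.* m)} r i)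
    where
    join : Fin (2 ℕ.* m) → Fin (2 ℕ.* m) → Fin r → Code
    join u v = combine (combine u v)

    code₁ : ∀ p q j → code (decode₁ p q j) ≡ join (uncurry combine p) (uncurry combine q) j
    code₁ (a , x) (b , y) j
      rewrite bit⁻¹-bit a | bit⁻¹-bit b | class-toℕ m x | class-toℕ m y | class-toℕ r j = refl

    code₂ : ∀ p j → code (decode₂ p j) ≡ join (proj₁ p) (proj₂ p) j
    code₂ (c , d) j = ≡.trans (code₁ (remQuot m c) (remQuot m d) j)
      (cong₂ (λ u v → join u v j) (Fin.combine-remQuot m c) (Fin.combine-remQuot m d))

    code₃ : ∀ p → code (decode₃ p) ≡ combine (proj₁ p) (proj₂ p)
    code₃ (u , j) = ≡.trans (code₂ (remQuot (2 ℕ.* m) u) j)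
        (cong (λ v → combine v j) (Fin.combine-remQuot {2 ℕ.* m} (2 ℕ.* m) u))

  decode-code : ∀ p → toFlag (decode (code p)) ≈ᶠ toFlag p
  decode-code ⟪ δ , x , y , j , η ⟫ = subst (λ p → toFlag p ≈ᶠ toFlag ⟪ δ , x , y , j , η ⟫)
      (≡.sym (≡.trans (decode-encode (bit⁻¹ δ) (class m x) (bit⁻¹ η) (class m y) (class r j))
        (cong₂ (λ b c → ⟪ b , + toℕ (class m x) , + toℕ (class m y) , + toℕ (class r j) , c ⟫) (bit-bit⁻¹ δ)
            (bit-bit⁻¹ η))))
      (toFlag-cong δ η (≋-sym (≋-class m x)) (≋-sym (≋-class m y)) (≋-cast (≡.sym r≡) (≋-sym (≋-class r j))))

  private
    δ-injective : ∀ {x x′} δ δ′ → x ≋ x′ mod (+ m) → V (vertexOf δ x) ≈ V (vertexOf δ′ x′) → δ ≡ δ′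
    δ-injective false false _ _ = refl
    δ-injective true  true  _ _ = refl
    δ-injective false true  e h = contradiction (≈-trans (≈-sym h) (V e)) V-1≉V
    δ-injective true  false e h = contradiction (≈-trans h (≈-sym (V e))) V-1≉V

    η-injective : ∀ {j j′ l l′} η η′ → H j l ≈ H j′ l′ → T (facetOf η j l) ≈ T (facetOf η′ j′ l′) → η ≡ η′
    η-injective false false _ _ = refl
    η-injective true  true  _ _ = refl
    η-injective {j} {j′} {l} {l′} false true (H d _) h = contradiction (≈-trans (≈-sym h) (T d))
        (T-successor≉T {j′} {l′})
    η-injective {j} {j′} {l} {l′} true false (H d _) h = contradiction (≈-trans h (≈-sym (T d)))
        (T-successor≉T {j} {l})

  code-cong : ∀ p q → toFlag p ≈ᶠ toFlag q → code p ≡ code q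
  code-cong ⟪ δ , x , y , j , η ⟫ ⟪ δ′ , x′ , y′ , j′ , η′ ⟫ h =
    equal (h 2F) (h 3F)
      where
      equal : E x y ≈ E x′ y′ → H j (y + x * j) ≈ H j′ (y′ + x′ * j′) →
              code ⟪ δ , x , y , j , η ⟫ ≡ code ⟪ δ′ , x′ , y′ , j′ , η′ ⟫
      equal (E dx dy) (H dj dl)
        rewrite δ-injective δ δ′ dx (h 1F) | η-injective η η′ (H dj dl) (h 4F)
              | class-≋ m dx | class-≋ m dy | class-≋ r (≋-cast r≡ dj) = refl

  flag-count : Inverse (setoid Code) (flags polytope)
  flag-count = record
    { to        = λ i → toFlag (decode i)
    ; from      = λ Φ → code (proj₁ (flag-index Φ))
    ; to-cong   = λ { refl → ≈ᶠ-refl {toFlag (decode _)} }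
    ; from-cong = λ {Φ} {Ψ} e → code-cong _ _
        (≈ᶠ-trans {toFlag (proj₁ (flag-index Φ))} {Φ} {toFlag (proj₁ (flag-index Ψ))} (proj₂ (flag-index Φ))
        (≈ᶠ-trans {Φ} {Ψ} {toFlag (proj₁ (flag-index Ψ))} e
            (≈ᶠ-sym {toFlag (proj₁ (flag-index Ψ))} {Ψ} (proj₂ (flag-index Ψ)))))
    ; inverse   =
        (λ { {Φ} refl → ≈ᶠ-trans {toFlag (decode (code (proj₁ (flag-index Φ))))}
            {toFlag (proj₁ (flag-index Φ))} {Φ}
               (decode-code (proj₁ (flag-index Φ))) (proj₂ (flag-index Φ)) }) ,
        (λ {i} {Φ} e → ≡.trans (code-cong _ (decode i)
            (≈ᶠ-trans {toFlag (proj₁ (flag-index Φ))} {Φ} {toFlag (decode i)} (proj₂ (flag-index Φ)) e))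
            (code-decode i))
    }

-- Odd prime powers and the presented group

pos-^ : ∀ m n → + (m ℕ.^ n) ≡ (+ m) ^ n
pos-^ m zero    = refl
pos-^ m (suc n) = ≡.trans (ℤ.pos-* m (m ℕ.^ n)) (cong (λ t → + m * t) (pos-^ m n))

+≋0⇒∣ : ∀ {m n} → + n ≋ 0ℤ mod (+ m) → m ∣ n
+≋0⇒∣ {m} {n} e = subst (m ∣_) (cong ℤ.∣_∣ (ℤ.+-identityʳ (+ n))) (Signed.∣⇒∣ᵤ (≋⇒∣ e))

+≋0 : ∀ n → + n ≋ 0ℤ mod (+ n)
+≋0 n = mod 1ℤ (≡.sym (≡.trans (ℤ.+-identityˡ _) (ℤ.*-identityˡ (+ n))))

-- Such an `h` inverts 2 modulo `m`, which makes `κ = + k * h` a half of `k`.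
odd⇒half : ∀ m → 2 ∤ m → ∃[ h ] h + h ≡ + m + 1ℤ
odd⇒half m 2∤m with m ℕ.% 2 | ℕ.m≡m%n+[m/n]*n m 2 | ℕ.m%n<n m 2
... | 0 | e | _ = contradiction (divides (m ℕ./ 2) e) 2∤m
... | 1 | e | _ = + (m ℕ./ 2) + 1ℤ , ≡.trans (identity (+ (m ℕ./ 2)))
      (cong (λ t → t + 1ℤ) (≡.sym (≡.trans (cong +_ e) (cong (λ t → 1ℤ + t) (ℤ.pos-* (m ℕ./ 2) 2)))))
  where
  identity : ∀ q → q + 1ℤ + (q + 1ℤ) ≡ 1ℤ + q * + 2 + 1ℤ
  identity = solve-∀
... | suc (suc _) | _ | ℕ.s≤s (ℕ.s≤s ())

module Theorem (m β k : ℕ) (m-prime : Prime m) (2∤m : 2 ∤ m) (1≤k : 1 ℕ.≤ k) (k≤m-1 : k ℕ.≤ m ℕ.∸ 1) where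

  private
    q R : ℕ
    q = m ℕ.^ suc (suc β)
    R = 1 ℕ.+ k ℕ.* m ℕ.^ suc β

    w h κ : ℤ
    w = + (m ℕ.^ β)
    h = proj₁ (odd⇒half m 2∤m)
    κ = + k * h

    2h≡m+1 : h + h ≡ + m + 1ℤ
    2h≡m+1 = proj₂ (odd⇒half m 2∤m)

    instance
      m≢0 : ℕ.NonZero m
      m≢0 = prime⇒nonZero m-prime

      q≢0 : ℕ.NonZero q
      q≢0 = ℕ.m^n≢0 m (suc (suc β))

    1<m : 1 ℕ.< m
    1<m = ℕ.nonTrivial⇒n>1 m {{prime⇒nonTrivial m-prime}}

    2<m : 2 ℕ.< m
    2<m = ℕ.≤∧≢⇒< 1<m (λ e → 2∤m (divides 1 (≡.sym e)))

    1≢0 : ¬ 1ℤ ≋ 0ℤ mod (+ m)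
    1≢0 e = contradiction (<⇒≋⇒≡ m 1<m (ℕ.>-nonZero⁻¹ m) e) λ ()

    2≢0 : ¬ + 2 ≋ 0ℤ mod (+ m)
    2≢0 e = contradiction (<⇒≋⇒≡ m 2<m (ℕ.>-nonZero⁻¹ m) e) λ ()

    r≡q : w * + m * + m ≡ + q
    r≡q = ≡.trans (identity w (+ m)) (≡.sym (≡.trans (ℤ.pos-* m (m ℕ.^ suc β))
        (cong (λ t → + m * t) (ℤ.pos-* m (m ℕ.^ β)))))
      where
      identity : ∀ w m → w * m * m ≡ m * (m * w)
      identity = solve-∀

  open Modulus (+ m) w κ
  open Order (+ m) w κ
  open Sections (+ m) w κ 1≢0
  open Construction (+ m) w κ 1≢0
  open FlagGraph (+ m) w κ 1≢0
  open Automorphisms (+ m) w κ 1≢0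
  open Orbits (+ m) w κ 1≢0

  private
    r≡power : r ≡ (+ m) ^ suc (suc β)
    r≡power = ≡.trans r≡q (pos-^ m (suc (suc β)))

    2s≋ : + R ≋ 1ℤ + (s + s) mod r
    -- Because `h + h` is `m + 1`, the number `s + s` exceeds `k * m ^ suc β` by exactly `k * r`.
    2s≋ = mod (- + k) (≡.trans (cong (λ t → 1ℤ + t)
        (≡.trans (ℤ.pos-* k (m ℕ.^ suc β)) (cong (λ t → + k * t) (ℤ.pos-* m (m ℕ.^ β)))))
      (≡.trans (identity₁ (+ k) (+ m) w) (≡.trans
          (cong (λ t → 1ℤ + + k * t * w * + m + - + k * r) (≡.sym 2h≡m+1)) (identity₂ (+ k) h w (+ m) r))))
      where
      identity₁ : ∀ k m w → 1ℤ + k * (m * w) ≡ 1ℤ + k * (m + 1ℤ) * w * m + - k * (w * m * m)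
      identity₁ = solve-∀
      identity₂ : ∀ k h w m r → 1ℤ + k * (h + h) * w * m + - k * r ≡ 1ℤ + (k * h * w * m + k * h * w * m) +
          - k * r
      identity₂ = solve-∀

    -- Cancelling `w * m` from the equation turns it into `m` dividing `2k(m + 1)`, hence `2k`. As
    -- `m` is an odd prime and `k` lies strictly between 0 and `m`, this is impossible.
    4s≢0 : ¬ s * + 4 ≋ 0ℤ mod r
    4s≢0 (mod t e) = [ (λ m∣2 → ℕ.<⇒≱ 2<m (∣⇒≤ m∣2)) , (λ m∣k → ℕ.<⇒≱ k<m (∣⇒≤ {{ℕ.>-nonZero 1≤k}} m∣k)) ]′
      (euclidsLemma 2 k m-prime (+≋0⇒∣ (mod (t - + 2 * + k)
          (≡.trans (ℤ.pos-* 2 k) (≡.trans (identity₃ (+ k) (+ m))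
          (≡.trans (cong (λ a → a - + 2 * + k * + m) cancelled) (identity₄ t (+ k) (+ m))))))))
      where
      k<m : k ℕ.< m
      k<m = ℕ.≤-trans (ℕ.s≤s k≤m-1) (ℕ.≤-reflexive (ℕ.suc-pred m))

      wm≢0 : ℤ.NonZero (w * + m)
      wm≢0 = subst ℤ.NonZero (ℤ.pos-* (m ℕ.^ β) m)
          (ℤ.≢-nonZero (λ f → ℕ.≢-nonZero⁻¹ (m ℕ.^ β ℕ.* m) {{ℕ.m*n≢0 (m ℕ.^ β) m {{ℕ.m^n≢0 m β}}}}
          (ℤ.+-injective f)))

      identity₁ : ∀ k m h w → + 2 * k * (h + h) * (w * m) ≡ k * h * w * m * + 4
      identity₁ = solve-∀
      identity₂ : ∀ t w m → 0ℤ + t * (w * m * m) ≡ t * m * (w * m)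
      identity₂ = solve-∀
      identity₃ : ∀ k m → + 2 * k ≡ + 2 * k * (m + 1ℤ) - + 2 * k * m
      identity₃ = solve-∀
      identity₄ : ∀ t k m → t * m - + 2 * k * m ≡ 0ℤ + (t - + 2 * k) * m
      identity₄ = solve-∀

      cancelled : + 2 * + k * (+ m + 1ℤ) ≡ t * + m
      cancelled = ℤ.*-cancelʳ-≡ _ _ (w * + m)
          {{wm≢0}} (≡.trans (cong (λ a → + 2 * + k * a * (w * + m)) (≡.sym 2h≡m+1))
        (≡.trans (identity₁ (+ k) (+ m) h w) (≡.trans e (identity₂ t w (+ m)))))

    invertible-r : ∀ {d} → ¬ d ≋ 0ℤ mod (+ m) → ∃[ n ] n * d ≋ 1ℤ mod r
    invertible-r d≢0 with invertible-^ m-prime d≢0 (suc (suc β))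
    ... | n , e = n , ≋-cast (≡.sym r≡power) e

    reaches-s : ∀ {d} → ¬ d ≋ 0ℤ mod r → ∃[ n ] n * d ≋ s mod r
    reaches-s {d} d≢0 with multiple-≋-power m-prime (suc β) (λ e → d≢0 (≋-cast (≡.sym r≡power) e))
    ... | n , e = κ * n , ≋-trans (≡⇒≋ (ℤ.*-assoc κ n d)) (≋-trans (*-congˡ κ (≋-cast (≡.sym r≡power) e))
          (≡⇒≋ (≡.trans (cong (λ t → κ * (+ m * t)) (≡.sym (pos-^ m β))) (identity κ (+ m) w))))
      where
      identity : ∀ κ m w → κ * (m * w) ≡ κ * w * m
      identity = solve-∀

  open Chirality (+ m) w κ 1≢0 4s≢0

  tight : Tight polytope
  tight = m , 2 ℕ.* m , q , hasType m q w κ 1≢0 r≡q , FlagCount.flag-count m q w κ 1≢0 r≡q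

  atomic : Atomic polytope
  atomic = tight , chiral , λ Q _ Q-chiral (covering , ≇) →
    CoveredBy.covering-not-proper (+ m) w κ 1≢0 4s≢0 (invertible m-prime) invertible-r reaches-s 2≢0 Q
        Q-chiral covering ≇

  private
    α′ : ℕ
    α′ = suc (suc β)

    module Λ = Group (Λ₁ m α′ k)

    power-cong : ∀ {x y n} → x ≡ y → Presented (Λ₁Rel m α′ k) (n ^ʷ x) 1ʷ → Presented (Λ₁Rel m α′ k)
        (n ^ʷ y) 1ʷ
    power-cong refl e = e

    σ₂-pairs : ∀ n → (σ₂ ^ʷ 2) ^ʷ n Λ.≈ σ₂ ^ʷ (n ℕ.* 2)
    σ₂-pairs zero    = Λ.refl
    σ₂-pairs (suc n) = Λ.trans (Λ.assoc σ₂ (σ₂ · 1ʷ) _)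
        (Λ.∙-congˡ (Λ.trans (Λ.∙-congʳ (Λ.identityʳ σ₂)) (Λ.∙-congˡ (σ₂-pairs n))))

    ζ^m : (σ₂ ^ʷ 2) ^ʷ m Λ.≈ 1ʷ
    ζ^m = Λ.trans (σ₂-pairs m) (power-cong (ℕ.*-comm 2 m) (rel (rotation σ₂^q)))

    open NormalForm {Λ₁Rel m α′ k} (ℕ.pred m) (ℕ.pred q) R
      (power-cong (≡.sym (ℕ.suc-pred m)) (rel (rotation σ₁^p))) (power-cong (≡.sym (ℕ.suc-pred m)) ζ^m)
      (power-cong (≡.sym (ℕ.suc-pred q)) (rel (rotation σ₃^r)))
      (rel (rotation [σ₁σ₂]²)) (rel (rotation [σ₂σ₃]²)) (rel (rotation [σ₁σ₂σ₃]²)) (rel σ₂²σ₁) (rel σ₃σ₂²)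

  φ-rel : ∀ {u v} → Λ₁Rel m α′ k u v → φ u ≈ᵃ φ v
  φ-rel (rotation σ₁^p)      F = ≈-trans (φ-σ₁^ m F) (≈-trans (αᶠ-≋ (+≋0 m) F) (αᶠ-0 F))
  φ-rel (rotation σ₂^q)      F = subst (λ n → to (φ (σ₂ ^ʷ n)) F ≈ F) (ℕ.*-comm m 2)
    (≈-trans (φ-σ₂^ m F) (≈-trans (ζᶠ-≋ (+≋0 m) F) (ζᶠ-0 F)))
  φ-rel (rotation σ₃^r)      F = ≈-trans (φ-σ₃^ q F) (≈-trans (γᶠ-≋ (≋-cast (≡.sym r≡q) (+≋0 q)) F) (γᶠ-0 F))
  φ-rel (rotation [σ₁σ₂]²)   = φ-[σ₁σ₂]²
  φ-rel (rotation [σ₂σ₃]²)   = φ-[σ₂σ₃]²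
  φ-rel (rotation [σ₁σ₂σ₃]²) = φ-[σ₁σ₂σ₃]²
  φ-rel σ₂²σ₁                = φ-σ₂²σ₁
  φ-rel σ₃σ₂²                = φ-σ₃σ₂² 2s≋

  φ-cong : ∀ {u v} → Presented (Λ₁Rel m α′ k) u v → φ u ≈ᵃ φ v
  φ-cong (rel h)                     = φ-rel h
  φ-cong (refl {u})                  = Aut.refl {φ u}
  φ-cong (sym {u} {v} e)             = Aut.sym {φ u} {φ v} (φ-cong e)
  φ-cong (trans {u} {v} {x} d e)     = Aut.trans {φ u} {φ v} {φ x} (φ-cong d) (φ-cong e)
  φ-cong (·-cong {u} {u′} {v} {v′} d e) = Aut.∙-cong {φ u} {φ u′} {φ v} {φ v′} (φ-cong d) (φ-cong e)
  φ-cong (⁻¹-cong {u} {v} e)         = Aut.⁻¹-cong {φ u} {φ v} (φ-cong e)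
  φ-cong (assoc u v x)               = Aut.assoc (φ u) (φ v) (φ x)
  φ-cong (identityˡ u)               = Aut.identityˡ (φ u)
  φ-cong (identityʳ u)               = Aut.identityʳ (φ u)
  φ-cong (inverseˡ u)                = Aut.inverseˡ (φ u)
  φ-cong (inverseʳ u)                = Aut.inverseʳ (φ u)

  private
    ζʷ : Word (Fin 3)
    ζʷ = σ₂ ^ʷ 2

    φ-normal : ∀ η i l j F → to (φ (normal η i l j)) F ≈ γᶠ (+ j) (ζᶠ (+ l) (αᶠ (+ i) (to (φ (τ^ η)) F)))
    φ-normal η i l j F = ≈-trans (φ-σ₃^ j _) (Isomorphism.cong (γ (+ j)) (≈-trans
      (φ-^ ζ ζᶠ-+ ζᶠ-0 {ζʷ} φ-σ₂² l _) (Isomorphism.cong (ζ (+ l)) (φ-σ₁^ i (to (φ (τ^ η)) F)))))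

    power-≈1 : ∀ {x n} → x ^ʷ n Λ.≈ 1ʷ → ∀ {i} → n ∣ i → x ^ʷ i Λ.≈ 1ʷ
    power-≈1 {x} {n} e (divides t refl) = multiple t
      where
      multiple : ∀ t → x ^ʷ (t ℕ.* n) Λ.≈ 1ʷ
      multiple zero    = Λ.refl
      multiple (suc t) = Λ.trans (Λ.sym (^ʷ-+ x n (t ℕ.* n)))
          (Λ.trans (Λ.∙-cong e (multiple t)) (Λ.identityˡ 1ʷ))

    V-inj : ∀ {i i′} → V i ≈ V i′ → i ≋ i′ mod (+ m)
    V-inj (V e) = e

    E-inj : ∀ {x x′ y y′} → E x y ≈ E x′ y′ → x ≋ x′ mod (+ m) × y ≋ y′ mod (+ m)
    E-inj (E d e) = d , e

    T-inj : ∀ {t t′} → T t ≈ T t′ → t ≋ t′ mod r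
    T-inj (T e) = e

    -- The exponents are visible on single faces: `V 0ℤ` shows `i`, then `E 0ℤ 0ℤ` shows `l`, and
    -- `T 0ℤ` shows `j`. If `τ` occurred, the edge would require `i` to be 0 and the vertex would
    -- require it to be 1 modulo `m`.
    trivial-normal : ∀ η i l j → (∀ F → γᶠ (+ j) (ζᶠ (+ l) (αᶠ (+ i) (to (φ (τ^ η)) F))) ≈ F) → normal η i l
        j Λ.≈ 1ʷ
    trivial-normal true i l j h = contradiction
      (≋-combine 1ℤ (- 1ℤ) 0ℤ (proj₁ (E-inj (h (E 0ℤ 0ℤ)))) (V-inj (h (V 0ℤ))) (identity (+ i) (+ m))) 1≢0
      where
      identity : ∀ i m → 1ℤ - 0ℤ ≡ 1ℤ * (0ℤ + i - 0ℤ) + - 1ℤ * (- 1ℤ + i - 0ℤ) + 0ℤ * m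
      identity = solve-∀
    trivial-normal false i l j h = Λ.trans (Λ.identityˡ _) (Λ.trans
      (Λ.∙-cong (power-≈1 (rel (rotation σ₁^p)) (+≋0⇒∣ i≋0)) (Λ.trans
        (Λ.∙-cong (power-≈1 ζ^m (+≋0⇒∣ l≋0)) (power-≈1 (rel (rotation σ₃^r)) (+≋0⇒∣ (≋-cast r≡q j≋0))))
            (Λ.identityˡ 1ʷ)))
      (Λ.identityˡ 1ʷ))
      where
      i≋0 : + i ≋ 0ℤ mod (+ m)
      i≋0 = ≋-trans (≡⇒≋ (≡.sym (ℤ.+-identityˡ (+ i)))) (V-inj (h (V 0ℤ)))

      identity : ∀ i l j m → l - 0ℤ ≡ 1ℤ * (0ℤ + l - j * (0ℤ + i) - 0ℤ) + j * (i - 0ℤ) + 0ℤ * m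
      identity = solve-∀

      l≋0 : + l ≋ 0ℤ mod (+ m)
      l≋0 = ≋-combine 1ℤ (+ j) 0ℤ (proj₂ (E-inj (h (E 0ℤ 0ℤ)))) i≋0 (identity (+ i) (+ l) (+ j) (+ m))

      j≋0 : + j ≋ 0ℤ mod r
      j≋0 = ≋-trans (≡⇒≋ (≡.sym (ℤ.+-identityˡ (+ j))))
          (T-inj (≈-trans (≈-sym (Isomorphism.cong (γ (+ j)) {y = T 0ℤ}
        (≈-trans (Isomorphism.cong (ζ (+ l)) {y = T 0ℤ} (α-T₀ (+ i))) (ζ-T₀ (+ l))))) (h (T 0ℤ))))

  -- Rewriting brings `u` into normal form, and the action detects whether that form is trivial;
  -- together they show that the presentation has no missing relations.
  φ-kernel : ∀ u → φ u ≈ᵃ Aut.ε → u Λ.≈ 1ʷ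
  φ-kernel u h with normalise u
  ... | η , i , l , j , e = Λ.trans e (trivial-normal η i l j (λ F →
    ≈-trans (≈-sym (φ-normal η i l j F)) (≈-trans (≈-sym (φ-cong e F)) (h F))))

  φ-injective : ∀ {u v} → φ u ≈ᵃ φ v → u Λ.≈ v
  φ-injective {u} {v} e = GroupProperties.x∙y⁻¹≈ε⇒x≈y (Λ₁ m α′ k) u v (φ-kernel (u · v ⁻¹ʷ)
    (Aut.trans {φ (u · v ⁻¹ʷ)} {φ v ∙ φ v Aut.⁻¹} {Aut.ε} (Aut.∙-congʳ {φ v Aut.⁻¹} {φ u} {φ v} e)
        (Aut.inverseʳ (φ v))))

  -- If the image of the base flag has even parity, a word already produces it, and rigidity
  -- applies. Odd parity would put `Φ` into the orbit of its 0-adjacent flag, contrary to chirality.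
  φ-surjective : ∀ f → Inner f
  φ-surjective f with flag-index (Φ ▹ f)
  ... | p , e = from-orbit (parity p) (orbit p)
    where
    from-orbit : ∀ b → InnerOrbit (baseFlag b) p → Inner f
    from-orbit false (g , inner , e′) = ≈-inner
        {g} {f} (automorphism-rigid {g} {f} (≈ᶠ-trans {Φ ▹ g} {toFlag p} {Φ ▹ f} e′ e)) inner
    from-orbit true  (g , inner , e′) = contradiction
      (sameOrbit-trans polytope {Φ} {toFlag p} {toFlag (adj zero base)}
        (f , ≈ᶠ-sym {toFlag p} {Φ ▹ f} e) (sameOrbit-sym polytope {toFlag (adj zero base)} {toFlag p}
            (g , e′)))
      (¬sameOrbit false)

  isAutomorphismGroup : IsAutomorphismGroup (Λ₁ m α′ k) gen polytope
  isAutomorphismGroup = Φ , φ , isGroupIsomorphism , σ-standard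
    where
    isGroupIsomorphism : IsGroupIsomorphism (Group.rawGroup (Λ₁ m α′ k)) (Group.rawGroup (Aut polytope)) φ
    isGroupIsomorphism = record
      { isGroupMonomorphism = record
        { isGroupHomomorphism = record
          { isMonoidHomomorphism = record
            { isMagmaHomomorphism = record
              { isRelHomomorphism = record { cong = φ-cong }
              ; homo = λ u v → Aut.refl {φ (u · v)}
              }
            ; ε-homo = Aut.refl {Aut.ε}
            }
          ; ⁻¹-homo = λ u → Aut.refl {φ (u ⁻¹ʷ)}
          }
        ; injective = φ-injective
        }
      ; surjective = λ f → proj₁ (φ-surjective f) , λ {v} e → Aut.trans {φ v} {φ (proj₁ (φ-surjective f))}
          {f} (φ-cong e) (proj₂ (φ-surjective f))
      }

theorem5p7 : (m α k : ℕ) → Prime m → 2 ∤ m → 2 ℕ.≤ α → 1 ℕ.≤ k → k ℕ.≤ m ℕ.∸ 1 →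
    Σ[ P ∈ Polytope 4 ]
    (HasType P (m ∷ 2 ℕ.* m ∷ m ℕ.^ α ∷ []) × Atomic P × IsAutomorphismGroup (Λ₁ m α k) gen P)
theorem5p7 m (suc (suc β)) k m-prime 2∤m (ℕ.s≤s (ℕ.s≤s _)) 1≤k k≤m-1 =
  _ , proj₁ (proj₂ (proj₂ (proj₂ tight))) , atomic , isAutomorphismGroup
  where open Theorem m β k m-prime 2∤m 1≤k k≤m-1
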